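{- Let $d\le N$ be positive integers and let $X, X'\in \mathbb{Z}^{d\times N}$ be matrices of rank $d$ that represent the same arithmetic matroid $\mathcal{A}=(E,\operatorname{rk},m)$ on $E=[N]$, and suppose that $\mathcal{A}$ is weakly multiplicative. Then there exist a matrix $T\in \mathrm{GL}(d,\mathbb{Z})$ and a diagonal matrix $D\in\mathbb{Z}^{N\times N}$ with diagonal entries in $\{1,-1\}$ such that $X' = T X D$.
   Context: For $X\in\mathbb{Z}^{d\times N}$ with columns $x_1,\dots,x_N$, the arithmetic matroid $\mathcal{A}(X)=([N],\operatorname{rk},m)$ represented by $X$ consists of the rank function $\operatorname{rk}(S)=\dim \langle x_e : e\in S\rangle_{\mathbb{R}}$ and the multiplicity function $m(S)=\bigl|(\langle S\rangle_{\mathbb{R}}\cap\mathbb{Z}^d)/\langle S\rangle\bigr|$ for $S\subseteq[N]$, where $\langle S\rangle\subseteq\mathbb{Z}^d$ is the subgroup generated by $\{x_e: e\in S\}$ and $\langle S\rangle_{\mathbb{R}}$ is the real span of the same vectors. Two matrices represent the same arithmetic matroid if their rank functions and multiplicity functions on subsets of $[N]$ coincide. A basis of $\mathcal{A}$ is a basis of the underlying matroid $([N],\operatorname{rk})$. The arithmetic matroid is torsion-free if $m(\emptyset)=1$ (automatic here). A basis $B$ is multiplicative if $m(B)=\prod_{x\in B} m(\{x\})$; a torsion-free arithmetic matroid is weakly multiplicative if it has at least one multiplicative basis. -}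

module Defs where

open import Algebra.Bundles using (CommutativeRing)
open import Data.Fin.Base using (Fin)
open import Data.Fin.Properties using (_≟_)
open import Data.Fin.Subset using (Subset; ⊤; ⁅_⁆; ∣_∣; _∉_; _⊆_) renaming (⊥ to ∅)
open import Data.Fin.Subset.Properties using (_∈?_)
open import Data.Integer.Base as ℤ using (ℤ; 0ℤ; 1ℤ; -1ℤ)
import Data.Integer.Properties as ℤ
open import Data.Integer.Solver using () renaming (module +-*-Solver to ℤ-+-*-Solver)
open import Data.List.Base using (map; filter; allFin)
open import Data.Nat.Base as ℕ using (ℕ)
open import Data.Nat.ListAction using (product)
import Data.Nat.Properties as ℕ
open import Data.Product.Base using (Σ; ∃-syntax; _×_; _,_)
open import Data.Rational.Base as ℚ using (ℚ; 0ℚ; 1ℚ; ½)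
import Data.Rational.Properties as ℚ
open import Data.Rational.Solver using (module +-*-Solver)
open import Data.Sum.Base using (_⊎_)
open import Data.Vec.Functional using (Vector)
open import Function.Bundles using (Bijection)
open import Level using (_⊔_; 0ℓ)
open import Relation.Binary.Bundles using (Setoid)
open import Relation.Binary.PropositionalEquality as ≡ using (_≡_; _≢_; refl; sym; trans; cong; subst)
open import Relation.Nullary.Decidable.Core using (yes; no)

-- ℝ is the setoid of Cauchy sequences of rationals, two sequences being equal
-- when their difference is null.
IsNull : (ℕ → ℚ) → Set
IsNull s = ∀ ε → 0ℚ ℚ.< ε → ∃[ n₀ ] (∀ n → n₀ ℕ.≤ n → ℚ.∣ s n ∣ ℚ.< ε)

IsCauchy : (ℕ → ℚ) → Set
IsCauchy s = ∀ ε → 0ℚ ℚ.< ε →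
  ∃[ n₀ ] (∀ m n → n₀ ℕ.≤ m → n₀ ℕ.≤ n → ℚ.∣ s m ℚ.- s n ∣ ℚ.< ε)

record ℝ : Set where
  constructor mkℝ
  field
    seq    : ℕ → ℚ
    cauchy : IsCauchy seq

open ℝ public

infix 4 _≈ℝ_

-- A record rather than a function, so that x and y can be inferred.
record _≈ℝ_ (x y : ℝ) : Set where
  constructor mk≈
  field
    null : IsNull (λ n → seq x n ℚ.- seq y n)

open _≈ℝ_ public

private
  abstract
    ⊔≤ˡ : ∀ m n {o} → m ℕ.⊔ n ℕ.≤ o → m ℕ.≤ o
    ⊔≤ˡ m n = ℕ.≤-trans (ℕ.m≤m⊔n m n)

    ⊔≤ʳ : ∀ m n {o} → m ℕ.⊔ n ℕ.≤ o → n ℕ.≤ o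
    ⊔≤ʳ m n = ℕ.≤-trans (ℕ.m≤n⊔m m n)

    0<½* : ∀ {ε} → 0ℚ ℚ.< ε → 0ℚ ℚ.< ½ ℚ.* ε
    0<½* {ε} 0<ε = ℚ.positive⁻¹ _ {{ℚ.pos*pos⇒pos ½ ε {{ℚ.positive 0<ε}}}}

    ½*+½* : ∀ ε → ½ ℚ.* ε ℚ.+ ½ ℚ.* ε ≡ ε
    ½*+½* ε = trans (sym (ℚ.*-distribʳ-+ ε ½ ½)) (ℚ.*-identityˡ ε)

    ∣+∣< : ∀ p q {ε} → ℚ.∣ p ∣ ℚ.< ½ ℚ.* ε → ℚ.∣ q ∣ ℚ.< ½ ℚ.* ε → ℚ.∣ p ℚ.+ q ∣ ℚ.< ε
    ∣+∣< p q {ε} p< q< = subst (ℚ.∣ p ℚ.+ q ∣ ℚ.<_) (½*+½* ε)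
      (ℚ.≤-<-trans (ℚ.∣p+q∣≤∣p∣+∣q∣ p q) (ℚ.+-mono-< p< q<))

    scale : ∀ {k} → 0ℚ ℚ.< k → ∀ {ε} → 0ℚ ℚ.< ε →
            ∃[ δ ] 0ℚ ℚ.< δ × (∀ p q → ℚ.∣ p ∣ ℚ.≤ k → ℚ.∣ q ∣ ℚ.< δ → ℚ.∣ p ℚ.* q ∣ ℚ.< ε)
    scale {k} 0<k {ε} 0<ε = δ , ℚ.positive⁻¹ δ , bound
      where
      instance
        k⁺ : ℚ.Positive k
        k⁺ = ℚ.positive 0<k
        k≥0 : ℚ.NonNegative k
        k≥0 = ℚ.pos⇒nonNeg k
        k≢0 : ℚ.NonZero k
        k≢0 = ℚ.pos⇒nonZero k
        ε⁺ : ℚ.Positive ε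
        ε⁺ = ℚ.positive 0<ε
      δ : ℚ
      δ = ℚ.1/ k ℚ.* ε
      instance
        1/k⁺ : ℚ.Positive (ℚ.1/ k)
        1/k⁺ = ℚ.1/pos⇒pos k
        δ⁺ : ℚ.Positive δ
        δ⁺ = ℚ.pos*pos⇒pos (ℚ.1/ k) ε
      kδ≡ε : k ℚ.* δ ≡ ε
      kδ≡ε = trans (sym (ℚ.*-assoc k (ℚ.1/ k) ε))
               (trans (cong (ℚ._* ε) (ℚ.*-inverseʳ k)) (ℚ.*-identityˡ ε))
      bound : ∀ p q → ℚ.∣ p ∣ ℚ.≤ k → ℚ.∣ q ∣ ℚ.< δ → ℚ.∣ p ℚ.* q ∣ ℚ.< ε
      bound p q p≤ q< = begin-strict
        ℚ.∣ p ℚ.* q ∣        ≡⟨ ℚ.∣p*q∣≡∣p∣*∣q∣ p q ⟩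
        ℚ.∣ p ∣ ℚ.* ℚ.∣ q ∣  ≤⟨ ℚ.*-monoʳ-≤-nonNeg ℚ.∣ q ∣ {{ℚ.∣-∣-nonNeg q}} p≤ ⟩
        k ℚ.* ℚ.∣ q ∣        <⟨ ℚ.*-monoʳ-<-pos k q< ⟩
        k ℚ.* δ              ≡⟨ kδ≡ε ⟩
        ε                    ∎
        where open ℚ.≤-Reasoning

    scaleʳ : ∀ {k} → 0ℚ ℚ.< k → ∀ {ε} → 0ℚ ℚ.< ε →
             ∃[ δ ] 0ℚ ℚ.< δ × (∀ p q → ℚ.∣ p ∣ ℚ.< δ → ℚ.∣ q ∣ ℚ.≤ k → ℚ.∣ p ℚ.* q ∣ ℚ.< ε)
    scaleʳ 0<k {ε} 0<ε = let δ , 0<δ , h = scale 0<k 0<ε in δ , 0<δ ,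
      λ p q p< q≤ → subst (λ z → ℚ.∣ z ∣ ℚ.< ε) (ℚ.*-comm q p) (h q p q≤ p<)

    bounded : ∀ {s} → IsCauchy s →
              ∃[ k ] 0ℚ ℚ.< k × ∃[ n₀ ] (∀ n → n₀ ℕ.≤ n → ℚ.∣ s n ∣ ℚ.≤ k)
    bounded {s} c = let n₀ , h = c 1ℚ (ℚ.positive⁻¹ 1ℚ) in
      1ℚ ℚ.+ ℚ.∣ s n₀ ∣
      , ℚ.positive⁻¹ _ {{ℚ.pos+nonNeg⇒pos 1ℚ ℚ.∣ s n₀ ∣ {{ℚ.∣-∣-nonNeg (s n₀)}}}}
      , n₀
      , λ n n₀≤n → begin
          ℚ.∣ s n ∣                              ≡⟨ cong ℚ.∣_∣ (split (s n) (s n₀)) ⟩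
          ℚ.∣ (s n ℚ.- s n₀) ℚ.+ s n₀ ∣          ≤⟨ ℚ.∣p+q∣≤∣p∣+∣q∣ (s n ℚ.- s n₀) (s n₀) ⟩
          ℚ.∣ s n ℚ.- s n₀ ∣ ℚ.+ ℚ.∣ s n₀ ∣      ≤⟨ ℚ.+-monoˡ-≤ ℚ.∣ s n₀ ∣ (ℚ.<⇒≤ (h n n₀ n₀≤n ℕ.≤-refl)) ⟩
          1ℚ ℚ.+ ℚ.∣ s n₀ ∣                      ∎
      where
      open ℚ.≤-Reasoning
      split : ∀ a b → a ≡ (a ℚ.- b) ℚ.+ b
      split = solve 2 (λ a b → a := (a :- b) :+ b) refl
        where open +-*-Solver

    +-cauchy : ∀ {s t} → IsCauchy s → IsCauchy t → IsCauchy (λ n → s n ℚ.+ t n)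
    +-cauchy {s} {t} cs ct ε 0<ε =
      let n₁ , h₁ = cs (½ ℚ.* ε) (0<½* 0<ε)
          n₂ , h₂ = ct (½ ℚ.* ε) (0<½* 0<ε)
      in n₁ ℕ.⊔ n₂ , λ m n ≤m ≤n →
      subst (λ z → ℚ.∣ z ∣ ℚ.< ε) (shuffle (s m) (s n) (t m) (t n))
        (∣+∣< (s m ℚ.- s n) (t m ℚ.- t n)
              (h₁ m n (⊔≤ˡ n₁ n₂ ≤m) (⊔≤ˡ n₁ n₂ ≤n))
              (h₂ m n (⊔≤ʳ n₁ n₂ ≤m) (⊔≤ʳ n₁ n₂ ≤n)))
      where
      shuffle : ∀ a b c d → (a ℚ.- b) ℚ.+ (c ℚ.- d) ≡ (a ℚ.+ c) ℚ.- (b ℚ.+ d)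
      shuffle = solve 4 (λ a b c d → (a :- b) :+ (c :- d) := (a :+ c) :- (b :+ d)) refl
        where open +-*-Solver

    neg-diff : ∀ a b → ℚ.∣ a ℚ.- b ∣ ≡ ℚ.∣ (ℚ.- a) ℚ.- (ℚ.- b) ∣
    neg-diff a b = trans (sym (ℚ.∣-p∣≡∣p∣ (a ℚ.- b)))
      (cong ℚ.∣_∣ (solve 2 (λ a b → :- (a :- b) := (:- a) :- (:- b)) refl a b))
      where open +-*-Solver

    neg-cauchy : ∀ {s} → IsCauchy s → IsCauchy (λ n → ℚ.- s n)
    neg-cauchy {s} cs ε 0<ε = let n₀ , h = cs ε 0<ε in n₀ , λ m n ≤m ≤n →
      subst (ℚ._< ε) (neg-diff (s m) (s n)) (h m n ≤m ≤n)

    product-diff : ∀ a b c d → a ℚ.* (b ℚ.- d) ℚ.+ (a ℚ.- c) ℚ.* d ≡ a ℚ.* b ℚ.- c ℚ.* d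
    product-diff = solve 4 (λ a b c d → a :* (b :- d) :+ (a :- c) :* d := a :* b :- c :* d) refl
      where open +-*-Solver

    *-cauchy : ∀ {s t} → IsCauchy s → IsCauchy t → IsCauchy (λ n → s n ℚ.* t n)
    *-cauchy {s} {t} cs ct ε 0<ε =
      let k , 0<k , nₛ , ≤k = bounded {s} cs
          l , 0<l , nₜ , ≤l = bounded {t} ct
          δ , 0<δ , hδ = scale 0<k (0<½* 0<ε)
          η , 0<η , hη = scaleʳ 0<l (0<½* 0<ε)
          n₁ , h₁ = ct δ 0<δ
          n₂ , h₂ = cs η 0<η
          a = λ {o} → ⊔≤ˡ (nₛ ℕ.⊔ nₜ) (n₁ ℕ.⊔ n₂) {o}
          b = λ {o} → ⊔≤ʳ (nₛ ℕ.⊔ nₜ) (n₁ ℕ.⊔ n₂) {o}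
          c₁ = λ {o} → ⊔≤ˡ n₁ n₂ {o}
          c₂ = λ {o} → ⊔≤ʳ n₁ n₂ {o}
      in (nₛ ℕ.⊔ nₜ) ℕ.⊔ (n₁ ℕ.⊔ n₂) , λ m n ≤m ≤n →
         subst (λ z → ℚ.∣ z ∣ ℚ.< ε) (product-diff (s m) (t m) (s n) (t n))
           (∣+∣< (s m ℚ.* (t m ℚ.- t n)) ((s m ℚ.- s n) ℚ.* t n)
             (hδ (s m) (t m ℚ.- t n) (≤k m (⊔≤ˡ nₛ nₜ (a ≤m))) (h₁ m n (c₁ (b ≤m)) (c₁ (b ≤n))))
             (hη (s m ℚ.- s n) (t n) (h₂ m n (c₂ (b ≤m)) (c₂ (b ≤n))) (≤l n (⊔≤ʳ nₛ nₜ (a ≤n)))))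

≗⇒≈ℝ : ∀ {x y : ℝ} → (∀ n → seq x n ≡ seq y n) → x ≈ℝ y
≗⇒≈ℝ {x} {y} eq = mk≈ λ ε 0<ε → 0 , λ n _ →
  subst (λ z → ℚ.∣ z ∣ ℚ.< ε)
    (sym (trans (cong (ℚ._- seq y n) (eq n)) (ℚ.+-inverseʳ (seq y n)))) 0<ε

infixl 6 _+ℝ_
infixl 7 _*ℝ_
infix 8 -ℝ_

_+ℝ_ : ℝ → ℝ → ℝ
x +ℝ y = mkℝ (λ n → seq x n ℚ.+ seq y n) (+-cauchy {seq x} {seq y} (cauchy x) (cauchy y))

_*ℝ_ : ℝ → ℝ → ℝ
x *ℝ y = mkℝ (λ n → seq x n ℚ.* seq y n) (*-cauchy {seq x} {seq y} (cauchy x) (cauchy y))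

-ℝ_ : ℝ → ℝ
-ℝ x = mkℝ (λ n → ℚ.- seq x n) (neg-cauchy {seq x} (cauchy x))

fromℚ : ℚ → ℝ
fromℚ q = mkℝ (λ _ → q) λ ε 0<ε → 0 , λ _ _ _ _ →
  subst (λ z → ℚ.∣ z ∣ ℚ.< ε) (sym (ℚ.+-inverseʳ q)) 0<ε

fromℤ : ℤ → ℝ
fromℤ i = fromℚ (i ℚ./ 1)

private
  abstract
    ≈-refl : ∀ {x} → x ≈ℝ x
    ≈-refl = ≗⇒≈ℝ (λ _ → refl)

    ≈-sym : ∀ {x y} → x ≈ℝ y → y ≈ℝ x
    ≈-sym {x} {y} x≈y = mk≈ λ ε 0<ε → let n₀ , h = null x≈y ε 0<ε in n₀ , λ n ≤n → subst (ℚ._< ε) (swap (seq x n) (seq y n)) (h n ≤n)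
      where
      swap : ∀ a b → ℚ.∣ a ℚ.- b ∣ ≡ ℚ.∣ b ℚ.- a ∣
      swap a b = trans (sym (ℚ.∣-p∣≡∣p∣ (a ℚ.- b)))
        (cong ℚ.∣_∣ (solve 2 (λ a b → :- (a :- b) := b :- a) refl a b))
        where open +-*-Solver

    null-+ : ∀ {s t u} → IsNull s → IsNull t → (∀ n → s n ℚ.+ t n ≡ u n) → IsNull u
    null-+ {s} {t} hs ht eq ε 0<ε =
      let n₁ , h₁ = hs (½ ℚ.* ε) (0<½* 0<ε)
          n₂ , h₂ = ht (½ ℚ.* ε) (0<½* 0<ε)
      in n₁ ℕ.⊔ n₂ , λ n ≤n →
      subst (λ z → ℚ.∣ z ∣ ℚ.< ε) (eq n)
        (∣+∣< (s n) (t n) (h₁ n (⊔≤ˡ n₁ n₂ ≤n)) (h₂ n (⊔≤ʳ n₁ n₂ ≤n)))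

    ≈-trans : ∀ {x y z} → x ≈ℝ y → y ≈ℝ z → x ≈ℝ z
    ≈-trans {x} {y} {z} p q = mk≈ (null-+ (null p) (null q) λ n → telescope (seq x n) (seq y n) (seq z n))
      where
      telescope : ∀ a b c → (a ℚ.- b) ℚ.+ (b ℚ.- c) ≡ a ℚ.- c
      telescope = solve 3 (λ a b c → (a :- b) :+ (b :- c) := a :- c) refl
        where open +-*-Solver

    +-cong : ∀ {x y u v} → x ≈ℝ y → u ≈ℝ v → x +ℝ u ≈ℝ y +ℝ v
    +-cong {x} {y} {u} {v} p q = mk≈ (null-+ (null p) (null q) λ n → shuffle (seq x n) (seq y n) (seq u n) (seq v n))
      where
      shuffle : ∀ a b c d → (a ℚ.- b) ℚ.+ (c ℚ.- d) ≡ (a ℚ.+ c) ℚ.- (b ℚ.+ d)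
      shuffle = solve 4 (λ a b c d → (a :- b) :+ (c :- d) := (a :+ c) :- (b :+ d)) refl
        where open +-*-Solver

    neg-cong : ∀ {x y} → x ≈ℝ y → -ℝ x ≈ℝ -ℝ y
    neg-cong {x} {y} p = mk≈ λ ε 0<ε → let n₀ , h = null p ε 0<ε in n₀ , λ n ≤n → subst (ℚ._< ε) (neg-diff (seq x n) (seq y n)) (h n ≤n)

    null-*ˡ : ∀ {s t} → IsCauchy s → IsNull t → IsNull (λ n → s n ℚ.* t n)
    null-*ˡ {s} {t} cs ht ε 0<ε =
      let k , 0<k , n₁ , ≤k = bounded {s} cs
          δ , 0<δ , hδ = scale 0<k 0<ε
          n₂ , h = ht δ 0<δ
      in n₁ ℕ.⊔ n₂ , λ n ≤n →
        hδ (s n) (t n) (≤k n (⊔≤ˡ n₁ n₂ ≤n)) (h n (⊔≤ʳ n₁ n₂ ≤n))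

    *-cong : ∀ {x y u v} → x ≈ℝ y → u ≈ℝ v → x *ℝ u ≈ℝ y *ℝ v
    *-cong {x} {y} {u} {v} p q = mk≈ (null-+
        (null-*ˡ {seq x} {λ n → seq u n ℚ.- seq v n} (cauchy x) (null q))
        (null-*ˡ {seq v} {λ n → seq x n ℚ.- seq y n} (cauchy v) (null p)) λ n →
        shuffle (seq x n) (seq u n) (seq y n) (seq v n))
      where
      shuffle : ∀ a b c d → a ℚ.* (b ℚ.- d) ℚ.+ d ℚ.* (a ℚ.- c) ≡ a ℚ.* b ℚ.- c ℚ.* d
      shuffle = solve 4 (λ a b c d → a :* (b :- d) :+ d :* (a :- c) := a :* b :- c :* d) refl
        where open +-*-Solver

ℝ-commutativeRing : CommutativeRing 0ℓ 0ℓ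
ℝ-commutativeRing = record
  { Carrier = ℝ
  ; _≈_ = _≈ℝ_
  ; _+_ = _+ℝ_
  ; _*_ = _*ℝ_
  ; -_ = -ℝ_
  ; 0# = fromℚ 0ℚ
  ; 1# = fromℚ 1ℚ
  ; isCommutativeRing = record
    { isRing = record
      { +-isAbelianGroup = record
        { isGroup = record
          { isMonoid = record
            { isSemigroup = record
              { isMagma = record
                { isEquivalence = record
                  { refl  = ≈-refl
                  ; sym   = ≈-sym
                  ; trans = ≈-trans
                  }
                ; ∙-cong = +-cong
                }
              ; assoc = λ x y z → ≗⇒≈ℝ λ n → ℚ.+-assoc (seq x n) (seq y n) (seq z n)
              }
            ; identity = (λ x → ≗⇒≈ℝ λ n → ℚ.+-identityˡ (seq x n))
                       , (λ x → ≗⇒≈ℝ λ n → ℚ.+-identityʳ (seq x n))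
            }
          ; inverse = (λ x → ≗⇒≈ℝ λ n → ℚ.+-inverseˡ (seq x n))
                    , (λ x → ≗⇒≈ℝ λ n → ℚ.+-inverseʳ (seq x n))
          ; ⁻¹-cong = neg-cong
          }
        ; comm = λ x y → ≗⇒≈ℝ λ n → ℚ.+-comm (seq x n) (seq y n)
        }
      ; *-cong = *-cong
      ; *-assoc = λ x y z → ≗⇒≈ℝ λ n → ℚ.*-assoc (seq x n) (seq y n) (seq z n)
      ; *-identity = (λ x → ≗⇒≈ℝ λ n → ℚ.*-identityˡ (seq x n))
                   , (λ x → ≗⇒≈ℝ λ n → ℚ.*-identityʳ (seq x n))
      ; distrib = (λ x y z → ≗⇒≈ℝ λ n → ℚ.*-distribˡ-+ (seq x n) (seq y n) (seq z n))
                , (λ x y z → ≗⇒≈ℝ λ n → ℚ.*-distribʳ-+ (seq x n) (seq y n) (seq z n))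
      }
    ; *-comm = λ x y → ≗⇒≈ℝ λ n → ℚ.*-comm (seq x n) (seq y n)
    }
  }

module LinearAlgebra {c ℓ} (R : CommutativeRing c ℓ) where

  open CommutativeRing R using (Carrier; _≈_; _+_; _*_; 0#)
  private module R = CommutativeRing R
  open import Algebra.Properties.Semiring.Sum R.semiring
    using (sum; sum-cong-≋; ∑-distrib-+; sum-replicate-zero; *-distribˡ-sum)
  import Relation.Binary.Reasoning.Setoid R.setoid as ≈-Reasoning

  combination : ∀ {d n} → (Fin n → Carrier) → (Fin n → Vector Carrier d) → Vector Carrier d
  combination a x i = sum (λ e → a e * x e i)

  -- The R-submodule of Rᵈ generated by { x e : e ∈ S }.
  Span : ∀ {d n} → (Fin n → Vector Carrier d) → Subset n → Vector Carrier d → Set (c ⊔ ℓ)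
  Span {n = n} x S v = Σ (Fin n → Carrier) λ a →
    (∀ e → e ∉ S → a e ≈ 0#) × (∀ i → v i ≈ combination a x i)

  LinearlyIndependent : ∀ {d r} → (Fin r → Vector Carrier d) → Set (c ⊔ ℓ)
  LinearlyIndependent b = ∀ a → (∀ i → combination a b i ≈ 0#) → ∀ k → a k ≈ 0#

  HasDimension : ∀ {d w} → (Vector Carrier d → Set w) → ℕ → Set (c ⊔ ℓ ⊔ w)
  HasDimension {d} W r = Σ (Fin r → Vector Carrier d) λ b →
    LinearlyIndependent b × (∀ k → W (b k)) × (∀ v → W v → Span b ⊤ v)

  Span-0 : ∀ {d n} (x : Fin n → Vector Carrier d) S {v} → (∀ i → v i ≈ 0#) → Span x S v
  Span-0 {n = n} x S {v} v≈0 = (λ _ → 0#) , (λ _ _ → R.refl) , λ i →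
    R.trans (v≈0 i) (R.sym (R.trans (sum-cong-≋ {n = n} (λ e → R.zeroˡ (x e i))) (sum-replicate-zero n)))

  Span-+ : ∀ {d n} (x : Fin n → Vector Carrier d) S {u v w} →
           Span x S u → Span x S v → (∀ i → w i ≈ u i + v i) → Span x S w
  Span-+ {n = n} x S {u} {v} {w} (a , a∉ , u≈) (b , b∉ , v≈) w≈ =
    (λ e → a e + b e)
    , (λ e e∉ → R.trans (R.+-cong (a∉ e e∉) (b∉ e e∉)) (R.+-identityˡ 0#))
    , λ i → begin
        w i                                       ≈⟨ w≈ i ⟩
        u i + v i                                 ≈⟨ R.+-cong (u≈ i) (v≈ i) ⟩
        combination a x i + combination b x i     ≈⟨ ∑-distrib-+ {n} (λ e → a e * x e i) (λ e → b e * x e i) ⟨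
        sum (λ e → a e * x e i + b e * x e i)     ≈⟨ sum-cong-≋ {n = n} (λ e → R.distribʳ (x e i) (a e) (b e)) ⟨
        combination (λ e → a e + b e) x i         ∎
    where open ≈-Reasoning

  Span-* : ∀ {d n} (x : Fin n → Vector Carrier d) S {v w} r →
           Span x S v → (∀ i → w i ≈ r * v i) → Span x S w
  Span-* {n = n} x S {v} {w} r (a , a∉ , v≈) w≈ =
    (λ e → r * a e)
    , (λ e e∉ → R.trans (R.*-congˡ (a∉ e e∉)) (R.zeroʳ r))
    , λ i → begin
        w i                               ≈⟨ w≈ i ⟩
        r * v i                           ≈⟨ R.*-congˡ (v≈ i) ⟩
        r * combination a x i             ≈⟨ *-distribˡ-sum {n} r (λ e → a e * x e i) ⟩
        sum (λ e → r * (a e * x e i))     ≈⟨ sum-cong-≋ {n = n} (λ e → R.*-assoc r (a e) (x e i)) ⟨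
        combination (λ e → r * a e) x i   ∎
    where open ≈-Reasoning

module ℤ-Linear = LinearAlgebra ℤ.+-*-commutativeRing
module ℝ-Linear = LinearAlgebra ℝ-commutativeRing

open import Algebra.Properties.Semiring.Sum ℤ.+-*-semiring using () renaming (sum to ∑ℤ)

Matrix : ℕ → ℕ → Set
Matrix m n = Fin m → Fin n → ℤ

infix 4 _≐_

_≐_ : ∀ {m n} → Matrix m n → Matrix m n → Set
X ≐ Y = ∀ i j → X i j ≡ Y i j

infixl 7 _⊡_

_⊡_ : ∀ {l m n} → Matrix l m → Matrix m n → Matrix l n
(X ⊡ Y) i k = ∑ℤ (λ j → X i j ℤ.* Y j k)

identity : ∀ {n} → Matrix n n
identity i j with i ≟ j
... | yes _ = 1ℤ
... | no  _ = 0ℤ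

InGL : ∀ {n} → Matrix n n → Set
InGL {n} T = Σ (Matrix n n) λ U → T ⊡ U ≐ identity × U ⊡ T ≐ identity

IsSignDiagonal : ∀ {n} → Matrix n n → Set
IsSignDiagonal D = (∀ i j → i ≢ j → D i j ≡ 0ℤ) × (∀ i → D i i ≡ 1ℤ ⊎ D i i ≡ -1ℤ)

column : ∀ {d N} → Matrix d N → Fin N → Vector ℤ d
column X e i = X i e

ℤ-span : ∀ {d N} → Matrix d N → Subset N → Vector ℤ d → Set
ℤ-span X = ℤ-Linear.Span (column X)

ℝ-span : ∀ {d N} → Matrix d N → Subset N → Vector ℝ d → Set
ℝ-span X = ℝ-Linear.Span (λ e i → fromℤ (column X e i))

-- HasRank X S r says rk(S) = dim ⟨S⟩_ℝ = r.
HasRank : ∀ {d N} → Matrix d N → Subset N → ℕ → Set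
HasRank X S r = ℝ-Linear.HasDimension (ℝ-span X S) r

-- The group (⟨S⟩_ℝ ∩ ℤᵈ) / ⟨S⟩, as a setoid.
TorsionQuotient : ∀ {d N} → Matrix d N → Subset N → Setoid 0ℓ 0ℓ
TorsionQuotient {d} X S = record
  { Carrier = Σ (Vector ℤ d) λ v → ℝ-span X S (λ i → fromℤ (v i))
  ; _≈_ = λ (u , _) (v , _) → ℤ-span X S (λ i → u i ℤ.- v i)
  ; isEquivalence = record
    { refl = λ {(u , _)} → ℤ-Linear.Span-0 (column X) S (λ i → ℤ.+-inverseʳ (u i))
    ; sym = λ {(u , _)} {(v , _)} u~v →
        ℤ-Linear.Span-* (column X) S -1ℤ u~v
          (λ i → trans (swap (u i) (v i)) (sym (ℤ.-1*i≡-i (u i ℤ.- v i))))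
    ; trans = λ {(u , _)} {(v , _)} {(w , _)} u~v v~w →
        ℤ-Linear.Span-+ (column X) S u~v v~w (λ i → telescope (u i) (v i) (w i))
    }
  }
  where
  open ℤ-+-*-Solver
  swap : ∀ a b → b ℤ.- a ≡ ℤ.- (a ℤ.- b)
  swap = solve 2 (λ a b → b :- a := :- (a :- b)) refl
  telescope : ∀ a b c → a ℤ.- c ≡ (a ℤ.- b) ℤ.+ (b ℤ.- c)
  telescope = solve 3 (λ a b c → a :- c := (a :- b) :+ (b :- c)) refl

-- HasMultiplicity X S k says m(S) = k: the quotient has exactly k classes.
HasMultiplicity : ∀ {d N} → Matrix d N → Subset N → ℕ → Set
HasMultiplicity X S k = Bijection (TorsionQuotient X S) (≡.setoid (Fin k))

-- Only the data of an arithmetic matroid: its axioms are consequences of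
-- `Represents X 𝒜`, and only represented arithmetic matroids occur below.
record ArithmeticMatroidData (N : ℕ) : Set where
  field
    rk : Subset N → ℕ
    m  : Subset N → ℕ

module _ {N : ℕ} (𝒜 : ArithmeticMatroidData N) where

  open ArithmeticMatroidData 𝒜

  IsIndependent : Subset N → Set
  IsIndependent S = rk S ≡ ∣ S ∣

  IsBasis : Subset N → Set
  IsBasis B = IsIndependent B × (∀ C → IsIndependent C → B ⊆ C → C ⊆ B)

  IsTorsionFree : Set
  IsTorsionFree = m ∅ ≡ 1

  IsMultiplicative : Subset N → Set
  IsMultiplicative B = m B ≡ product (map (λ e → m ⁅ e ⁆) (filter (_∈? B) (allFin N)))

  IsWeaklyMultiplicative : Set
  IsWeaklyMultiplicative = IsTorsionFree × ∃[ B ] (IsBasis B × IsMultiplicative B)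

record Represents {d N : ℕ} (X : Matrix d N) (𝒜 : ArithmeticMatroidData N) : Set where
  open ArithmeticMatroidData 𝒜
  field
    rank         : ∀ S → HasRank X S (rk S)
    multiplicity : ∀ S → HasMultiplicity X S (m S)

{-# OPTIONS --safe #-}
module Submission where

-- After a multiplicative basis B is made diagonal, both matrices have coordinates A and A′ in which the
-- columns of B agree. If φ is a functional of content g whose kernel is spanned by the columns in U, then
-- m(U ∪ e) g = m(U) |φ(e)| unless φ(e) = 0, which the rank detects; hence |φ(e)| is determined by the
-- arithmetic matroid, the functional and e. Sign changes making A and A′ agree are found column by column.
-- If the new column is a⁺ + a⁻ in A and a⁺ − a⁻ in A′, the rows of a⁻ have to be negated, together with
-- everything connected to them through the old columns. This is possible because a row of a⁺ connected to
-- a⁻ would give, along a shortest path, a functional φ with |φ(a⁺) + φ(a⁻)| = |φ(a⁺) − φ(a⁻)| and both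
-- values nonzero.

open import Algebra.Bundles using (CommutativeRing)
open import Data.Bool.Base using (true; false; if_then_else_)
open import Data.Fin.Base using (Fin; zero; suc; punchIn; toℕ; fromℕ<; remQuot; combine)
open import Data.Fin.Properties using (_≟_; all?; any?; ¬∀⟶∃¬; ¬Fin0; injective⇒≤; combine-remQuot; combine-injective; toℕ-fromℕ<; toℕ-injective; toℕ<n)
open import Data.Fin.Subset using (Subset; ∣_∣; _∉_; _∈_; ⊤; _⊆_; _∪_; ⁅_⁆) renaming (⊥ to ∅)
open import Data.Fin.Subset.Properties
open import Data.Integer.Base as ℤ using (ℤ; 0ℤ; 1ℤ; -1ℤ; +_; -[1+_])
open import Data.Integer.DivMod using (_/ℕ_; _%ℕ_; n%ℕd<d; a≡a%ℕn+[a/ℕn]*n)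
import Data.Integer.Properties as ℤ
open import Data.List.Base using (List; []; _∷_; map; filter; tabulate; allFin)
open import Data.List.Membership.Propositional using () renaming (_∈_ to _∈ˡ_)
open import Data.List.Membership.Propositional.Properties using (∈-allFin)
open import Data.List.Relation.Unary.Any using () renaming (here to hereˡ; there to thereˡ)
open import Data.Nat.Base as ℕ using (ℕ; zero; suc; _≤_)
open import Data.Nat.Divisibility using (divides)
open import Data.Nat.GCD using (GCD; module Bézout)
open import Data.Nat.ListAction using (product)
import Data.Nat.Properties as ℕ
open import Data.Product.Base using (Σ; ∃-syntax; _×_; _,_; proj₁; proj₂)
open import Data.Rational.Base as ℚ using (ℚ; 0ℚ; 1ℚ; ½)
import Data.Rational.Properties as ℚ
open import Data.Rational.Solver using () renaming (module +-*-Solver to ℚ-Solver)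
import Data.Rational.Unnormalised.Base as ℚᵘ
import Data.Rational.Unnormalised.Properties as ℚᵘ
open import Data.Sum.Base using (_⊎_; inj₁; inj₂; [_,_]′)
open import Data.Vec.Base as Vec using (_∷_; []; here; there)
open import Data.Vec.Functional as Vector using (Vector; insertAt)
open import Data.Vec.Functional.Properties using (insertAt-lookup; insertAt-punchIn)
open import Data.Vec.Properties using (lookup∘tabulate; lookup⇒[]=; []=⇒lookup)
open import Defs
open import Function.Base using (_∘_)
open import Function.Bundles using (Bijection)
open import Function.Definitions using (Injective)
open import Level as Level using (Level; _⊔_; 0ℓ)
open import Relation.Binary.Bundles using (Setoid)
open import Relation.Binary.PropositionalEquality as ≡ using (_≡_; _≢_)
open import Relation.Nullary.Decidable using (_×-dec_; _⊎-dec_; ¬?; decidable-stable)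
open import Relation.Nullary.Decidable.Core using (Dec; does; yes; no)
open import Relation.Nullary.Negation.Core using (¬_; contradiction)
open import Relation.Unary using (Decidable)

-- Multiplicativity of `B` is what makes the coordinates integral. The columns of `B`, divided by
-- their multiplicities, generate a sublattice of ℤᵈ of index m(B) / ∏ m({e}); index one gives a
-- lattice basis `P` with an integral dual `Q`, and `A = Q X`. A sign equivalence of `A` and `A′`
-- then yields T = P′ diag(σ) Q, invertible over ℤ and not merely over ℚ. Rows of `A` are indexed by
-- all of [N] and vanish off `B`, which avoids choosing a bijection between `B` and [d]. Ranks are
-- dimensions over Cauchy reals, where no nonzero entry can be searched for. Integer facts are
-- therefore drawn from real spans by testing with integer functionals, whose vanishing is
-- decidable, and dimensions are compared by elimination without division. A functional yields a
-- comparison only if one set U spans its kernel in both coordinate systems. This is why functionals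
-- are built from columns that already match. Along a shortest path the construction stays explicit:
-- a newly reached row vanishes on every earlier column except its own diagonal one.

-- Linear algebra over a commutative ring.

module RingLinear {ℓ₁ ℓ₂} (R : CommutativeRing ℓ₁ ℓ₂) where
  open CommutativeRing R hiding (zero)
  open LinearAlgebra R
  open import Algebra.Properties.Ring ring using (-‿distribˡ-*)
  open import Algebra.Properties.Semiring.Sum semiring public
    using (sum; sum-cong-≋; ∑-distrib-+; ∑-comm; sum-remove; sum-replicate-zero; *-distribˡ-sum; *-distribʳ-sum)
  open import Algebra.Properties.CommutativeSemigroup *-commutativeSemigroup using (x∙yz≈y∙xz)
  open import Relation.Binary.Reasoning.Setoid setoid

  -- Binds tighter than multiplication: `a * u · v` is `a` times a dot product.
  infix 8 _·_

  _·_ : ∀ {n} → Vector Carrier n → Vector Carrier n → Carrier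
  u · v = sum (λ i → u i * v i)

  sum-zero : ∀ {n} {f : Vector Carrier n} → (∀ i → f i ≈ 0#) → sum f ≈ 0#
  sum-zero {n} f≈0 = trans (sum-cong-≋ {n} f≈0) (sum-replicate-zero n)

  sum-single : ∀ {n} (f : Vector Carrier n) j → (∀ i → i ≢ j → f i ≈ 0#) → sum f ≈ f j
  sum-single f zero    f≈0 = trans (+-congˡ (sum-zero λ i → f≈0 (suc i) λ ())) (+-identityʳ _)
  sum-single f (suc j) f≈0 = trans
    (+-cong (f≈0 zero λ ()) (sum-single (f ∘ suc) j λ i i≢j → f≈0 (suc i) λ { ≡.refl → i≢j ≡.refl }))
    (+-identityˡ _)

  ·-cong : ∀ {n} {u u′ v v′ : Vector Carrier n} →
           (∀ i → u i ≈ u′ i) → (∀ i → v i ≈ v′ i) → u · v ≈ u′ · v′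
  ·-cong {n} u≈ v≈ = sum-cong-≋ {n} λ i → *-cong (u≈ i) (v≈ i)

  ·-comm : ∀ {n} (u v : Vector Carrier n) → u · v ≈ v · u
  ·-comm {n} u v = sum-cong-≋ {n} λ i → *-comm (u i) (v i)

  ·-+ : ∀ {n} (u v w : Vector Carrier n) → u · (λ i → v i + w i) ≈ u · v + u · w
  ·-+ {n} u v w = trans (sum-cong-≋ {n} λ i → distribˡ (u i) (v i) (w i))
    (∑-distrib-+ (λ i → u i * v i) (λ i → u i * w i))

  ·-* : ∀ {n} (u : Vector Carrier n) r v → u · (λ i → r * v i) ≈ r * (u · v)
  ·-* {n} u r v = trans (sum-cong-≋ {n} λ i → x∙yz≈y∙xz (u i) r (v i))
    (sym (*-distribˡ-sum r (λ i → u i * v i)))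

  ·-neg : ∀ {n} (u v : Vector Carrier n) → u · (λ i → - v i) ≈ - (u · v)
  ·-neg {n} u v = begin
    u · (λ i → - v i)          ≈⟨ ·-cong (λ i → refl {u i}) (λ i → trans (-‿cong (sym (*-identityˡ (v i)))) (-‿distribˡ-* 1# (v i))) ⟩
    u · (λ i → - 1# * v i)     ≈⟨ ·-* u (- 1#) v ⟩
    - 1# * (u · v)             ≈⟨ -‿distribˡ-* 1# (u · v) ⟨
    - (1# * (u · v))           ≈⟨ -‿cong (*-identityˡ (u · v)) ⟩
    - (u · v)                  ∎

  ·-- : ∀ {n} (u v w : Vector Carrier n) → u · (λ i → v i - w i) ≈ u · v - u · w
  ·-- u v w = trans (·-+ u v (λ i → - w i)) (+-congˡ (·-neg u w))

  -- (u X) · v = u · (X v) for a matrix X given by rows.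
  ·-swap : ∀ {m n} (u : Vector Carrier m) (X : Fin m → Fin n → Carrier) v →
           (λ j → u · (λ i → X i j)) · v ≈ u · (λ i → X i · v)
  ·-swap {m} {n} u X v = begin
    sum (λ j → sum (λ i → u i * X i j) * v j)    ≈⟨ sum-cong-≋ {n} (λ j → *-distribʳ-sum (v j) (λ i → u i * X i j)) ⟩
    sum (λ j → sum (λ i → u i * X i j * v j))    ≈⟨ ∑-comm (λ j i → u i * X i j * v j) ⟩
    sum (λ i → sum (λ j → u i * X i j * v j))    ≈⟨ sum-cong-≋ {m} (λ i → sum-cong-≋ {n} λ j → *-assoc (u i) (X i j) (v j)) ⟩
    sum (λ i → sum (λ j → u i * (X i j * v j)))  ≈⟨ sum-cong-≋ {m} (λ i → *-distribˡ-sum (u i) (λ j → X i j * v j)) ⟨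
    u · (λ i → X i · v)                          ∎

  ·-combination : ∀ {d n} (φ : Vector Carrier d) a (x : Fin n → Vector Carrier d) →
                  φ · combination a x ≈ a · (λ e → φ · x e)
  ·-combination {d} {n} φ a x = begin
    φ · combination a x               ≈⟨ ·-comm φ (combination a x) ⟩
    combination a x · φ               ≈⟨ ·-swap a x φ ⟩
    a · (λ e → x e · φ)               ≈⟨ ·-cong {n} (λ e → refl) (λ e → ·-comm (x e) φ) ⟩
    a · (λ e → φ · x e)               ∎

  ·-span-zero : ∀ {d n} (φ : Vector Carrier d) (x : Fin n → Vector Carrier d) S {v} → Span x S v →
                (∀ e → e ∈ S → φ · x e ≈ 0#) → φ · v ≈ 0#
  ·-span-zero {n = n} φ x S {v} (a , a∉ , v≈) kills = begin
    φ · v                  ≈⟨ ·-cong (λ i → refl) v≈ ⟩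
    φ · combination a x    ≈⟨ ·-combination φ a x ⟩
    a · (λ e → φ · x e)    ≈⟨ sum-zero {n} term ⟩
    0#                     ∎
    where
    term : ∀ e → a e * (φ · x e) ≈ 0#
    term e with e ∈? S
    ... | yes e∈S = trans (*-congˡ (kills e e∈S)) (zeroʳ (a e))
    ... | no  e∉S = trans (*-congʳ (a∉ e e∉S)) (zeroˡ _)

  Span-mono : ∀ {d n} (x : Fin n → Vector Carrier d) {S S′ v} → S ⊆ S′ → Span x S v → Span x S′ v
  Span-mono x S⊆S′ (a , a∉ , v≈) = a , (λ e e∉S′ → a∉ e (e∉S′ ∘ S⊆S′)) , v≈

  Span-absorb : ∀ {d n} (x : Fin n → Vector Carrier d) S e {v} →
                Span x S (x e) → Span x (S ∪ ⁅ e ⁆) v → Span x S v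
  Span-absorb {d} {n} x S e {v} xₑ∈S (a , a∉ , v≈) =
    Span-+ x S {combination a′ x} {λ i → a e * x e i} (a′ , a′∉ , λ i → refl) (Span-* x S (a e) xₑ∈S λ i → refl) λ i → begin
      v i                                                  ≈⟨ v≈ i ⟩
      sum (λ f → a f * x f i)                              ≈⟨ sum-cong-≋ {n} (split i) ⟩
      sum (λ f → a′ f * x f i + extra i f)                 ≈⟨ ∑-distrib-+ {n} (λ f → a′ f * x f i) (extra i) ⟩
      combination a′ x i + sum (extra i)                   ≈⟨ +-congˡ (trans (sum-single (extra i) e (extra≢ i)) (extra≡ i)) ⟩
      combination a′ x i + a e * x e i                     ∎
    where
    a′ : Vector Carrier n
    a′ f with f ≟ e
    ... | yes _ = 0#
    ... | no  _ = a f
    extra : Fin d → Vector Carrier n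
    extra i f with f ≟ e
    ... | yes _ = a e * x e i
    ... | no  _ = 0#
    a′∉ : ∀ f → f ∉ S → a′ f ≈ 0#
    a′∉ f f∉S with f ≟ e
    ... | yes _   = refl
    ... | no  f≢e = a∉ f λ f∈ → [ f∉S , (λ f∈e → f≢e (x∈⁅y⁆⇒x≡y e f∈e)) ]′ (x∈p∪q⁻ S ⁅ e ⁆ f∈)
    split : ∀ i f → a f * x f i ≈ a′ f * x f i + extra i f
    split i f with f ≟ e
    ... | yes ≡.refl = sym (trans (+-congʳ (zeroˡ _)) (+-identityˡ _))
    ... | no  _      = sym (+-identityʳ _)
    extra≢ : ∀ i f → f ≢ e → extra i f ≈ 0#
    extra≢ i f f≢e with f ≟ e
    ... | yes f≡e = contradiction f≡e f≢e
    ... | no  _   = refl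
    extra≡ : ∀ i → extra i e ≈ a e * x e i
    extra≡ i with e ≟ e
    ... | yes _   = refl
    ... | no  e≢e = contradiction ≡.refl e≢e

  -- A relation among the coefficient vectors maps through `x` to a relation among the `b k`.
  -- Dimensions can thus be bounded by the support of the coefficients, without any assumption on
  -- the generators `x`.
  independent-coefficients : ∀ {d n r} {b : Fin r → Vector Carrier d} (x : Fin n → Vector Carrier d)
    (C : Fin r → Vector Carrier n) → (∀ k i → b k i ≈ combination (C k) x i) →
    LinearlyIndependent b → LinearlyIndependent C
  independent-coefficients {r = r} {b} x C b≈ indep a aC≈0 = indep a λ i → begin
    a · (λ k → b k i)                                ≈⟨ ·-cong (λ k → refl) (λ k → b≈ k i) ⟩
    a · (λ k → C k · (λ e → x e i))                  ≈⟨ ·-swap a C (λ e → x e i) ⟨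
    (λ e → a · (λ k → C k e)) · (λ e → x e i)        ≈⟨ sum-zero (λ e → trans (*-congʳ (aC≈0 e)) (zeroˡ _)) ⟩
    0#                                               ∎

  -- Fraction-free elimination, since a pivot p has only ¬ p ≈ 0# and need not be invertible.
  module Steinitz
    (1≉0 : ¬ 1# ≈ 0#)
    (cancel : ∀ {a b} → a * b ≈ 0# → ¬ a ≈ 0# → b ≈ 0#)
    (stable : ∀ {a} → ¬ ¬ a ≈ 0# → a ≈ 0#)
    where

    module _ {r n} (C : Fin (suc r) → Vector Carrier (suc n)) (k : Fin (suc r)) where

      private
        p = C k zero
        C₀ : Vector Carrier r
        C₀ j = C (punchIn k j) zero

      eliminate : Fin r → Vector Carrier (suc n)
      eliminate j e = p * C (punchIn k j) e - C₀ j * C k e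

      eliminate-zero : ∀ j → eliminate j zero ≈ 0#
      eliminate-zero j = trans (+-congʳ (*-comm p (C₀ j))) (-‿inverseʳ _)

      -- A relation `a` among the eliminated rows, rewritten in the original rows: collecting the
      -- multiples of row `k` gives the coefficient `- (a · C₀)`.
      lift-coefficients : Vector Carrier r → Vector Carrier (suc r)
      lift-coefficients a = insertAt (λ j → p * a j) k (- (a · C₀))

      combination-eliminate : ∀ a e →
        combination (lift-coefficients a) C e ≈ combination a eliminate e
      combination-eliminate a e = begin
        combination b C e
          ≈⟨ sum-remove {i = k} (λ j → b j * C j e) ⟩
        b k * c + sum (λ j → b (punchIn k j) * C (punchIn k j) e)
          ≡⟨ ≡.cong (λ z → z * c + sum (λ j → b (punchIn k j) * C (punchIn k j) e)) (insertAt-lookup (λ j → p * a j) k (- s)) ⟩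
        - s * c + sum (λ j → b (punchIn k j) * C (punchIn k j) e)
          ≈⟨ +-congˡ (sum-cong-≋ {r} λ j → trans (*-congʳ (reflexive (insertAt-punchIn (λ j → p * a j) k (- s) j))) (shuffle p (a j) (C (punchIn k j) e))) ⟩
        - s * c + a · (λ j → p * C (punchIn k j) e)
          ≈⟨ +-comm _ _ ⟩
        a · (λ j → p * C (punchIn k j) e) + - s * c
          ≈⟨ +-congˡ (-‿distribˡ-* s c) ⟨
        a · (λ j → p * C (punchIn k j) e) - s * c
          ≈⟨ +-congˡ (-‿cong (trans (*-comm s c) (sym (·-* a c C₀)))) ⟩
        a · (λ j → p * C (punchIn k j) e) - a · (λ j → c * C₀ j)
          ≈⟨ +-congˡ (-‿cong (·-cong (λ j → refl {a j}) λ j → *-comm c (C₀ j))) ⟩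
        a · (λ j → p * C (punchIn k j) e) - a · (λ j → C₀ j * c)
          ≈⟨ ·-- a (λ j → p * C (punchIn k j) e) (λ j → C₀ j * c) ⟨
        combination a eliminate e ∎
        where
        b = lift-coefficients a
        s = a · C₀
        c = C k e
        shuffle : ∀ x y z → x * y * z ≈ y * (x * z)
        shuffle x y z = trans (*-assoc x y z) (x∙yz≈y∙xz x y z)

      eliminate-independent : ¬ p ≈ 0# → LinearlyIndependent C →
        LinearlyIndependent (λ j e → eliminate j (suc e))
      eliminate-independent p≉0 indep a a≈0 j = cancel
        (trans (reflexive (≡.sym (insertAt-punchIn (λ j → p * a j) k (- (a · C₀)) j)))
               (indep (lift-coefficients a) (λ e → trans (combination-eliminate a e) (vanish e)) (punchIn k j)))
        p≉0
        where
        vanish : ∀ e → combination a eliminate e ≈ 0#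
        vanish zero    = sum-zero λ j → trans (*-congˡ (eliminate-zero j)) (zeroʳ (a j))
        vanish (suc e) = a≈0 e

    drop-independent : ∀ {r n} (C : Fin r → Vector Carrier (suc n)) → (∀ k → C k zero ≈ 0#) →
      LinearlyIndependent C → LinearlyIndependent (λ k e → C k (suc e))
    drop-independent C C₀≈0 indep a a≈0 = indep a λ where
      zero    → sum-zero λ k → trans (*-congˡ (C₀≈0 k)) (zeroʳ (a k))
      (suc e) → a≈0 e

    ¬too-many : ∀ {r n} (S : Subset n) (C : Fin r → Vector Carrier n) →
      (∀ k e → e ∉ S → C k e ≈ 0#) → LinearlyIndependent C → ¬ ∣ S ∣ ℕ.< r
    ¬too-many {suc r} [] C C∉ indep lt = 1≉0 (indep (λ _ → 1#) (λ ()) zero)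
    ¬too-many (false ∷ S) C C∉ indep =
      ¬too-many S (λ k e → C k (suc e)) (λ k e e∉ → C∉ k (suc e) (e∉ ∘ drop-there))
        (drop-independent C (λ k → C∉ k zero λ ()) indep)
    ¬too-many {suc r} (true ∷ S) C C∉ indep lt =
      ¬too-many S (λ k e → C k (suc e)) C∉′ (drop-independent C (λ k → stable (pivot k)) indep) (ℕ.<⇒≤ lt)
      where
      C∉′ : ∀ k e → e ∉ S → C k (suc e) ≈ 0#
      C∉′ k e e∉ = C∉ k (suc e) (e∉ ∘ drop-there)
      pivot : ∀ k → ¬ ¬ C k zero ≈ 0#
      pivot k p≉0 = ¬too-many S (λ j e → eliminate C k j (suc e))
        (λ j e e∉ → trans (+-cong (trans (*-congˡ (C∉′ (punchIn k j) e e∉)) (zeroʳ _))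
                                  (-‿cong (trans (*-congˡ (C∉′ k e e∉)) (zeroʳ _))))
                          (-‿inverseʳ 0#))
        (eliminate-independent C k p≉0 indep) (ℕ.s≤s⁻¹ lt)

    independent⇒≤∣∣ : ∀ {d n r} (x : Fin n → Vector Carrier d) S {b : Fin r → Vector Carrier d} →
      LinearlyIndependent b → (∀ k → Span x S (b k)) → r ℕ.≤ ∣ S ∣
    independent⇒≤∣∣ x S indep span = ℕ.≮⇒≥ (¬too-many S (λ k → proj₁ (span k)) (λ k → proj₁ (proj₂ (span k)))
      (independent-coefficients x (λ k → proj₁ (span k)) (λ k → proj₂ (proj₂ (span k))) indep))

    independent⇒≤ : ∀ {d w r s} {W : Vector Carrier d → Set w} {b : Fin r → Vector Carrier d} →
      LinearlyIndependent b → (∀ k → W (b k)) → HasDimension W s → r ℕ.≤ s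
    independent⇒≤ {s = s} {b = b} indep b∈W (c , _ , _ , spanning) = ≡.subst (_ ℕ.≤_) (∣⊤∣≡n s)
      (independent⇒≤∣∣ c ⊤ {b} indep (λ k → spanning _ (b∈W k)))

    -- Applying `φ` to a relation isolates the coefficient of `y`.
    cons-independent : ∀ {d r} (φ y : Vector Carrier d) (b : Fin r → Vector Carrier d) →
      ¬ φ · y ≈ 0# → (∀ k → φ · b k ≈ 0#) → LinearlyIndependent b → LinearlyIndependent (y Vector.∷ b)
    cons-independent {d} {r} φ y b φy≉0 φb≈0 indep a a≈0 = λ where
        zero    → a₀≈0
        (suc k) → indep (a ∘ suc) (λ i → trans (sym (+-identityˡ _))
          (trans (+-congʳ (sym (trans (*-congʳ a₀≈0) (zeroˡ (y i))))) (a≈0 i))) k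
      where
      a₀≈0 : a zero ≈ 0#
      a₀≈0 = cancel (begin
        (φ · y) * a zero                                            ≈⟨ *-comm _ _ ⟩
        a zero * (φ · y)                                            ≈⟨ +-identityʳ _ ⟨
        a zero * (φ · y) + 0#                                       ≈⟨ +-congˡ (sum-zero {r} λ k → trans (*-congˡ (φb≈0 k)) (zeroʳ _)) ⟨
        a · (λ k → φ · (y Vector.∷ b) k)                            ≈⟨ ·-combination φ a (y Vector.∷ b) ⟨
        φ · combination a (y Vector.∷ b)                            ≈⟨ sum-zero {d} (λ i → trans (*-congˡ (a≈0 i)) (zeroʳ _)) ⟩
        0#                                                          ∎) φy≉0

open ≡ using (refl; sym; trans; cong; cong₂; subst)

-- The integers inside the Cauchy reals, and cancellation for reals.

fromℤ-injective : ∀ {i j} → fromℤ i ≈ℝ fromℤ j → i ≡ j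
fromℤ-injective {i} {j} i≈j = ℤ.*-cancelʳ-≡ i j 1ℤ (drop (ℚᵘ.≃-trans (ℚᵘ.≃-sym (ℚ.toℚᵘ-fromℚᵘ (ℚᵘ.mkℚᵘ i 0)))
    (ℚᵘ.≃-trans (ℚᵘ.≃-reflexive (cong ℚ.toℚᵘ i/1≡j/1)) (ℚ.toℚᵘ-fromℚᵘ (ℚᵘ.mkℚᵘ j 0)))))
  where
  p = i ℚ./ 1
  q = j ℚ./ 1
  drop : ℚᵘ.mkℚᵘ i 0 ℚᵘ.≃ ℚᵘ.mkℚᵘ j 0 → i ℤ.* 1ℤ ≡ j ℤ.* 1ℤ
  drop (ℚᵘ.*≡* eq) = eq
  -- The difference sequence is constant, so nullness tested at ε = |p - q| would make |p - q| less
  -- than itself.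
  p-q≡0 : p ℚ.- q ≡ 0ℚ
  p-q≡0 with 0ℚ ℚ.<? ℚ.∣ p ℚ.- q ∣
  ... | yes 0<ε = let n₀ , h = null i≈j ℚ.∣ p ℚ.- q ∣ 0<ε in contradiction (h n₀ ℕ.≤-refl) (ℚ.<-irrefl refl)
  ... | no  0≮ε = ℚ.∣p∣≡0⇒p≡0 (p ℚ.- q) (ℚ.≤-antisym (ℚ.≮⇒≥ 0≮ε) (ℚ.0≤∣p∣ _))
  i/1≡j/1 : p ≡ q
  i/1≡j/1 = trans (solve 2 (λ p q → p := (p :- q) :+ q) refl p q) (trans (cong (ℚ._+ q) p-q≡0) (ℚ.+-identityˡ q))
    where open ℚ-Solver

fromℤ-+ : ∀ i j → fromℤ (i ℤ.+ j) ≈ℝ fromℤ i +ℝ fromℤ j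
fromℤ-+ i j = ≗⇒≈ℝ λ _ → ℚ.toℚᵘ-injective (begin
  ℚ.toℚᵘ (ℚ.fromℚᵘ (ℚᵘ.mkℚᵘ (i ℤ.+ j) 0))  ≈⟨ ℚ.toℚᵘ-fromℚᵘ (ℚᵘ.mkℚᵘ (i ℤ.+ j) 0) ⟩
  ℚᵘ.mkℚᵘ (i ℤ.+ j) 0                      ≈⟨ ℚᵘ.*≡* (cong (ℤ._* 1ℤ) (cong₂ ℤ._+_ (sym (ℤ.*-identityʳ i)) (sym (ℤ.*-identityʳ j)))) ⟩
  ℚᵘ.mkℚᵘ i 0 ℚᵘ.+ ℚᵘ.mkℚᵘ j 0             ≈⟨ ℚᵘ.+-cong (ℚ.toℚᵘ-fromℚᵘ (ℚᵘ.mkℚᵘ i 0)) (ℚ.toℚᵘ-fromℚᵘ (ℚᵘ.mkℚᵘ j 0)) ⟨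
  ℚ.toℚᵘ (i ℚ./ 1) ℚᵘ.+ ℚ.toℚᵘ (j ℚ./ 1)   ≈⟨ ℚ.toℚᵘ-homo-+ (i ℚ./ 1) (j ℚ./ 1) ⟨
  ℚ.toℚᵘ (i ℚ./ 1 ℚ.+ j ℚ./ 1)             ∎)
  where open import Relation.Binary.Reasoning.Setoid ℚᵘ.≃-setoid

fromℤ-* : ∀ i j → fromℤ (i ℤ.* j) ≈ℝ fromℤ i *ℝ fromℤ j
fromℤ-* i j = ≗⇒≈ℝ λ _ → ℚ.toℚᵘ-injective (begin
  ℚ.toℚᵘ (ℚ.fromℚᵘ (ℚᵘ.mkℚᵘ (i ℤ.* j) 0))  ≈⟨ ℚ.toℚᵘ-fromℚᵘ (ℚᵘ.mkℚᵘ (i ℤ.* j) 0) ⟩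
  ℚᵘ.mkℚᵘ i 0 ℚᵘ.* ℚᵘ.mkℚᵘ j 0             ≈⟨ ℚᵘ.*-cong (ℚ.toℚᵘ-fromℚᵘ (ℚᵘ.mkℚᵘ i 0)) (ℚ.toℚᵘ-fromℚᵘ (ℚᵘ.mkℚᵘ j 0)) ⟨
  ℚ.toℚᵘ (i ℚ./ 1) ℚᵘ.* ℚ.toℚᵘ (j ℚ./ 1)   ≈⟨ ℚ.toℚᵘ-homo-* (i ℚ./ 1) (j ℚ./ 1) ⟨
  ℚ.toℚᵘ ((i ℚ./ 1) ℚ.* (j ℚ./ 1))         ∎)
  where open import Relation.Binary.Reasoning.Setoid ℚᵘ.≃-setoid


fromℤ-reciprocal : ∀ i → i ≢ 0ℤ → ∃[ y ] y *ℝ fromℤ i ≈ℝ fromℚ 1ℚ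
fromℤ-reciprocal i i≢0 = fromℚ (ℚ.1/ p) , ≗⇒≈ℝ λ _ → ℚ.*-inverseˡ p
  where
  p = i ℚ./ 1
  instance
    p≢0 : ℚ.NonZero p
    p≢0 = ℚ.≢-nonZero λ p≡0 → i≢0 (fromℤ-injective (≗⇒≈ℝ λ _ → p≡0))

BoundedAway : (ℕ → ℚ) → Set
BoundedAway s = ∃[ ε ] 0ℚ ℚ.< ε × ∃[ n₀ ] (∀ n → n₀ ℕ.≤ n → ε ℚ.≤ ℚ.∣ s n ∣)

private
  0<½* : ∀ {ε} → 0ℚ ℚ.< ε → 0ℚ ℚ.< ½ ℚ.* ε
  0<½* {ε} 0<ε = ℚ.positive⁻¹ _ {{ℚ.pos*pos⇒pos ½ ε {{ℚ.positive 0<ε}}}}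

  ½*+½* : ∀ ε → ½ ℚ.* ε ℚ.+ ½ ℚ.* ε ≡ ε
  ½*+½* ε = trans (sym (ℚ.*-distribʳ-+ ε ½ ½)) (ℚ.*-identityˡ ε)

  halves : ∀ p q {ε} → ℚ.∣ p ℚ.- q ∣ ℚ.< ½ ℚ.* ε → ℚ.∣ q ∣ ℚ.< ½ ℚ.* ε → ℚ.∣ p ∣ ℚ.< ε
  halves p q {ε} p-q< q< = begin-strict
    ℚ.∣ p ∣                    ≡⟨ cong ℚ.∣_∣ (solve 2 (λ p q → p := (p :- q) :+ q) refl p q) ⟩
    ℚ.∣ (p ℚ.- q) ℚ.+ q ∣      ≤⟨ ℚ.∣p+q∣≤∣p∣+∣q∣ (p ℚ.- q) q ⟩
    ℚ.∣ p ℚ.- q ∣ ℚ.+ ℚ.∣ q ∣  <⟨ ℚ.+-mono-< p-q< q< ⟩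
    ½ ℚ.* ε ℚ.+ ½ ℚ.* ε        ≡⟨ ½*+½* ε ⟩
    ε                          ∎
    where
    open ℚ.≤-Reasoning
    open ℚ-Solver

-- One rational comparison at the Cauchy index for ε/4 decides the case. If that term is below ε/2,
-- all later terms are below ε; otherwise all later terms are at least ε/4, which is excluded.
¬boundedAway⇒null : ∀ {s} → IsCauchy s → ¬ BoundedAway s → IsNull s
¬boundedAway⇒null {s} c ¬away ε 0<ε with c (½ ℚ.* (½ ℚ.* ε)) (0<½* (0<½* 0<ε))
... | n₀ , h with ℚ.∣ s n₀ ∣ ℚ.<? ½ ℚ.* ε
...   | yes small = n₀ , λ n n₀≤n → halves (s n) (s n₀)
          (ℚ.<-trans (h n n₀ n₀≤n ℕ.≤-refl) (subst (½ ℚ.* (½ ℚ.* ε) ℚ.<_) (½*+½* _)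
            (subst (ℚ._< ½ ℚ.* (½ ℚ.* ε) ℚ.+ ½ ℚ.* (½ ℚ.* ε)) (ℚ.+-identityʳ _)
              (ℚ.+-monoʳ-< (½ ℚ.* (½ ℚ.* ε)) (0<½* (0<½* 0<ε))))))
          small
...   | no  large = contradiction
          (½ ℚ.* (½ ℚ.* ε) , 0<½* (0<½* 0<ε) , n₀ , λ n n₀≤n → ℚ.≮⇒≥ λ sn< →
            large (halves (s n₀) (s n) (h n₀ n ℕ.≤-refl n₀≤n) sn<))
          ¬away

null⇒≈0 : ∀ {x} → IsNull (seq x) → x ≈ℝ fromℚ 0ℚ
null⇒≈0 {x} x→0 = mk≈ λ ε 0<ε → let n₀ , h = x→0 ε 0<ε in n₀ , λ n n₀≤n →
  subst (λ z → ℚ.∣ z ∣ ℚ.< ε) (sym (ℚ.+-identityʳ (seq x n))) (h n n₀≤n)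

≈0⇒null : ∀ {x} → x ≈ℝ fromℚ 0ℚ → IsNull (seq x)
≈0⇒null {x} x≈0 ε 0<ε = let n₀ , h = null x≈0 ε 0<ε in n₀ , λ n n₀≤n →
  subst (λ z → ℚ.∣ z ∣ ℚ.< ε) (ℚ.+-identityʳ (seq x n)) (h n n₀≤n)

-- If `y` were bounded away from 0 by ε, then |x| ε ≤ |x y| < η ε would hold eventually for every η,
-- making `x` null.
ℝ-cancel : ∀ {x y} → x *ℝ y ≈ℝ fromℚ 0ℚ → ¬ x ≈ℝ fromℚ 0ℚ → y ≈ℝ fromℚ 0ℚ
ℝ-cancel {x} {y} xy≈0 x≉0 = null⇒≈0 {y} (¬boundedAway⇒null (cauchy y) λ (ε , 0<ε , n₀ , ε≤) →
  x≉0 (null⇒≈0 {x} λ η 0<η →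
    let instance
          ε⁺ : ℚ.Positive ε
          ε⁺ = ℚ.positive 0<ε
          η⁺ : ℚ.Positive η
          η⁺ = ℚ.positive 0<η
        n₁ , h = ≈0⇒null {x *ℝ y} xy≈0 (η ℚ.* ε) (ℚ.positive⁻¹ _ {{ℚ.pos*pos⇒pos η ε}})
    in n₀ ℕ.⊔ n₁ , λ n ≤n → ℚ.*-cancelʳ-<-nonNeg ε {{ℚ.pos⇒nonNeg ε}} (begin-strict
      ℚ.∣ seq x n ∣ ℚ.* ε                ≤⟨ ℚ.*-monoˡ-≤-nonNeg ℚ.∣ seq x n ∣ {{ℚ.∣-∣-nonNeg (seq x n)}} (ε≤ n (ℕ.≤-trans (ℕ.m≤m⊔n n₀ n₁) ≤n)) ⟩
      ℚ.∣ seq x n ∣ ℚ.* ℚ.∣ seq y n ∣    ≡⟨ ℚ.∣p*q∣≡∣p∣*∣q∣ (seq x n) (seq y n) ⟨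
      ℚ.∣ seq x n ℚ.* seq y n ∣          <⟨ h n (ℕ.≤-trans (ℕ.m≤n⊔m n₀ n₁) ≤n) ⟩
      η ℚ.* ε                            ∎)))
  where open ℚ.≤-Reasoning

ℝ-stable : ∀ {x} → ¬ ¬ x ≈ℝ fromℚ 0ℚ → x ≈ℝ fromℚ 0ℚ
ℝ-stable {x} ¬¬x≈0 = null⇒≈0 {x} (¬boundedAway⇒null (cauchy x) λ (ε , 0<ε , n₀ , ε≤) →
  ¬¬x≈0 λ x≈0 → let n₁ , h = ≈0⇒null {x} x≈0 ε 0<ε in
    ℚ.<-irrefl refl (ℚ.≤-<-trans (ε≤ (n₀ ℕ.⊔ n₁) (ℕ.m≤m⊔n n₀ n₁)) (h (n₀ ℕ.⊔ n₁) (ℕ.m≤n⊔m n₀ n₁))))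

open import Algebra.Properties.Group (CommutativeRing.+-group ℤ.+-*-commutativeRing) using () renaming (∙-cancelˡ to +-cancelˡ)
open import Data.Fin.Subset using (_-_)
open import Data.Integer.Base using (_*_; _+_)
open import Data.Integer.Solver using (module +-*-Solver)

-- Integer vectors and rational spans.

module ℤL = RingLinear ℤ.+-*-commutativeRing
open ℤL using (_·_)

*-≢0 : ∀ {i j} → i ≢ 0ℤ → j ≢ 0ℤ → i * j ≢ 0ℤ
*-≢0 {i} i≢0 j≢0 ij≡0 = [ i≢0 , j≢0 ]′ (ℤ.i*j≡0⇒i≡0∨j≡0 i ij≡0)

*-cancel-0 : ∀ {i j} → i * j ≡ 0ℤ → i ≢ 0ℤ → j ≡ 0ℤ
*-cancel-0 {i} ij≡0 i≢0 = [ (λ i≡0 → contradiction i≡0 i≢0) , (λ j≡0 → j≡0) ]′ (ℤ.i*j≡0⇒i≡0∨j≡0 i ij≡0)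

identity-≡ : ∀ {n} (i : Fin n) → identity i i ≡ 1ℤ
identity-≡ i with i ≟ i
... | yes _   = refl
... | no  i≢i = contradiction refl i≢i

identity-≢ : ∀ {n} {i j : Fin n} → i ≢ j → identity i j ≡ 0ℤ
identity-≢ {i = i} {j} i≢j with i ≟ j
... | yes i≡j = contradiction i≡j i≢j
... | no  _   = refl

identity-· : ∀ {n} i (v : Vector ℤ n) → identity i · v ≡ v i
identity-· i v = trans (ℤL.sum-single (λ j → identity i j * v j) i λ j j≢i → cong (_* v j) (identity-≢ (j≢i ∘ sym)))
  (trans (cong (_* v i) (identity-≡ i)) (ℤ.*-identityˡ (v i)))

·-identity : ∀ {n} (v : Vector ℤ n) j → v · (λ i → identity i j) ≡ v j
·-identity v j = trans (ℤL.sum-single (λ i → v i * identity i j) j λ i i≢j → trans (cong (v i *_) (identity-≢ i≢j)) (ℤ.*-zeroʳ (v i)))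
  (trans (cong (v j *_) (identity-≡ j)) (ℤ.*-identityʳ (v j)))

zero-or-pivot : ∀ {n} (v : Vector ℤ n) → (∀ i → v i ≡ 0ℤ) ⊎ ∃[ i ] v i ≢ 0ℤ
zero-or-pivot {n} v with all? (λ i → v i ℤ.≟ 0ℤ)
... | yes v≡0 = inj₁ v≡0
... | no  v≢0 = inj₂ (¬∀⟶∃¬ n _ (λ i → v i ℤ.≟ 0ℤ) v≢0)

-- The rational span with the denominator `k` cleared, so that all coefficients stay integral.
ℚSpan : ∀ {d n} → (Fin n → Vector ℤ d) → Subset n → Vector ℤ d → Set
ℚSpan x S v = ∃[ k ] k ≢ 0ℤ × ℤ-Linear.Span x S (λ i → k * v i)

Annihilates : ∀ {d n} → Vector ℤ d → (Fin n → Vector ℤ d) → Subset n → Set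
Annihilates φ x S = ∀ e → e ∈ S → φ · x e ≡ 0ℤ

span-tail : ∀ {d n} (x : Fin (suc n) → Vector ℤ d) {S} s {v} → ℤ-Linear.Span (x ∘ suc) S v → ℤ-Linear.Span x (s ∷ S) v
span-tail x s {v} (a , a∉ , v≡) = (0ℤ Vector.∷ a)
  , (λ { zero _ → refl ; (suc e) e∉ → a∉ e (e∉ ∘ there) })
  , λ i → trans (v≡ i) (sym (ℤ.+-identityˡ _))

-- The Fredholm alternative over ℚ, by elimination of one generator at a time. It is a decision
-- because integer equality is decidable; later, membership in a span is proved by refuting the
-- separating functional.
span-or-functional : ∀ {d n} (x : Fin n → Vector ℤ d) S v →
  ℚSpan x S v ⊎ ∃[ φ ] Annihilates φ x S × φ · v ≢ 0ℤ
span-or-functional x [] v with zero-or-pivot v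
... | inj₁ v≡0       = inj₁ (1ℤ , (λ ()) , ℤ-Linear.Span-0 x [] λ i → trans (ℤ.*-identityˡ (v i)) (v≡0 i))
... | inj₂ (i , vᵢ≢0) = inj₂ (identity i , (λ _ ()) , λ eq → vᵢ≢0 (trans (sym (identity-· i v)) eq))
span-or-functional x (false ∷ S) v with span-or-functional (x ∘ suc) S v
... | inj₁ (k , k≢0 , span) = inj₁ (k , k≢0 , span-tail x false span)
... | inj₂ (φ , kills , φv≢0) = inj₂ (φ , (λ { (suc e) e∈ → kills e (drop-there e∈) }) , φv≢0)
span-or-functional x (true ∷ S) v with zero-or-pivot (x zero)
... | inj₁ x₀≡0 = [ (λ (k , k≢0 , span) → inj₁ (k , k≢0 , span-tail x true span))
                  , (λ (φ , kills , φv≢0) → inj₂ (φ , (λ { zero _ → ℤL.sum-zero λ i → trans (cong (φ i *_) (x₀≡0 i)) (ℤ.*-zeroʳ (φ i))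
                                                           ; (suc e) e∈ → kills e (drop-there e∈) }) , φv≢0)) ]′
                  (span-or-functional (x ∘ suc) S v)
... | inj₂ (i , p≢0) = [ lift-span , lift-functional ]′ (span-or-functional (λ e → project (x (suc e))) S (project v))
  where
  open ≡.≡-Reasoning
  x₀ = x zero
  p = x₀ i
  -- `p` times the projection along `x₀` onto the hyperplane where coordinate `i` vanishes; the
  -- factor `p` avoids division.
  project : Vector ℤ _ → Vector ℤ _
  project u j = p * u j ℤ.- u i * x₀ j
  project-x₀ : ∀ j → project x₀ j ≡ 0ℤ
  project-x₀ j = ℤ.+-inverseʳ (p * x₀ j)
  lift-span : ℚSpan (λ e → project (x (suc e))) S (project v) → _
  lift-span (k , k≢0 , a , a∉ , kv≡) = inj₁ (k * p , *-≢0 k≢0 p≢0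
    , (k * v i ℤ.- a · (λ e → x (suc e) i)) Vector.∷ (λ e → a e * p)
    , (λ { zero e∉ → contradiction here e∉ ; (suc e) e∉ → trans (cong (_* p) (a∉ e (e∉ ∘ there))) refl })
    , λ j → begin
        k * p * v j                                              ≡⟨ solve 5 (λ k p vj vi xj → k :* p :* vj := k :* (p :* vj :- vi :* xj) :+ k :* vi :* xj) refl k p (v j) (v i) (x₀ j) ⟩
        k * project v j + k * v i * x₀ j                         ≡⟨ cong (_+ k * v i * x₀ j) (kv≡ j) ⟩
        a · (λ e → project (x (suc e)) j) + k * v i * x₀ j       ≡⟨ cong (_+ k * v i * x₀ j) (ℤL.·-- a (λ e → p * x (suc e) j) (λ e → x (suc e) i * x₀ j)) ⟩
        (a · (λ e → p * x (suc e) j) ℤ.- a · (λ e → x (suc e) i * x₀ j)) + k * v i * x₀ j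
          ≡⟨ cong (λ z → (a · (λ e → p * x (suc e) j) ℤ.- z) + k * v i * x₀ j) (trans (ℤL.·-cong {u = a} (λ e → refl) (λ e → ℤ.*-comm (x (suc e) i) (x₀ j))) (ℤL.·-* a (x₀ j) (λ e → x (suc e) i))) ⟩
        (a · (λ e → p * x (suc e) j) ℤ.- x₀ j * s) + k * v i * x₀ j
          ≡⟨ solve 4 (λ P xj s kv → (P :- xj :* s) :+ kv :* xj := (kv :- s) :* xj :+ P) refl (a · (λ e → p * x (suc e) j)) (x₀ j) s (k * v i) ⟩
        (k * v i ℤ.- s) * x₀ j + a · (λ e → p * x (suc e) j)
          ≡⟨ cong (λ z → (k * v i ℤ.- s) * x₀ j + z) (ℤL.sum-cong-≋ λ e → sym (ℤ.*-assoc (a e) p (x (suc e) j))) ⟩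
        (k * v i ℤ.- s) * x₀ j + (λ e → a e * p) · (λ e → x (suc e) j) ∎)
    where
    open +-*-Solver
    s = a · (λ e → x (suc e) i)
  lift-functional : (∃[ φ ] Annihilates φ (λ e → project (x (suc e))) S × φ · project v ≢ 0ℤ) → _
  lift-functional (φ , kills , φv≢0) = inj₂ (ψ
    , (λ { zero _ → trans (ψ-· x₀) (ℤL.sum-zero λ j → trans (cong (φ j *_) (project-x₀ j)) (ℤ.*-zeroʳ (φ j)))
         ; (suc e) e∈ → trans (ψ-· (x (suc e))) (kills e (drop-there e∈)) })
    , λ ψv≡0 → φv≢0 (trans (sym (ψ-· v)) ψv≡0))
    where
    ψ : Vector ℤ _
    ψ j = p * φ j ℤ.- (φ · x₀) * identity i j
    ψ-· : ∀ u → ψ · u ≡ φ · project u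
    ψ-· u = begin
      ψ · u                                                          ≡⟨ ℤL.·-comm ψ u ⟩
      u · ψ                                                          ≡⟨ ℤL.·-- u (λ j → p * φ j) (λ j → (φ · x₀) * identity i j) ⟩
      u · (λ j → p * φ j) ℤ.- u · (λ j → (φ · x₀) * identity i j)    ≡⟨ cong₂ ℤ._-_ (ℤL.·-* u p φ) (ℤL.·-* u (φ · x₀) (identity i)) ⟩
      p * (u · φ) ℤ.- (φ · x₀) * (u · identity i)                    ≡⟨ cong₂ (λ a b → p * a ℤ.- b) (ℤL.·-comm u φ) (trans (cong ((φ · x₀) *_) (trans (ℤL.·-comm u (identity i)) (identity-· i u))) (ℤ.*-comm (φ · x₀) (u i))) ⟩
      p * (φ · u) ℤ.- u i * (φ · x₀)                                 ≡⟨ cong₂ ℤ._-_ (ℤL.·-* φ p u) (ℤL.·-* φ (u i) x₀) ⟨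
      φ · (λ j → p * u j) ℤ.- φ · (λ j → u i * x₀ j)                 ≡⟨ ℤL.·-- φ (λ j → p * u j) (λ j → u i * x₀ j) ⟨
      φ · project u                                                  ∎

-- Ranks over the scalars, read through integer functionals.

∣p∪⁅x⁆∣≤1+∣p∣ : ∀ {n} (p : Subset n) x → ∣ p ∪ ⁅ x ⁆ ∣ ℕ.≤ suc ∣ p ∣
∣p∪⁅x⁆∣≤1+∣p∣ (s     ∷ p) zero    rewrite ∪-identityʳ p with s
... | true  = ℕ.n≤1+n _
... | false = ℕ.≤-refl
∣p∪⁅x⁆∣≤1+∣p∣ (true  ∷ p) (suc x) = ℕ.s≤s (∣p∪⁅x⁆∣≤1+∣p∣ p x)
∣p∪⁅x⁆∣≤1+∣p∣ (false ∷ p) (suc x) = ∣p∪⁅x⁆∣≤1+∣p∣ p x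

-- The part of the theory of fields of characteristic 0 that ℝ offers constructively: equality with 0 is only stable.
record ScalarRing (ℓ₁ ℓ₂ : Level) : Set (Level.suc (ℓ₁ ⊔ ℓ₂)) where
  field
    ring : CommutativeRing ℓ₁ ℓ₂

  module K = CommutativeRing ring

  field
    ι            : ℤ → K.Carrier
    ι-0          : ι 0ℤ K.≈ K.0#
    ι-1          : ι 1ℤ K.≈ K.1#
    ι-+          : ∀ i j → ι (i + j) K.≈ ι i K.+ ι j
    ι-*          : ∀ i j → ι (i * j) K.≈ ι i K.* ι j
    ι-injective  : ∀ {i} → ι i K.≈ K.0# → i ≡ 0ℤ
    ι-reciprocal : ∀ i → i ≢ 0ℤ → ∃[ y ] y K.* ι i K.≈ K.1#
    cancel       : ∀ {x y} → x K.* y K.≈ K.0# → ¬ x K.≈ K.0# → y K.≈ K.0#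
    stable       : ∀ {x} → ¬ ¬ x K.≈ K.0# → x K.≈ K.0#

module ScalarExtension {ℓ₁ ℓ₂} (scalarRing : ScalarRing ℓ₁ ℓ₂) where

  open ScalarRing scalarRing

  1≉0 : ¬ K.1# K.≈ K.0#
  1≉0 1≈0 = contradiction (ι-injective (K.trans ι-1 1≈0)) λ ()

  private
    module KL = RingLinear ring
    module KA = LinearAlgebra ring
    module KS = KL.Steinitz 1≉0 cancel stable

  open import Relation.Binary.Reasoning.Setoid K.setoid

  scalars : ∀ {d} → Vector ℤ d → Vector K.Carrier d
  scalars v i = ι (v i)

  K-span : ∀ {d N} → Matrix d N → Subset N → Vector K.Carrier d → Set (ℓ₁ ⊔ ℓ₂)
  K-span X = KA.Span (λ e → scalars (column X e))

  HasKRank : ∀ {d N} → Matrix d N → Subset N → ℕ → Set (ℓ₁ ⊔ ℓ₂)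
  HasKRank X S = KA.HasDimension (K-span X S)

  ι-≡0 : ∀ {i} → i ≡ 0ℤ → ι i K.≈ K.0#
  ι-≡0 refl = ι-0

  ι-≢0 : ∀ {i} → i ≢ 0ℤ → ¬ ι i K.≈ K.0#
  ι-≢0 i≢0 i≈0 = i≢0 (ι-injective i≈0)

  ι-sum : ∀ {n} (f : Vector ℤ n) → ι (ℤL.sum f) K.≈ KL.sum (ι ∘ f)
  ι-sum {zero}  f = ι-0
  ι-sum {suc n} f = K.trans (ι-+ (f zero) (ℤL.sum (f ∘ suc))) (K.+-congˡ (ι-sum (f ∘ suc)))

  ι-· : ∀ {n} (u v : Vector ℤ n) → ι (u · v) K.≈ scalars u KL.· scalars v
  ι-· {n} u v = K.trans (ι-sum (λ i → u i * v i)) (KL.sum-cong-≋ {n} λ i → ι-* (u i) (v i))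

  module _ {d N} (X : Matrix d N) where

    private
      x = column X

    ℤ-span-generator : ∀ {S e} → e ∈ S → ℤ-span X S (x e)
    ℤ-span-generator {S} {e} e∈S = identity e
      , (λ f f∉S → identity-≢ λ { refl → f∉S e∈S })
      , λ i → sym (identity-· e (λ f → x f i))

    ℤ-span⇒K-span : ∀ {S v} → ℤ-span X S v → K-span X S (scalars v)
    ℤ-span⇒K-span {S} (a , a∉ , v≡) = scalars a
      , (λ e e∉ → ι-≡0 (a∉ e e∉))
      , λ i → K.trans (K.reflexive (cong ι (v≡ i))) (ι-· a (λ e → x e i))

    ℚSpan⇒K-span : ∀ {S v} → ℚSpan x S v → K-span X S (scalars v)
    ℚSpan⇒K-span {S} {v} (k , k≢0 , kv∈S) with ι-reciprocal k k≢0
    ... | y , yk≈1 = KA.Span-* _ S y (ℤ-span⇒K-span kv∈S) λ i → begin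
      ι (v i)                     ≈⟨ K.*-identityˡ _ ⟨
      K.1# K.* ι (v i)         ≈⟨ K.*-congʳ {ι (v i)} yk≈1 ⟨
      y K.* ι k K.* ι (v i)     ≈⟨ K.*-assoc y (ι k) (ι (v i)) ⟩
      y K.* (ι k K.* ι (v i))   ≈⟨ K.*-congˡ {y} (ι-* k (v i)) ⟨
      y K.* ι (k * v i)            ∎

    module _ {S} {φ : Vector ℤ d} (φS≡0 : Annihilates φ x S) where

      K-span-annihilated : ∀ {y} → K-span X S y → scalars φ KL.· y K.≈ K.0#
      K-span-annihilated y∈S = KL.·-span-zero (scalars φ) (λ e → scalars (x e)) S y∈S λ e e∈S →
        K.trans (K.sym (ι-· φ (x e))) (ι-≡0 (φS≡0 e e∈S))

      ℤ∩K-span-annihilated : ∀ {v} → K-span X S (scalars v) → φ · v ≡ 0ℤ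
      ℤ∩K-span-annihilated {v} v∈S = ι-injective
        (K.trans (ι-· φ v) (K-span-annihilated v∈S))

      -- A basis of the span of `S` stays independent when `x e` is added, since `φ` kills the
      -- former and not the latter.
      rank-increases : ∀ {e r r′} → φ · x e ≢ 0ℤ → HasKRank X S r → HasKRank X (S ∪ ⁅ e ⁆) r′ → r ℕ.< r′
      rank-increases {e} φxₑ≢0 (b , indep , b∈S , _) rank′ = KS.independent⇒≤ {b = scalars (x e) Vector.∷ b}
        (KS.cons-independent (scalars φ) (scalars (x e)) b
          (λ φxₑ≈0 → ι-≢0 φxₑ≢0 (K.trans (ι-· φ (x e)) φxₑ≈0))
          (λ k → K-span-annihilated (b∈S k)) indep)
        (λ { zero    → ℤ-span⇒K-span (ℤ-span-generator (q⊆p∪q S ⁅ e ⁆ (x∈⁅x⁆ e)))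
           ; (suc k) → KL.Span-mono _ (p⊆p∪q ⁅ e ⁆) (b∈S k) })
        rank′

    rank-stays : ∀ {S e r r′} → ℚSpan x S (x e) → HasKRank X S r → HasKRank X (S ∪ ⁅ e ⁆) r′ → r′ ℕ.≤ r
    rank-stays {S} {e} xₑ∈S rank (b , indep , b∈S , _) = KS.independent⇒≤ indep
      (λ k → KL.Span-absorb _ S e (ℚSpan⇒K-span xₑ∈S) (b∈S k)) rank

    module _ (𝒜 : ArithmeticMatroidData N) (rank : ∀ S → HasKRank X S (ArithmeticMatroidData.rk 𝒜 S)) where

      open ArithmeticMatroidData 𝒜

      -- A relation with c e ≠ 0 makes c e times the span of S contained in the span of S - e.
      independent⇒no-relation : ∀ {S} → IsIndependent 𝒜 S → (c : Vector ℤ N) → (∀ e → e ∉ S → c e ≡ 0ℤ) →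
        (∀ i → ℤ-Linear.combination c x i ≡ 0ℤ) → ∀ e → c e ≡ 0ℤ
      independent⇒no-relation {S} rk≡ c c∉ cx≡0 e with c e ℤ.≟ 0ℤ
      ... | yes cₑ≡0 = cₑ≡0
      ... | no  cₑ≢0 with e ∈? S
      ...   | no  e∉S = c∉ e e∉S
      ...   | yes e∈S with rank S
      ...     | b , indep , b∈S , _ = contradiction (x∈p⇒∣p-x∣<∣p∣ e∈S) (ℕ.≤⇒≯ (subst (ℕ._≤ ∣ S - e ∣) rk≡
                  (KS.independent⇒≤∣∣ (λ f → scalars (x f)) (S - e) scaled-independent λ k →
                    coefficients k , coefficients∉ k , combination≈ k)))
        where
        cₑ = ι (c e)
        b′ : Fin (rk S) → Vector K.Carrier d
        b′ k i = cₑ K.* b k i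
        scaled-independent : KA.LinearlyIndependent b′
        scaled-independent a a≈0 k = cancel (indep (λ k → cₑ K.* a k) (λ i → K.trans
          (KL.sum-cong-≋ λ k → K.trans (K.*-congʳ {b k i} (K.*-comm cₑ (a k))) (K.*-assoc (a k) cₑ (b k i))) (a≈0 i)) k) (ι-≢0 cₑ≢0)
        a = λ k → proj₁ (b∈S k)
        coefficients : Fin (rk S) → Vector K.Carrier N
        coefficients k f = cₑ K.* a k f K.- a k e K.* ι (c f)
        coefficients∉ : ∀ k f → f ∉ S - e → coefficients k f K.≈ K.0#
        coefficients∉ k f f∉ with f ≟ e
        ... | yes refl = K.trans (K.+-congʳ (K.*-comm cₑ (a k e))) (K.-‿inverseʳ (a k e K.* cₑ))
        ... | no  f≢e  = K.trans (K.+-cong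
            (K.trans (K.*-congˡ {cₑ} (proj₁ (proj₂ (b∈S k)) f f∉S)) (K.zeroʳ cₑ))
            (K.-‿cong (K.trans (K.*-congˡ {a k e} (ι-≡0 (c∉ f f∉S))) (K.zeroʳ (a k e)))))
            (K.-‿inverseʳ (K.0#))
          where
          f∉S : f ∉ S
          f∉S f∈S = f∉ (x∈p∧x≢y⇒x∈p-y f∈S f≢e)
        combination≈ : ∀ k i → b′ k i K.≈ KA.combination (coefficients k) (λ f → scalars (x f)) i
        combination≈ k i = begin
          cₑ K.* b k i                                            ≈⟨ K.*-congˡ {cₑ} (proj₂ (proj₂ (b∈S k)) i) ⟩
          cₑ K.* (a k KL.· xᵢ)                                    ≈⟨ K.*-congˡ {cₑ} (KL.·-comm (a k) xᵢ) ⟩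
          cₑ K.* (xᵢ KL.· a k)                                    ≈⟨ KL.·-* xᵢ cₑ (a k) ⟨
          A                                                      ≈⟨ K.+-identityʳ _ ⟨
          A K.+ K.0#                                          ≈⟨ K.+-congˡ {A} (K.-‿inverseʳ (K.0#)) ⟨
          A K.+ (K.0# K.- K.0#)                      ≈⟨ K.+-congˡ {A} (K.+-identityˡ _) ⟩
          A K.- K.0#                                    ≈⟨ K.+-congˡ {A} (K.-‿cong (K.trans (K.*-congˡ {a k e} relation) (K.zeroʳ (a k e)))) ⟨
          A K.- a k e K.* (xᵢ KL.· scalars c)                ≈⟨ K.+-congˡ {A} (K.-‿cong (KL.·-* xᵢ (a k e) (scalars c))) ⟨
          A K.- xᵢ KL.· (λ f → a k e K.* ι (c f))        ≈⟨ KL.·-- xᵢ (λ f → cₑ K.* a k f) (λ f → a k e K.* ι (c f)) ⟨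
          xᵢ KL.· coefficients k                                 ≈⟨ KL.·-comm xᵢ (coefficients k) ⟩
          coefficients k KL.· xᵢ                                 ∎
          where
          xᵢ : Vector K.Carrier N
          xᵢ f = ι (x f i)
          A = xᵢ KL.· (λ f → cₑ K.* a k f)
          relation : xᵢ KL.· scalars c K.≈ K.0#
          relation = K.trans (KL.·-comm xᵢ (scalars c)) (K.trans (K.sym (ι-· c (λ f → x f i))) (ι-≡0 (cx≡0 i)))

      -- If `φ` did not vanish at `e`, adjoining `e` would raise the rank and `B ∪ ⁅ e ⁆` would be
      -- independent; maximality then puts `e` into `B`, where `φ` vanishes.
      basis-annihilator : ∀ {B} → IsBasis 𝒜 B → ∀ {φ} → Annihilates φ x B → ∀ e → φ · x e ≡ 0ℤ
      basis-annihilator {B} (rk≡ , maximal) {φ} φB≡0 e with φ · x e ℤ.≟ 0ℤ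
      ... | yes φxₑ≡0 = φxₑ≡0
      ... | no  φxₑ≢0 = φB≡0 e (maximal (B ∪ ⁅ e ⁆) independent (p⊆p∪q ⁅ e ⁆) (q⊆p∪q B ⁅ e ⁆ (x∈⁅x⁆ e)))
        where
        independent : IsIndependent 𝒜 (B ∪ ⁅ e ⁆)
        independent = ℕ.≤-antisym
          (let b , indep , b∈ , _ = rank (B ∪ ⁅ e ⁆) in KS.independent⇒≤∣∣ _ (B ∪ ⁅ e ⁆) {b} indep b∈)
          (ℕ.≤-trans (∣p∪⁅x⁆∣≤1+∣p∣ B e)
            (subst (ℕ._< rk (B ∪ ⁅ e ⁆)) rk≡ (rank-increases {B} {φ} φB≡0 φxₑ≢0 (rank B) (rank (B ∪ ⁅ e ⁆)))))

      -- If φ i ≠ 0, the `i`-th unit vector together with a basis of the full span would be d + 1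
      -- independent vectors in a space of dimension d.
      full-rank⇒no-annihilator : HasKRank X ⊤ d → ∀ {φ} → (∀ e → φ · x e ≡ 0ℤ) → ∀ i → φ i ≡ 0ℤ
      full-rank⇒no-annihilator (b , indep , b∈ , _) {φ} φX≡0 i with φ i ℤ.≟ 0ℤ
      ... | yes φᵢ≡0 = φᵢ≡0
      ... | no  φᵢ≢0 = contradiction (subst (suc d ℕ.≤_) (∣⊤∣≡n d) (KS.independent⇒≤∣∣ (λ j → scalars (identity j)) ⊤
        (KS.cons-independent (scalars φ) (scalars (identity i)) b
          (λ φᵢ≈0 → ι-≢0 φᵢ≢0 (K.trans (K.reflexive (cong ι (trans (sym (identity-· i φ)) (ℤL.·-comm (identity i) φ)))) (K.trans (ι-· φ (identity i)) φᵢ≈0)))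
          (λ k → K-span-annihilated {⊤} {φ} (λ e _ → φX≡0 e) (b∈ k)) indep)
        λ k → (scalars (identity i) Vector.∷ b) k , (λ e e∉ → contradiction ∈⊤ e∉) , λ j → K.sym (standard _ j)))
        (ℕ.<-irrefl refl)
        where
        standard : (y : Vector K.Carrier d) → ∀ j → y KL.· (λ e → ι (identity e j)) K.≈ y j
        standard y j = K.trans
          (KL.sum-single (λ e → y e K.* ι (identity e j)) j λ e e≢j →
            K.trans (K.*-congˡ {y e} (ι-≡0 (identity-≢ e≢j))) (K.zeroʳ (y e)))
          (K.trans (K.*-congˡ {y j} (K.trans (K.reflexive (cong ι (identity-≡ j))) ι-1)) (K.*-identityʳ (y j)))

      basis-spans : HasKRank X ⊤ d → ∀ {B} → IsBasis 𝒜 B → ∀ v → ℚSpan x B v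
      basis-spans full {B} basis v with span-or-functional x B v
      ... | inj₁ span = span
      ... | inj₂ (φ , φB≡0 , φv≢0) = contradiction
        (ℤL.sum-zero λ i → cong (_* v i) (full-rank⇒no-annihilator full {φ} (basis-annihilator basis {φ} φB≡0) i)) φv≢0

ℝ-scalarRing : ScalarRing 0ℓ 0ℓ
ℝ-scalarRing = record
  { ring         = ℝ-commutativeRing
  ; ι            = fromℤ
  ; ι-0          = ≗⇒≈ℝ λ _ → refl
  ; ι-1          = ≗⇒≈ℝ λ _ → refl
  ; ι-+          = fromℤ-+
  ; ι-*          = fromℤ-*
  ; ι-injective  = λ {i} → fromℤ-injective {i} {0ℤ}
  ; ι-reciprocal = fromℤ-reciprocal
  ; cancel       = λ {x} {y} → ℝ-cancel {x} {y}
  ; stable       = λ {x} → ℝ-stable {x}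
  }

module ℝE = ScalarExtension ℝ-scalarRing

-- Signs, contents and residues of integers.

IsSign : ℤ → Set
IsSign s = s ≡ 1ℤ ⊎ s ≡ -1ℤ

sign² : ∀ {s} → IsSign s → s * s ≡ 1ℤ
sign² (inj₁ refl) = refl
sign² (inj₂ refl) = refl

sign-abs : ∀ i → ∃[ s ] IsSign s × i ≡ s * + ℤ.∣ i ∣
sign-abs (+ n)    = 1ℤ , inj₁ refl , sym (ℤ.*-identityˡ (+ n))
sign-abs -[1+ n ] = -1ℤ , inj₂ refl , sym (ℤ.-1*i≡-i (+ suc n))

+-≡⇒ℤ : ∀ {g} x y {m n} → g ℕ.+ y ℕ.* n ≡ x ℕ.* m → + g ≡ + x * + m ℤ.- + y * + n
+-≡⇒ℤ {g} x y {m} {n} eq = begin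
  + g                                    ≡⟨ solve 2 (λ g t → g := (g :+ t) :- t) refl (+ g) (+ y * + n) ⟩
  (+ g + + y * + n) ℤ.- + y * + n        ≡⟨ cong (λ t → (+ g + t) ℤ.- + y * + n) (ℤ.pos-* y n) ⟨
  + (g ℕ.+ y ℕ.* n) ℤ.- + y * + n        ≡⟨ cong (λ t → + t ℤ.- + y * + n) eq ⟩
  + (x ℕ.* m) ℤ.- + y * + n              ≡⟨ cong (ℤ._- + y * + n) (ℤ.pos-* x m) ⟩
  + x * + m ℤ.- + y * + n                ∎
  where
  open ≡.≡-Reasoning
  open +-*-Solver

bezout : ∀ a (b : ℕ) → ∃[ g ] ∃[ p ] ∃[ q ] ∃[ α ] ∃[ β ]
  (a ≡ + g * p) × (+ b ≡ + g * q) × (α * a + β * + b ≡ + g)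
bezout a b with sign-abs a | Bézout.lemma ℤ.∣ a ∣ b
... | s , s-sign , a≡ | Bézout.result g gcd identity with GCD.commonDivisor gcd
...   | divides k ∣a∣≡ , divides l b≡ = g , s * + k , + l , α identity , β identity
  , trans a≡ (trans (cong (λ z → s * + z) ∣a∣≡) (trans (cong (s *_) (ℤ.pos-* k g)) (solve 3 (λ s k g → s :* (k :* g) := g :* (s :* k)) refl s (+ k) (+ g))))
  , trans (cong +_ b≡) (trans (ℤ.pos-* l g) (ℤ.*-comm (+ l) (+ g)))
  , combined identity
  where
  open ≡.≡-Reasoning
  open +-*-Solver
  α β : Bézout.Identity g ℤ.∣ a ∣ b → ℤ
  α (Bézout.+- x y eq) = s * + x
  α (Bézout.-+ x y eq) = ℤ.- (s * + x)
  β (Bézout.+- x y eq) = ℤ.- (+ y)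
  β (Bézout.-+ x y eq) = + y
  cancel-sign : ∀ x → s * x * a ≡ x * + ℤ.∣ a ∣
  cancel-sign x = begin
    s * x * a                       ≡⟨ cong (s * x *_) a≡ ⟩
    s * x * (s * + ℤ.∣ a ∣)         ≡⟨ solve 3 (λ s x a → s :* x :* (s :* a) := s :* s :* (x :* a)) refl s x (+ ℤ.∣ a ∣) ⟩
    s * s * (x * + ℤ.∣ a ∣)         ≡⟨ cong (_* (x * + ℤ.∣ a ∣)) (sign² s-sign) ⟩
    1ℤ * (x * + ℤ.∣ a ∣)            ≡⟨ ℤ.*-identityˡ _ ⟩
    x * + ℤ.∣ a ∣                   ∎
  combined : ∀ i → α i * a + β i * + b ≡ + g
  combined (Bézout.+- x y eq) = trans
    (cong₂ _+_ (cancel-sign (+ x)) (sym (ℤ.neg-distribˡ-* (+ y) (+ b)))) (sym (+-≡⇒ℤ x y eq))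
  combined (Bézout.-+ x y eq) = trans
    (cong (_+ + y * + b) (trans (sym (ℤ.neg-distribˡ-* (s * + x) a)) (cong ℤ.-_ (cancel-sign (+ x)))))
    (trans (ℤ.+-comm _ (+ y * + b)) (sym (+-≡⇒ℤ y x eq)))

-- `g` is the gcd of the entries and `u` a Bézout vector. Keeping `u` makes primitivity an equation,
-- u · p = 1, which survives linear changes of coordinates.
content : ∀ {n} (v : Vector ℤ n) → ∃[ g ] Σ (Vector ℤ n) λ p → Σ (Vector ℤ n) λ u → (∀ i → v i ≡ + g * p i) × u · v ≡ + g
content {zero}  v = 0 , v , v , (λ ()) , refl
content {suc n} v with content (v ∘ suc)
... | h , p , u , v≡ , uv≡h with bezout (v zero) h
...   | g , r , q , α , β , v₀≡ , h≡ , αβ = g , (r Vector.∷ λ i → q * p i) , (α Vector.∷ λ i → β * u i)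
  , (λ { zero → v₀≡ ; (suc i) → trans (v≡ i) (trans (cong (_* p i) h≡) (ℤ.*-assoc (+ g) q (p i))) })
  , trans (cong (λ z → α * v zero + z) (begin
      (λ i → β * u i) · (v ∘ suc)      ≡⟨ ℤL.·-comm (λ i → β * u i) (v ∘ suc) ⟩
      (v ∘ suc) · (λ i → β * u i)      ≡⟨ ℤL.·-* (v ∘ suc) β u ⟩
      β * ((v ∘ suc) · u)              ≡⟨ cong (β *_) (trans (ℤL.·-comm (v ∘ suc) u) uv≡h) ⟩
      β * + h                          ∎)) αβ
  where open ≡.≡-Reasoning

*-cancelˡ : ∀ {k i j} → k ≢ 0ℤ → k * i ≡ k * j → i ≡ j
*-cancelˡ {k} {i} {j} k≢0 = ℤ.*-cancelˡ-≡ k i j {{ℤ.≢-nonZero k≢0}}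

primitive-part : ∀ {n} (v : Vector ℤ n) {i} → v i ≢ 0ℤ →
  ∃[ g ] + g ≢ 0ℤ × Σ (Vector ℤ n) λ p → Σ (Vector ℤ n) λ u → (∀ i → v i ≡ + g * p i) × u · p ≡ 1ℤ
primitive-part v {i} vᵢ≢0 with content v
... | g , p , u , v≡ , uv≡g = g , g≢0 , p , u , v≡ , *-cancelˡ g≢0 (begin
  + g * (u · p)              ≡⟨ ℤL.·-* u (+ g) p ⟨
  u · (λ i → + g * p i)      ≡⟨ ℤL.·-cong {u = u} (λ _ → refl) v≡ ⟨
  u · v                      ≡⟨ uv≡g ⟩
  + g                        ≡⟨ ℤ.*-identityʳ (+ g) ⟨
  + g * 1ℤ                   ∎)
  where
  open ≡.≡-Reasoning
  g≢0 : + g ≢ 0ℤ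
  g≢0 g≡0 = vᵢ≢0 (trans (v≡ i) (cong (_* p i) g≡0))

residue-unique : ∀ {g a b} c → a ℕ.< g → b ℕ.< g → + a ℤ.- + b ≡ c * + g → a ≡ b
residue-unique {g} {a} {b} c a<g b<g eq with sign-abs c
... | s , s-sign , c≡ = residue-unique′ s-sign ℤ.∣ c ∣ (trans eq (cong (_* + g) c≡))
  where
  open ≡.≡-Reasoning
  open +-*-Solver
  bound : ∀ {a b} k → + a ≡ + b + + k * + g → a ℕ.< g → a ≡ b
  bound {a} {b} k eq a<g with trans eq (cong (λ z → + b + z) (sym (ℤ.pos-* k g)))
  ... | eq′ with k
  ...   | zero   = trans (ℤ.+-injective eq′) (ℕ.+-identityʳ b)
  ...   | suc k′ = contradiction a<g (ℕ.≤⇒≯ (subst (g ℕ.≤_) (sym (ℤ.+-injective eq′)) (ℕ.≤-trans (ℕ.m≤m+n g (k′ ℕ.* g)) (ℕ.m≤n+m _ b))))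
  residue-unique′ : ∀ {s} → IsSign s → ∀ k → + a ℤ.- + b ≡ s * + k * + g → a ≡ b
  residue-unique′ (inj₁ refl) k eq = bound k (begin
    + a                              ≡⟨ solve 2 (λ a b → a := b :+ (a :- b)) refl (+ a) (+ b) ⟩
    + b + (+ a ℤ.- + b)              ≡⟨ cong (λ z → + b + z) eq ⟩
    + b + 1ℤ * + k * + g             ≡⟨ cong (λ z → + b + z * + g) (ℤ.*-identityˡ (+ k)) ⟩
    + b + + k * + g                  ∎) a<g
  residue-unique′ (inj₂ refl) k eq = sym (bound k (begin
    + b                              ≡⟨ solve 2 (λ a b → b := a :- (a :- b)) refl (+ a) (+ b) ⟩
    + a ℤ.- (+ a ℤ.- + b)            ≡⟨ cong (λ z → + a ℤ.- z) eq ⟩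
    + a ℤ.- -1ℤ * + k * + g          ≡⟨ solve 3 (λ a k g → a :- con -1ℤ :* k :* g := a :+ k :* g) refl (+ a) (+ k) (+ g) ⟩
    + a + + k * + g                  ∎) b<g)

-- Counting the classes of the torsion quotient.

injective⇒surjective : ∀ {a b} {f : Fin a → Fin b} → b ℕ.≤ a → Injective _≡_ _≡_ f → ∀ y → ∃[ i ] f i ≡ y
injective⇒surjective {a} {b} {f} b≤a inj y with any? (λ i → f i ≟ y)
... | yes hit = hit
... | no miss = contradiction (ℕ.≤-trans (injective⇒≤ extended-injective) b≤a) (ℕ.<-irrefl refl)
  where
  extended : Fin (suc a) → Fin b
  extended zero    = y
  extended (suc i) = f i
  extended-injective : Injective _≡_ _≡_ extended
  extended-injective {zero}  {zero}  eq = refl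
  extended-injective {zero}  {suc j} eq = contradiction (j , sym eq) miss
  extended-injective {suc i} {zero}  eq = contradiction (i , eq) miss
  extended-injective {suc i} {suc j} eq = cong suc (inj eq)

module _ {d N} {X : Matrix d N} {S k} (bijection : HasMultiplicity X S k) where

  open Bijection bijection using (to; injective; surjective) renaming (cong to to-cong)
  open Setoid (TorsionQuotient X S) using (Carrier; _≈_) renaming (refl to ≈-refl)

  representative : Fin k → Carrier
  representative y = proj₁ (surjective y)

  to-representative : ∀ y → to (representative y) ≡ y
  to-representative y = proj₂ (surjective y) {representative y} (≈-refl {representative y})

  multiplicity-≥ : ∀ {n} (f : Fin n → Carrier) → (∀ i j → f i ≈ f j → i ≡ j) → n ℕ.≤ k
  multiplicity-≥ f inj = injective⇒≤ {f = to ∘ f} λ {i} {j} eq → inj i j (injective {f i} {f j} eq)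

  multiplicity-≤ : ∀ {n} (f : Carrier → Fin n) → (∀ u v → f u ≡ f v → u ≈ v) → k ℕ.≤ n
  multiplicity-≤ f inj = injective⇒≤ {f = f ∘ representative} λ {y} {z} eq →
    trans (sym (to-representative y)) (trans (to-cong {representative y} {representative z} (inj _ _ eq)) (to-representative z))

multiples-of-primitive : ∀ {n} {p u : Vector ℤ n} {s t} → u · p ≡ 1ℤ → (∀ i → s * p i ≡ t * p i) → s ≡ t
multiples-of-primitive {p = p} {u} {s} {t} up≡1 sp≡tp = begin
  s                       ≡⟨ scale s ⟨
  u · (λ i → s * p i)     ≡⟨ ℤL.·-cong {u = u} (λ _ → refl) sp≡tp ⟩
  u · (λ i → t * p i)     ≡⟨ scale t ⟩
  t                       ∎
  where
  open ≡.≡-Reasoning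
  scale : ∀ t → u · (λ i → t * p i) ≡ t
  scale t = trans (ℤL.·-* u t p) (trans (cong (t *_) up≡1) (ℤ.*-identityʳ t))

module _ {d N} (X : Matrix d N) {e : Fin N} where

  span-singleton : ∀ {w} → ℤ-span X ⁅ e ⁆ w → ∃[ c ] (∀ i → w i ≡ c * X i e)
  span-singleton (a , a∉ , w≡) = a e , λ i → trans (w≡ i)
    (ℤL.sum-single (λ f → a f * X i f) e λ f f≢e → cong (_* X i f) (a∉ f (f≢e ∘ x∈⁅y⁆⇒x≡y e)))

  -- The 2 × 2 minors are values of integer functionals that kill `x e`, so they vanish on its real
  -- line; the real coefficient itself is never identified as a rational.
  ℝ-span-singleton-proportional : ∀ {v} → ℝ-span X ⁅ e ⁆ (λ i → fromℤ (v i)) → ∀ i j → X i e * v j ≡ X j e * v i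
  ℝ-span-singleton-proportional {v} v∈ i j = ℤ.i-j≡0⇒i≡j _ _
    (trans (sym (φ-· v)) (ℝE.ℤ∩K-span-annihilated X {⁅ e ⁆} {φ} kills v∈))
    where
    open ≡.≡-Reasoning
    φ : Vector ℤ d
    φ k = X i e * identity j k ℤ.- X j e * identity i k
    φ-· : ∀ u → φ · u ≡ X i e * u j ℤ.- X j e * u i
    φ-· u = begin
      φ · u                                                                     ≡⟨ ℤL.·-comm φ u ⟩
      u · φ                                                                     ≡⟨ ℤL.·-- u (λ k → X i e * identity j k) (λ k → X j e * identity i k) ⟩
      u · (λ k → X i e * identity j k) ℤ.- u · (λ k → X j e * identity i k)     ≡⟨ cong₂ ℤ._-_ (entry (X i e) j) (entry (X j e) i) ⟩
      X i e * u j ℤ.- X j e * u i                                               ∎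
      where
      entry : ∀ t k → u · (λ l → t * identity k l) ≡ t * u k
      entry t k = trans (ℤL.·-* u t (identity k)) (cong (t *_) (trans (ℤL.·-comm u (identity k)) (identity-· k u)))
    kills : Annihilates φ (column X) ⁅ e ⁆
    kills f f∈ with x∈⁅y⁆⇒x≡y e f∈
    ... | refl = trans (φ-· (column X e)) (trans (cong (λ z → X i e * X j e ℤ.- z) (ℤ.*-comm (X j e) (X i e))) (ℤ.+-inverseʳ (X i e * X j e)))

  -- Writing the column as g p with `p` primitive, the integer points of its line are the multiples
  -- of `p`, so the quotient is ℤ/g and k = g. The multiples 0, ..., g - 1 give one inequality,
  -- residues modulo `g` the other.
  multiplicity-divides : ∀ {k i} → X i e ≢ 0ℤ → HasMultiplicity X ⁅ e ⁆ k →
    Σ (Vector ℤ d) λ p → ∀ i → X i e ≡ + k * p i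
  multiplicity-divides {k} {i} xᵢ≢0 bijection with primitive-part (column X e) xᵢ≢0
  ... | g , g≢0 , p , u , x≡gp , up≡1 = p , subst (λ z → ∀ i → X i e ≡ + z * p i) (ℕ.≤-antisym
      (multiplicity-≥ bijection multiples multiples-injective)
      (multiplicity-≤ bijection residue residue-injective)) x≡gp
    where
    open ≡.≡-Reasoning
    open +-*-Solver
    open Setoid (TorsionQuotient X ⁅ e ⁆) using (Carrier; _≈_)
    instance
      g-nonZero : ℕ.NonZero g
      g-nonZero = ℕ.≢-nonZero λ g≡0 → g≢0 (cong +_ g≡0)
    multiples : Fin g → Carrier
    multiples j = (λ i → + toℕ j * p i) , ℝE.ℚSpan⇒K-span X (+ g , g≢0 ,
      ℤ-Linear.Span-* (column X) ⁅ e ⁆ (+ toℕ j) (ℝE.ℤ-span-generator X (x∈⁅x⁆ e)) λ i →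
        trans (solve 3 (λ g j p → g :* (j :* p) := j :* (g :* p)) refl (+ g) (+ toℕ j) (p i)) (cong (+ toℕ j *_) (sym (x≡gp i))))
    multiples-injective : ∀ j l → multiples j ≈ multiples l → j ≡ l
    multiples-injective j l j≈l with span-singleton j≈l
    ... | c , eq = toℕ-injective (residue-unique c (toℕ<n j) (toℕ<n l) (multiples-of-primitive {p = p} {u} up≡1 λ i → begin
      (+ toℕ j ℤ.- + toℕ l) * p i             ≡⟨ solve 3 (λ j l p → (j :- l) :* p := j :* p :- l :* p) refl (+ toℕ j) (+ toℕ l) (p i) ⟩
      + toℕ j * p i ℤ.- + toℕ l * p i         ≡⟨ eq i ⟩
      c * X i e                               ≡⟨ cong (c *_) (x≡gp i) ⟩
      c * (+ g * p i)                         ≡⟨ ℤ.*-assoc c (+ g) (p i) ⟨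
      c * + g * p i                           ∎))
    on-line : ∀ {v} → ℝ-span X ⁅ e ⁆ (λ i → fromℤ (v i)) → ∀ j → v j ≡ (u · v) * p j
    on-line {v} v∈ j = *-cancelˡ g≢0 (begin
      + g * v j                                 ≡⟨ cong (+ g *_) (trans (sym (ℤ.*-identityˡ (v j))) (cong (_* v j) (sym up≡1))) ⟩
      + g * ((u · p) * v j)                     ≡⟨ solve 3 (λ g s v → g :* (s :* v) := v :* (g :* s)) refl (+ g) (u · p) (v j) ⟩
      v j * (+ g * (u · p))                     ≡⟨ cong (v j *_) (ℤL.·-* u (+ g) p) ⟨
      v j * (u · (λ i → + g * p i))             ≡⟨ ℤL.·-* u (v j) (λ i → + g * p i) ⟨
      u · (λ i → v j * (+ g * p i))             ≡⟨ ℤL.·-cong {u = u} (λ _ → refl) (λ i → trans (cong (v j *_) (sym (x≡gp i))) (trans (ℤ.*-comm (v j) (X i e)) (trans (ℝ-span-singleton-proportional v∈ i j) (cong (_* v i) (x≡gp j))))) ⟩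
      u · (λ i → + g * p j * v i)               ≡⟨ ℤL.·-* u (+ g * p j) v ⟩
      + g * p j * (u · v)                       ≡⟨ solve 3 (λ g p s → g :* p :* s := g :* (s :* p)) refl (+ g) (p j) (u · v) ⟩
      + g * ((u · v) * p j)                     ∎)
    residue : Carrier → Fin g
    residue (v , _) = fromℕ< (n%ℕd<d (u · v) g)
    residue-injective : ∀ v w → residue v ≡ residue w → v ≈ w
    residue-injective (v , v∈) (w , w∈) eq = ℤ-Linear.Span-* (column X) ⁅ e ⁆ (u · v /ℕ g ℤ.- u · w /ℕ g)
      (ℝE.ℤ-span-generator X (x∈⁅x⁆ e)) λ i → begin
        v i ℤ.- w i                                       ≡⟨ cong₂ ℤ._-_ (on-line v∈ i) (on-line w∈ i) ⟩
        (u · v) * p i ℤ.- (u · w) * p i                   ≡⟨ cong₂ (λ a b → a * p i ℤ.- b * p i) (a≡a%ℕn+[a/ℕn]*n (u · v) g) (a≡a%ℕn+[a/ℕn]*n (u · w) g) ⟩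
        (+ rᵥ + qᵥ * + g) * p i ℤ.- (+ r + q * + g) * p i ≡⟨ cong (λ z → (+ z + qᵥ * + g) * p i ℤ.- (+ r + q * + g) * p i) r≡ ⟩
        (+ r + qᵥ * + g) * p i ℤ.- (+ r + q * + g) * p i  ≡⟨ solve 5 (λ r q q′ g p → (r :+ q :* g) :* p :- (r :+ q′ :* g) :* p := (q :- q′) :* (g :* p)) refl (+ r) qᵥ q (+ g) (p i) ⟩
        (qᵥ ℤ.- q) * (+ g * p i)                          ≡⟨ cong ((qᵥ ℤ.- q) *_) (x≡gp i) ⟨
        (qᵥ ℤ.- q) * X i e                                ∎
      where
      rᵥ = u · v %ℕ g
      r = u · w %ℕ g
      qᵥ = u · v /ℕ g
      q = u · w /ℕ g
      r≡ : rᵥ ≡ r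
      r≡ = trans (sym (toℕ-fromℕ< (n%ℕd<d (u · v) g))) (trans (cong toℕ eq) (toℕ-fromℕ< (n%ℕd<d (u · w) g)))

-- A multiplicative basis yields a basis of the lattice.

∏ : ∀ {n} → (Fin n → ℕ) → ℕ
∏ {zero}  h = 1
∏ {suc n} h = h zero ℕ.* ∏ (h ∘ suc)

-- Brings the list product of `IsMultiplicative` into a form whose factors are indexed by all of
-- `Fin n`, as the digit expansion below requires.
product-filter-tabulate : ∀ {a p n} {A : Set a} {P : A → Set p} (P? : Decidable P) (f : A → ℕ) (g : Fin n → A) →
  product (map f (filter P? (tabulate g))) ≡ ∏ (λ i → if does (P? (g i)) then f (g i) else 1)
product-filter-tabulate {n = zero}  P? f g = refl
product-filter-tabulate {n = suc n} P? f g with does (P? (g zero))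
... | true  = cong (f (g zero) ℕ.*_) (product-filter-tabulate P? f (g ∘ suc))
... | false = trans (product-filter-tabulate P? f (g ∘ suc)) (sym (ℕ.*-identityˡ _))

∏-divisor : ∀ {n} (h : Fin n → ℕ) i → ∃[ l ] ∏ h ≡ h i ℕ.* l
∏-divisor h zero    = ∏ (h ∘ suc) , refl
∏-divisor h (suc i) with ∏-divisor (h ∘ suc) i
... | l , eq = h zero ℕ.* l , trans (cong (h zero ℕ.*_) eq)
  (trans (sym (ℕ.*-assoc (h zero) (h (suc i)) l)) (trans (cong (ℕ._* l) (ℕ.*-comm (h zero) (h (suc i)))) (ℕ.*-assoc (h (suc i)) (h zero) l)))

-- Mixed-radix expansion: `Fin (∏ h)` stands for the box of vectors whose entry at `i` is below
-- `h i`.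
digits : ∀ {n} {h : Fin n → ℕ} → Fin (∏ h) → ∀ i → Fin (h i)
digits {h = h} y zero    = proj₁ (remQuot {h zero} (∏ (h ∘ suc)) y)
digits {h = h} y (suc i) = digits {h = h ∘ suc} (proj₂ (remQuot {h zero} (∏ (h ∘ suc)) y)) i

digits-injective : ∀ {n} {h : Fin n → ℕ} (y z : Fin (∏ h)) → (∀ i → digits {h = h} y i ≡ digits {h = h} z i) → y ≡ z
digits-injective {zero}  {h} zero zero eq = refl
digits-injective {suc n} {h} y z eq = begin
  y                                                   ≡⟨ combine-remQuot {h zero} (∏ (h ∘ suc)) y ⟨
  combine (proj₁ (split y)) (proj₂ (split y))         ≡⟨ cong₂ combine (eq zero) (digits-injective {h = h ∘ suc} _ _ (eq ∘ suc)) ⟩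
  combine (proj₁ (split z)) (proj₂ (split z))         ≡⟨ combine-remQuot {h zero} (∏ (h ∘ suc)) z ⟩
  z                                                   ∎
  where
  open ≡.≡-Reasoning
  split : Fin (∏ h) → _
  split = remQuot {h zero} (∏ (h ∘ suc))

⊡-assoc : ∀ {k l m n} (X : Matrix k l) (Y : Matrix l m) (Z : Matrix m n) → (X ⊡ Y) ⊡ Z ≐ X ⊡ (Y ⊡ Z)
⊡-assoc X Y Z i j = ℤL.·-swap (X i) Y (λ k → Z k j)

-- P and Q are mutually inverse once the index set [N] is cut down to B: the columns of P in B are
-- a basis of ℤᵈ, and the rows of Q in B are the dual basis.
record Frame {d N} (X : Matrix d N) (B : Subset N) (m : Fin N → ℕ) : Set where
  field
    P     : Matrix d N
    Q     : Matrix N d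
    P∉    : ∀ {e} → e ∉ B → ∀ i → P i e ≡ 0ℤ
    Q∉    : ∀ {e} → e ∉ B → ∀ i → Q e i ≡ 0ℤ
    PQ    : P ⊡ Q ≐ identity
    QP    : ∀ e {f} → f ∈ B → (Q ⊡ P) e f ≡ identity e f
    scale : ∀ {e} → e ∈ B → ∀ i → X i e ≡ + m e * P i e
    m≢0   : ∀ {e} → e ∈ B → m e ≢ 0

module _ {d N} (X : Matrix d N) (full : HasRank X ⊤ d) (𝒜 : ArithmeticMatroidData N) (represents : Represents X 𝒜)
  {B : Subset N} (basis : IsBasis 𝒜 B) (multiplicative : IsMultiplicative 𝒜 B) where

  open ArithmeticMatroidData 𝒜
  open Represents represents

  private
    mₑ : Fin N → ℕ
    mₑ e = m ⁅ e ⁆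

    no-relation : (c : Vector ℤ N) → (∀ e → e ∉ B → c e ≡ 0ℤ) → (∀ i → c · X i ≡ 0ℤ) → ∀ e → c e ≡ 0ℤ
    no-relation = ℝE.independent⇒no-relation X 𝒜 rank (proj₁ basis)


    nonzero-column : ∀ {e} → e ∈ B → ∃[ i ] X i e ≢ 0ℤ
    nonzero-column {e} e∈B with zero-or-pivot (column X e)
    ... | inj₂ pivot = pivot
    ... | inj₁ xₑ≡0 = contradiction (trans (sym (identity-≡ e)) (no-relation (identity e)
          (λ f f∉B → identity-≢ λ { refl → f∉B e∈B })
          (λ i → trans (identity-· e (X i)) (xₑ≡0 i)) e)) λ ()

    Generator : Fin N → Set
    Generator e = Σ (Vector ℤ d) λ p → (e ∉ B → ∀ i → p i ≡ 0ℤ) × (e ∈ B → ∀ i → X i e ≡ + mₑ e * p i)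

    generator′ : ∀ e → Dec (e ∈ B) → Generator e
    generator′ e (no  e∉B) = (λ _ → 0ℤ) , (λ _ _ → refl) , λ e∈B → contradiction e∈B e∉B
    generator′ e (yes e∈B) =
      let p , x≡ = multiplicity-divides X (proj₂ (nonzero-column e∈B)) (multiplicity ⁅ e ⁆)
      in p , (λ e∉B → contradiction e∈B e∉B) , λ _ → x≡

    abstract
      generator : ∀ e → Generator e
      generator e = generator′ e (e ∈? B)

    P : Matrix d N
    P i e = proj₁ (generator e) i

    P∉ : ∀ {e} → e ∉ B → ∀ i → P i e ≡ 0ℤ
    P∉ {e} = proj₁ (proj₂ (generator e))

    X≡mP : ∀ {e} → e ∈ B → ∀ i → X i e ≡ + mₑ e * P i e
    X≡mP {e} = proj₂ (proj₂ (generator e))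

    -- The value 1 off `B` leaves only the digit 0 there, so that `digit y` is supported on `B`.
    h : Fin N → ℕ
    h e = if does (e ∈? B) then mₑ e else 1

    h∈ : ∀ {e} → e ∈ B → h e ≡ mₑ e
    h∈ {e} e∈B with e ∈? B
    ... | yes _   = refl
    ... | no  e∉B = contradiction e∈B e∉B

    h∉ : ∀ {e} → e ∉ B → h e ≡ 1
    h∉ {e} e∉B with e ∈? B
    ... | yes e∈B = contradiction e∈B e∉B
    ... | no  _   = refl

    mB≡∏h : m B ≡ ∏ h
    mB≡∏h = trans multiplicative (product-filter-tabulate (_∈? B) mₑ (λ e → e))

    anything∈B : ∀ v → ℝ-span X B (λ i → fromℤ (v i))
    anything∈B v = ℝE.ℚSpan⇒K-span X (ℝE.basis-spans X 𝒜 rank full basis v)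

    ∏h≢0 : ∏ h ≢ 0
    ∏h≢0 ∏≡0 = ¬Fin0 (subst Fin (trans mB≡∏h ∏≡0)
      (Bijection.to (multiplicity B) ((λ _ → 0ℤ) , anything∈B (λ _ → 0ℤ))))

    -- Clearing the denominators mₑ with their common multiple ∏ h turns a relation between the
    -- columns of P into one between the columns of X.
    P-independent : (c : Vector ℤ N) → (∀ e → e ∉ B → c e ≡ 0ℤ) → (∀ i → P i · c ≡ 0ℤ) → ∀ e → c e ≡ 0ℤ
    P-independent c c∉ Pc≡0 e = *-cancel-0 (no-relation c′ c′∉ relation e) l≢0
      where
      open ≡.≡-Reasoning
      open +-*-Solver
      l : Fin N → ℕ
      l e = proj₁ (∏-divisor h e)
      l≢0 : + l e ≢ 0ℤ
      l≢0 l≡0 = ∏h≢0 (trans (proj₂ (∏-divisor h e)) (trans (cong (h e ℕ.*_) (ℤ.+-injective l≡0)) (ℕ.*-zeroʳ (h e))))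
      c′ : Vector ℤ N
      c′ e = + l e * c e
      c′∉ : ∀ e → e ∉ B → c′ e ≡ 0ℤ
      c′∉ e e∉ = trans (cong (+ l e *_) (c∉ e e∉)) (ℤ.*-zeroʳ (+ l e))
      relation : ∀ i → c′ · (λ e → X i e) ≡ 0ℤ
      relation i = begin
        c′ · X i                                  ≡⟨ ℤL.sum-cong-≋ {N} term ⟩
        (λ e → P i e) · (λ e → + ∏ h * c e)       ≡⟨ ℤL.·-* (P i) (+ ∏ h) c ⟩
        + ∏ h * P i · c                           ≡⟨ cong (+ ∏ h *_) (Pc≡0 i) ⟩
        + ∏ h * 0ℤ                                ≡⟨ ℤ.*-zeroʳ (+ ∏ h) ⟩
        0ℤ                                        ∎
        where
        term : ∀ e → c′ e * X i e ≡ P i e * (+ ∏ h * c e)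
        term e with e ∈? B
        ... | no  e∉ = trans (cong (_* X i e) (c′∉ e e∉)) (sym (trans (cong (λ z → P i e * (+ ∏ h * z)) (c∉ e e∉)) (trans (cong (P i e *_) (ℤ.*-zeroʳ (+ ∏ h))) (ℤ.*-zeroʳ (P i e)))))
        ... | yes e∈ = begin
          + l e * c e * X i e                     ≡⟨ cong (+ l e * c e *_) (X≡mP e∈ i) ⟩
          + l e * c e * (+ mₑ e * P i e)          ≡⟨ solve 4 (λ l c m p → l :* c :* (m :* p) := p :* (m :* l :* c)) refl (+ l e) (c e) (+ mₑ e) (P i e) ⟩
          P i e * (+ mₑ e * + l e * c e)          ≡⟨ cong (λ z → P i e * (z * c e)) (ℤ.pos-* (mₑ e) (l e)) ⟨
          P i e * (+ (mₑ e ℕ.* l e) * c e)        ≡⟨ cong (λ z → P i e * (+ (z ℕ.* l e) * c e)) (h∈ e∈) ⟨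
          P i e * (+ (h e ℕ.* l e) * c e)         ≡⟨ cong (λ z → P i e * (+ z * c e)) (proj₂ (∏-divisor h e)) ⟨
          P i e * (+ ∏ h * c e)                   ∎

    digit : Fin (∏ h) → Vector ℤ N
    digit y e = + toℕ (digits {h = h} y e)

    digit∉ : ∀ y {e} → e ∉ B → digit y e ≡ 0ℤ
    digit∉ y {e} e∉ = cong +_ (ℕ.n<1⇒n≡0 (subst (toℕ (digits {h = h} y e) ℕ.<_) (h∉ e∉) (toℕ<n (digits {h = h} y e))))

    open Setoid (TorsionQuotient X B) using (Carrier; _≈_)

    point : Fin (∏ h) → Carrier
    point y = (λ i → P i · digit y) , anything∈B (λ i → P i · digit y)

    span-in-P : ∀ w → ((a , _) : ℤ-span X B w) → ∀ i → w i ≡ P i · (λ e → + mₑ e * a e)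
    span-in-P w (a , a∉ , w≡) i = trans (w≡ i) (ℤL.sum-cong-≋ {N} term)
      where
      open +-*-Solver
      term : ∀ e → a e * X i e ≡ P i e * (+ mₑ e * a e)
      term e with e ∈? B
      ... | yes e∈ = trans (cong (a e *_) (X≡mP e∈ i)) (solve 3 (λ a m p → a :* (m :* p) := p :* (m :* a)) refl (a e) (+ mₑ e) (P i e))
      ... | no  e∉ = trans (cong (_* X i e) (a∉ e e∉)) (sym (cong (_* (+ mₑ e * a e)) (P∉ e∉ i)))

    -- If two points differ by an element of the lattice generated by `B`, independence of `P`
    -- compares coefficients: their digits at `e` are congruent modulo m({e}) and lie below it,
    -- hence are equal.
    point-injective : ∀ y z → point y ≈ point z → y ≡ z
    point-injective y z y≈z@(a , a∉ , _) = digits-injective {h = h} y z λ e → toℕ-injective (digit≡ e (e ∈? B))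
      where
      open ≡.≡-Reasoning
      c : Vector ℤ N
      c e = (digit y e ℤ.- digit z e) ℤ.- + mₑ e * a e
      c∉ : ∀ e → e ∉ B → c e ≡ 0ℤ
      c∉ e e∉ rewrite digit∉ y e∉ | digit∉ z e∉ | a∉ e e∉ | ℤ.*-zeroʳ (+ mₑ e) = refl
      Pc≡0 : ∀ i → P i · c ≡ 0ℤ
      Pc≡0 i = begin
        P i · c                                                               ≡⟨ ℤL.·-- (P i) (λ e → digit y e ℤ.- digit z e) (λ e → + mₑ e * a e) ⟩
        P i · (λ e → digit y e ℤ.- digit z e) ℤ.- P i · (λ e → + mₑ e * a e)  ≡⟨ cong₂ ℤ._-_ (ℤL.·-- (P i) (digit y) (digit z)) (sym (span-in-P (λ i → P i · digit y ℤ.- P i · digit z) y≈z i)) ⟩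
        (P i · digit y ℤ.- P i · digit z) ℤ.- (P i · digit y ℤ.- P i · digit z) ≡⟨ ℤ.+-inverseʳ (P i · digit y ℤ.- P i · digit z) ⟩
        0ℤ                                                                    ∎
      digit≡ : ∀ e → Dec (e ∈ B) → toℕ (digits {h = h} y e) ≡ toℕ (digits {h = h} z e)
      digit≡ e (no  e∉) = ℤ.+-injective (trans (digit∉ y e∉) (sym (digit∉ z e∉)))
      digit≡ e (yes e∈) = residue-unique (a e) (toℕ<n (digits {h = h} y e)) (toℕ<n (digits {h = h} z e))
        (trans (ℤ.i-j≡0⇒i≡j _ _ (P-independent c c∉ Pc≡0 e)) (trans (ℤ.*-comm (+ mₑ e) (a e)) (cong (λ z → a e * + z) (sym (h∈ e∈)))))

    PSpan : Vector ℤ d → Set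
    PSpan v = Σ (Vector ℤ N) λ c → (∀ e → e ∉ B → c e ≡ 0ℤ) × (∀ i → v i ≡ P i · c)

    congruent⇒PSpan : ∀ {v} y → ℤ-span X B (λ i → v i ℤ.- P i · digit y) → PSpan v
    congruent⇒PSpan {v} y v≈y@(a , a∉ , _) = (λ e → digit y e + + mₑ e * a e)
      , (λ e e∉ → cong₂ _+_ (digit∉ y e∉) (trans (cong (+ mₑ e *_) (a∉ e e∉)) (ℤ.*-zeroʳ (+ mₑ e))))
      , λ i → begin
        v i                                                  ≡⟨ solve 2 (λ v w → v := w :+ (v :- w)) refl (v i) (P i · digit y) ⟩
        P i · digit y + (v i ℤ.- P i · digit y)              ≡⟨ cong (λ z → P i · digit y + z) (span-in-P (λ i → v i ℤ.- P i · digit y) v≈y i) ⟩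
        P i · digit y + P i · (λ e → + mₑ e * a e)           ≡⟨ ℤL.·-+ (P i) (digit y) (λ e → + mₑ e * a e) ⟨
        P i · (λ e → digit y e + + mₑ e * a e)               ∎
      where
      open ≡.≡-Reasoning
      open +-*-Solver

    abstract
      -- The place where multiplicativity is decisive: the ∏ h = m(B) points are pairwise
      -- incongruent, hence represent every class of ℤᵈ modulo the lattice generated by `B`. That
      -- lattice lies in the span of `P`, so `P` generates ℤᵈ.
      P-spans : ∀ v → PSpan v
      P-spans v =
        let y , eq = injective⇒surjective {f = λ y → Bijection.to (multiplicity B) (point y)} (ℕ.≤-reflexive mB≡∏h)
                       (λ {y} {z} eq → point-injective y z (Bijection.injective (multiplicity B) {point y} {point z} eq))
                       (Bijection.to (multiplicity B) (v , anything∈B v))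
        in congruent⇒PSpan {v} y (Bijection.injective (multiplicity B) {v , anything∈B v} {point y} (sym eq))

  frame : Frame X B mₑ
  frame = record
    { P = P
    ; Q = Q
    ; P∉ = P∉
    ; Q∉ = Q∉
    ; PQ = PQ
    ; QP = QP
    ; scale = X≡mP
    ; m≢0 = λ e∈ m≡0 → let i , xᵢ≢0 = nonzero-column e∈ in xᵢ≢0 (trans (X≡mP e∈ i) (cong (λ z → + z * P i _) m≡0))
    }
    where
    open ≡.≡-Reasoning
    Q : Matrix N d
    Q e j = proj₁ (P-spans (λ i → identity i j)) e
    Q∉ : ∀ {e} → e ∉ B → ∀ j → Q e j ≡ 0ℤ
    Q∉ {e} e∉ j = proj₁ (proj₂ (P-spans (λ i → identity i j))) e e∉
    PQ : P ⊡ Q ≐ identity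
    PQ i j = sym (proj₂ (proj₂ (P-spans (λ i → identity i j))) i)
    -- `P` sends column `f` of `QP - identity` to PQP - P = 0, and the columns of `P` in `B` are
    -- independent.
    QP : ∀ e {f} → f ∈ B → (Q ⊡ P) e f ≡ identity e f
    QP e {f} f∈ = ℤ.i-j≡0⇒i≡j _ _ (P-independent (λ e → (Q ⊡ P) e f ℤ.- identity e f)
      (λ e e∉ → cong₂ ℤ._-_ (ℤL.sum-zero λ j → cong (_* P j f) (Q∉ e∉ j)) (identity-≢ λ { refl → e∉ f∈ }))
      (λ i → begin
        P i · (λ e → (Q ⊡ P) e f ℤ.- identity e f)                    ≡⟨ ℤL.·-- (P i) (λ e → (Q ⊡ P) e f) (λ e → identity e f) ⟩
        P i · (λ e → (Q ⊡ P) e f) ℤ.- P i · (λ e → identity e f)      ≡⟨ cong₂ ℤ._-_ (trans (sym (⊡-assoc P Q P i f)) (ℤL.sum-cong-≋ {d} λ j → cong (_* P j f) (PQ i j))) (·-identity (P i) f) ⟩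
        identity i · (λ j → P j f) ℤ.- P i f                          ≡⟨ cong (ℤ._- P i f) (identity-· i (λ j → P j f)) ⟩
        P i f ℤ.- P i f                                               ≡⟨ ℤ.+-inverseʳ (P i f) ⟩
        0ℤ                                                            ∎) e)

-- The effect of one further element on the multiplicity.

module _ {d N} {X : Matrix d N} where

  multiplicity-nonzero : ∀ {S k} → HasMultiplicity X S k → k ≢ 0
  multiplicity-nonzero {S} bijection k≡0 = ¬Fin0 (subst Fin k≡0 (Bijection.to bijection
    ((λ _ → 0ℤ) , ℝE.ℤ-span⇒K-span X (ℤ-Linear.Span-0 (column X) S (λ _ → refl)))))

-- The hypotheses say that `ψ` maps ℤᵈ onto ℤ, split by `u`, and that its kernel consists of the
-- integer points in the span of `S`. Since ψ(xₑ) ≠ 0, the set S ∪ e has full rank.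
module _ {d N} (X : Matrix d N) {S e} (ψ u : Vector ℤ d) (ψu≡1 : ψ · u ≡ 1ℤ)
  (ψS≡0 : Annihilates ψ (column X) S) (ψxₑ≢0 : ψ · column X e ≢ 0ℤ)
  (kernel : ∀ w → ψ · w ≡ 0ℤ → ℚSpan (column X) S w) where

  private
    x = column X
    S′ = S ∪ ⁅ e ⁆
    c = ℤ.∣ ψ · x e ∣

    instance
      c-nonZero : ℕ.NonZero c
      c-nonZero = ℕ.≢-nonZero λ c≡0 → ψxₑ≢0 (ℤ.∣i∣≡0⇒i≡0 c≡0)

    σ = proj₁ (sign-abs (ψ · x e))

    ψxₑ≡σc : ψ · x e ≡ σ * + c
    ψxₑ≡σc = proj₂ (proj₂ (sign-abs (ψ · x e)))

    σψxₑ≡c : σ * ψ · x e ≡ + c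
    σψxₑ≡c = begin
      σ * ψ · x e          ≡⟨ cong (σ *_) ψxₑ≡σc ⟩
      σ * (σ * + c)        ≡⟨ ℤ.*-assoc σ σ (+ c) ⟨
      σ * σ * + c          ≡⟨ cong (_* + c) (sign² (proj₁ (proj₂ (sign-abs (ψ · x e))))) ⟩
      1ℤ * + c             ≡⟨ ℤ.*-identityˡ (+ c) ⟩
      + c                  ∎
      where open ≡.≡-Reasoning

    ψ-linear : ∀ v a w → ψ · (λ i → v i + a * w i) ≡ ψ · v + a * ψ · w
    ψ-linear v a w = trans (ℤL.·-+ ψ v (λ i → a * w i)) (cong (λ z → ψ · v + z) (ℤL.·-* ψ a w))

    open Setoid (TorsionQuotient X S) using (Carrier; _≈_)
    open Setoid (TorsionQuotient X S′) using () renaming (Carrier to Carrier′; _≈_ to _≈′_)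

    xₑ∈S′ : ℤ-span X S′ (x e)
    xₑ∈S′ = ℝE.ℤ-span-generator X (q⊆p∪q S ⁅ e ⁆ (x∈⁅x⁆ e))

    eliminate-xₑ : Vector ℤ d → Vector ℤ d
    eliminate-xₑ w i = ψ · x e * w i + ℤ.- (ψ · w) * x e i

    ψ-eliminate-xₑ : ∀ w → ψ · eliminate-xₑ w ≡ 0ℤ
    ψ-eliminate-xₑ w = begin
      ψ · eliminate-xₑ w                                    ≡⟨ ψ-linear (λ i → ψ · x e * w i) (ℤ.- (ψ · w)) (x e) ⟩
      ψ · (λ i → ψ · x e * w i) + ℤ.- (ψ · w) * ψ · x e     ≡⟨ cong (λ z → z + ℤ.- (ψ · w) * ψ · x e) (ℤL.·-* ψ (ψ · x e) w) ⟩
      ψ · x e * ψ · w + ℤ.- (ψ · w) * ψ · x e               ≡⟨ solve 2 (λ a b → a :* b :+ (:- b) :* a := con 0ℤ) refl (ψ · x e) (ψ · w) ⟩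
      0ℤ                                                    ∎
      where
      open ≡.≡-Reasoning
      open +-*-Solver

    ℚ-spanned : ∀ w → ℚSpan x S (eliminate-xₑ w) → ℚSpan x S′ w
    ℚ-spanned w (k , k≢0 , span) = k * ψ · x e , *-≢0 k≢0 ψxₑ≢0 ,
      ℤ-Linear.Span-+ x S′ {λ i → k * eliminate-xₑ w i} {λ i → k * ψ · w * x e i}
        (ℤL.Span-mono x (p⊆p∪q ⁅ e ⁆) span) (ℤ-Linear.Span-* x S′ (k * ψ · w) xₑ∈S′ λ i → refl) λ i →
        solve 5 (λ k a w b y → k :* a :* w := k :* (a :* w :+ (:- b) :* y) :+ k :* b :* y) refl k (ψ · x e) (w i) (ψ · w) (x e i)
      where open +-*-Solver

    anything∈S′ : ∀ w → ℝ-span X S′ (λ i → fromℤ (w i))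
    anything∈S′ w = ℝE.ℚSpan⇒K-span X (ℚ-spanned w (kernel (eliminate-xₑ w) (ψ-eliminate-xₑ w)))

    module _ {s t} (bij : HasMultiplicity X S s) (bij′ : HasMultiplicity X S′ t) where

      open ≡.≡-Reasoning
      open +-*-Solver

      v : Fin s → Vector ℤ d
      v k = proj₁ (representative bij k)

      ψv≡0 : ∀ k → ψ · v k ≡ 0ℤ
      ψv≡0 k = ℝE.ℤ∩K-span-annihilated X {S} {ψ} ψS≡0 {v k} (proj₂ (representative bij k))

      -- Representatives of the extension: a class of the kernel plus `j` times the splitting `u`.
      -- Applying `ψ` recovers `j` modulo `c`, after which the class `k` is determined.
      offset : Fin s → Fin c → Vector ℤ d
      offset k j i = v k i + + toℕ j * u i

      point : Fin s → Fin c → Carrier′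
      point k j = offset k j , anything∈S′ (offset k j)

      ψ-point : ∀ k j → ψ · offset k j ≡ + toℕ j
      ψ-point k j = trans (ψ-linear (v k) (+ toℕ j) u) (trans (cong₂ (λ a b → a + + toℕ j * b) (ψv≡0 k) ψu≡1)
        (trans (ℤ.+-identityˡ _) (ℤ.*-identityʳ (+ toℕ j))))

      point-injective : ∀ k j k′ j′ → point k j ≈′ point k′ j′ → k ≡ k′ × j ≡ j′
      point-injective k j k′ j′ (a , a∉ , eq) = k≡k′ , j≡j′
        where
        a∉S : ∀ f → f ≢ e → f ∉ S → a f ≡ 0ℤ
        a∉S f f≢e f∉S = a∉ f λ f∈ → [ f∉S , (λ f∈e → f≢e (x∈⁅y⁆⇒x≡y e f∈e)) ]′ (x∈p∪q⁻ S ⁅ e ⁆ f∈)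
        j-j′ : + toℕ j ℤ.- + toℕ j′ ≡ a e * ψ · x e
        j-j′ = begin
          + toℕ j ℤ.- + toℕ j′                        ≡⟨ cong₂ (λ a b → a ℤ.- b) (ψ-point k j) (ψ-point k′ j′) ⟨
          ψ · offset k j ℤ.- ψ · offset k′ j′                 ≡⟨ ℤL.·-- ψ (offset k j) (offset k′ j′) ⟨
          ψ · (λ i → offset k j i ℤ.- offset k′ j′ i)        ≡⟨ ℤL.·-cong {u = ψ} (λ _ → refl) eq ⟩
          ψ · ℤ-Linear.combination a x                ≡⟨ ℤL.·-combination ψ a x ⟩
          a · (λ f → ψ · x f)                         ≡⟨ ℤL.sum-single (λ f → a f * ψ · x f) e term ⟩
          a e * ψ · x e                               ∎
          where
          term : ∀ f → f ≢ e → a f * ψ · x f ≡ 0ℤ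
          term f f≢e with f ∈? S
          ... | yes f∈S = trans (cong (a f *_) (ψS≡0 f f∈S)) (ℤ.*-zeroʳ (a f))
          ... | no  f∉S = cong (_* ψ · x f) (a∉S f f≢e f∉S)
        j≡j′ : j ≡ j′
        j≡j′ = toℕ-injective (residue-unique (a e * σ) (toℕ<n j) (toℕ<n j′)
          (trans j-j′ (trans (cong (a e *_) ψxₑ≡σc) (sym (ℤ.*-assoc (a e) σ (+ c))))))
        aₑ≡0 : a e ≡ 0ℤ
        aₑ≡0 = *-cancel-0 (trans (ℤ.*-comm (ψ · x e) (a e)) (trans (sym j-j′)
          (trans (cong (λ l → + toℕ l ℤ.- + toℕ j′) j≡j′) (ℤ.+-inverseʳ (+ toℕ j′))))) ψxₑ≢0
        k≡k′ : k ≡ k′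
        k≡k′ = trans (sym (to-representative bij k)) (trans (Bijection.cong bij {representative bij k} {representative bij k′}
          (a , a∉S′ , λ i → begin
            v k i ℤ.- v k′ i                                                     ≡⟨ solve 3 (λ v v′ t → v :- v′ := (v :+ t) :- (v′ :+ t)) refl (v k i) (v k′ i) (+ toℕ j′ * u i) ⟩
            (v k i + + toℕ j′ * u i) ℤ.- (v k′ i + + toℕ j′ * u i)               ≡⟨ cong (λ l → (v k i + + toℕ l * u i) ℤ.- (v k′ i + + toℕ j′ * u i)) j≡j′ ⟨
            (v k i + + toℕ j * u i) ℤ.- (v k′ i + + toℕ j′ * u i)                ≡⟨ eq i ⟩
            ℤ-Linear.combination a x i                                           ∎)) (to-representative bij k′))
          where
          a∉S′ : ∀ f → f ∉ S → a f ≡ 0ℤ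
          a∉S′ f f∉S with f ≟ e
          ... | yes refl = aₑ≡0
          ... | no  f≢e  = a∉S f f≢e f∉S

      s*c≤t : s ℕ.* c ℕ.≤ t
      s*c≤t = multiplicity-≥ bij′ (λ y → point (proj₁ (remQuot {s} c y)) (proj₂ (remQuot {s} c y))) λ y z eq →
        let k≡ , j≡ = point-injective _ _ _ _ eq
        in trans (sym (combine-remQuot {s} c y)) (trans (cong₂ combine k≡ j≡) (combine-remQuot {s} c z))

      r : Vector ℤ d → ℕ
      r w = ψ · w %ℕ c

      q : Vector ℤ d → ℤ
      q w = ψ · w /ℕ c

      -- Removes the remainder along `u` and the quotient along xₑ, so that the result lies in the
      -- kernel of `ψ`. The sign σ is there because ψ(xₑ) = σ c while the division is by `c`.
      reduced : Vector ℤ d → Vector ℤ d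
      reduced w i = (w i + ℤ.- (+ r w) * u i) + ℤ.- (q w * σ) * x e i

      reduced-carrier : Vector ℤ d → Carrier
      reduced-carrier w = reduced w , ℝE.ℚSpan⇒K-span X (kernel (reduced w) (begin
        ψ · reduced w
          ≡⟨ ψ-linear (λ i → w i + ℤ.- (+ r w) * u i) (ℤ.- (q w * σ)) (x e) ⟩
        ψ · (λ i → w i + ℤ.- (+ r w) * u i) + ℤ.- (q w * σ) * ψ · x e
          ≡⟨ cong₂ _+_ (trans (ψ-linear w (ℤ.- (+ r w)) u) (cong₂ (λ a b → a + ℤ.- (+ r w) * b) (a≡a%ℕn+[a/ℕn]*n (ψ · w) c) ψu≡1)) (solve 3 (λ q s y → (:- (q :* s)) :* y := :- (q :* (s :* y))) refl (q w) σ (ψ · x e)) ⟩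
        ((+ r w + q w * + c) + ℤ.- (+ r w) * 1ℤ) + ℤ.- (q w * (σ * ψ · x e))
          ≡⟨ cong (λ z → ((+ r w + q w * + c) + ℤ.- (+ r w) * 1ℤ) + ℤ.- (q w * z)) σψxₑ≡c ⟩
        ((+ r w + q w * + c) + ℤ.- (+ r w) * 1ℤ) + ℤ.- (q w * + c)
          ≡⟨ solve 3 (λ r q c → ((r :+ q :* c) :+ (:- r) :* con 1ℤ) :+ :- (q :* c) := con 0ℤ) refl (+ r w) (q w) (+ c) ⟩
        0ℤ ∎))

      t≤s*c : t ℕ.≤ s ℕ.* c
      t≤s*c = multiplicity-≤ bij′ code λ (w , _) (z , _) eq →
        let k≡ , j≡ = combine-injective (Bijection.to bij (reduced-carrier w)) (fromℕ< (n%ℕd<d (ψ · w) c)) (Bijection.to bij (reduced-carrier z)) (fromℕ< (n%ℕd<d (ψ · z) c)) eq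
            r≡ = trans (sym (toℕ-fromℕ< (n%ℕd<d (ψ · w) c))) (trans (cong toℕ j≡) (toℕ-fromℕ< (n%ℕd<d (ψ · z) c)))
        in ℤ-Linear.Span-+ x S′
             (ℤL.Span-mono x (p⊆p∪q ⁅ e ⁆) (Bijection.injective bij {reduced-carrier w} {reduced-carrier z} k≡))
             (ℤ-Linear.Span-* x S′ (q w * σ ℤ.- q z * σ) xₑ∈S′ λ i → refl) λ i → trans
               (solve 7 (λ w z r u qw qz y → w :- z := (((w :+ (:- r) :* u) :+ (:- qw) :* y) :- ((z :+ (:- r) :* u) :+ (:- qz) :* y)) :+ (qw :- qz) :* y) refl
                 (w i) (z i) (+ r z) (u i) (q w * σ) (q z * σ) (x e i))
               (cong (λ r′ → (((w i + ℤ.- (+ r′) * u i) + ℤ.- (q w * σ) * x e i) ℤ.- reduced z i) + (q w * σ ℤ.- q z * σ) * x e i) (sym r≡))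
        where
        code : Carrier′ → Fin (s ℕ.* c)
        code (w , _) = combine (Bijection.to bij (reduced-carrier w)) (fromℕ< (n%ℕd<d (ψ · w) c))

  -- ℤᵈ/⟨S ∪ e⟩ is an extension of ℤ/ψ(xₑ) by (⟨S⟩_ℝ ∩ ℤᵈ)/⟨S⟩.
  multiplicity-adjoin : ∀ {s t} → HasMultiplicity X S s → HasMultiplicity X (S ∪ ⁅ e ⁆) t → t ≡ s ℕ.* ℤ.∣ ψ · column X e ∣
  multiplicity-adjoin bij bij′ = ℕ.≤-antisym (t≤s*c bij bij′) (s*c≤t bij bij′)

-- Functionals whose absolute values the arithmetic matroid determines.

-- Up to scale, `φ` is the equation of the hyperplane spanned by the columns in `U`, inside the
-- coordinate space of `B` regarded as a subspace of that of [N].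
record SpannedKernel {n N} (A : Matrix n N) (B : Subset n) (φ : Vector ℤ n) (U : Subset N) : Set where
  field
    supported   : ∀ {r} → r ∉ B → φ r ≡ 0ℤ
    annihilates : Annihilates φ (column A) U
    kernel      : ∀ w → (∀ {r} → r ∉ B → w r ≡ 0ℤ) → φ · w ≡ 0ℤ → ℚSpan (column A) U w

module _ {d N} (X : Matrix d N) (𝒜 : ArithmeticMatroidData N) (represents : Represents X 𝒜)
  {B : Subset N} {μ : Fin N → ℕ} (frame : Frame X B μ) where

  open ArithmeticMatroidData 𝒜
  open Represents represents
  open Frame frame
  open ≡.≡-Reasoning

  private
    A : Matrix N N
    A = Q ⊡ X

    P-Q : ∀ (v : Vector ℤ d) i → P i · (λ r → Q r · v) ≡ v i
    P-Q v i = begin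
      P i · (λ r → Q r · v)                    ≡⟨ ℤL.·-swap (P i) Q v ⟨
      (λ j → P i · (λ r → Q r j)) · v          ≡⟨ ℤL.·-cong {v = v} (PQ i) (λ _ → refl) ⟩
      identity i · v                           ≡⟨ identity-· i v ⟩
      v i                                      ∎

  module _ {φ U} (spanned : SpannedKernel A B φ U) {g ψ u} (g≢0 : + g ≢ 0ℤ)
    (φ≡gψ : ∀ r → φ r ≡ + g * ψ r) (uψ≡1 : u · ψ ≡ 1ℤ) where

    open SpannedKernel spanned

    private
      φ-· : ∀ w → φ · w ≡ + g * ψ · w
      φ-· w = begin
        φ · w                      ≡⟨ ℤL.·-comm φ w ⟩
        w · φ                      ≡⟨ ℤL.·-cong {u = w} (λ _ → refl) φ≡gψ ⟩
        w · (λ r → + g * ψ r)      ≡⟨ ℤL.·-* w (+ g) ψ ⟩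
        + g * w · ψ                ≡⟨ cong (+ g *_) (ℤL.·-comm w ψ) ⟩
        + g * ψ · w                ∎

      ψ-supported : ∀ {r} → r ∉ B → ψ r ≡ 0ℤ
      ψ-supported {r} r∉ = *-cancel-0 (trans (sym (φ≡gψ r)) (supported r∉)) g≢0

      -- `ψ` carried to ℤᵈ by `Q`, with Bézout vector P u. It stays primitive because `P` and `Q`
      -- are inverse to each other on the part supported on `B`.
      ψ̂ : Vector ℤ d
      ψ̂ j = ψ · (λ r → Q r j)

      û : Vector ℤ d
      û i = P i · u

      ψ̂-· : ∀ v → ψ̂ · v ≡ ψ · (λ r → Q r · v)
      ψ̂-· = ℤL.·-swap ψ Q

      ψ-QP : ∀ f → ψ · (λ r → (Q ⊡ P) r f) ≡ ψ f
      ψ-QP f with f ∈? B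
      ... | yes f∈ = trans (ℤL.·-cong {u = ψ} (λ _ → refl) (λ r → QP r f∈)) (·-identity ψ f)
      ... | no  f∉ = trans (ℤL.sum-zero {N} λ r → trans (cong (ψ r *_) (ℤL.sum-zero {d} λ j → trans (cong (Q r j *_) (P∉ f∉ j)) (ℤ.*-zeroʳ (Q r j)))) (ℤ.*-zeroʳ (ψ r))) (sym (ψ-supported f∉))

      ψ̂û≡1 : ψ̂ · û ≡ 1ℤ
      ψ̂û≡1 = begin
        ψ̂ · û                                        ≡⟨ ψ̂-· û ⟩
        ψ · (λ r → Q r · û)                          ≡⟨ ℤL.·-cong {u = ψ} (λ _ → refl) (λ r → ℤL.·-swap (Q r) P u) ⟨
        ψ · (λ r → (Q ⊡ P) r · u)                    ≡⟨ ℤL.·-swap ψ (Q ⊡ P) u ⟨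
        (λ f → ψ · (λ r → (Q ⊡ P) r f)) · u          ≡⟨ ℤL.·-cong {v = u} ψ-QP (λ _ → refl) ⟩
        ψ · u                                        ≡⟨ ℤL.·-comm ψ u ⟩
        u · ψ                                        ≡⟨ uψ≡1 ⟩
        1ℤ                                           ∎

      φ-column : ∀ f → φ · column A f ≡ + g * ψ̂ · column X f
      φ-column f = trans (φ-· (column A f)) (cong (+ g *_) (sym (ψ̂-· (column X f))))

      ψ̂U≡0 : Annihilates ψ̂ (column X) U
      ψ̂U≡0 f f∈ = *-cancel-0 (trans (sym (φ-column f)) (annihilates f f∈)) g≢0

      ψ̂-kernel : ∀ w → ψ̂ · w ≡ 0ℤ → ℚSpan (column X) U w
      ψ̂-kernel w ψ̂w≡0 with kernel (λ r → Q r · w) (λ r∉ → ℤL.sum-zero λ j → cong (_* w j) (Q∉ r∉ j))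
                              (trans (φ-· (λ r → Q r · w)) (trans (cong (+ g *_) (trans (sym (ψ̂-· w)) ψ̂w≡0)) (ℤ.*-zeroʳ (+ g))))
      ... | k , k≢0 , a , a∉ , kQw≡ = k , k≢0 , a , a∉ , λ i → begin
        k * w i                                           ≡⟨ cong (k *_) (P-Q w i) ⟨
        k * P i · (λ r → Q r · w)                         ≡⟨ ℤL.·-* (P i) k (λ r → Q r · w) ⟨
        P i · (λ r → k * Q r · w)                         ≡⟨ ℤL.·-cong {u = P i} (λ _ → refl) kQw≡ ⟩
        P i · ℤ-Linear.combination a (column A)           ≡⟨ ℤL.·-combination (P i) a (column A) ⟩
        a · (λ f → P i · column A f)                      ≡⟨ ℤL.·-cong {u = a} (λ _ → refl) (λ f → P-Q (column X f) i) ⟩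
        ℤ-Linear.combination a (column X) i               ∎

    -- The columns on which `φ` vanishes form the closure of `U`; together with `rank-at-nonzero`
    -- this makes the vanishing of `φ` at `e` a matter of rank alone.
    rank-at-zero : ∀ {e} → φ · column A e ≡ 0ℤ → rk (U ∪ ⁅ e ⁆) ℕ.≤ rk U
    rank-at-zero {e} φAₑ≡0 = ℝE.rank-stays X
      (ψ̂-kernel (column X e) (*-cancel-0 (trans (sym (φ-column e)) φAₑ≡0) g≢0)) (rank U) (rank (U ∪ ⁅ e ⁆))

    module _ {e} (φAₑ≢0 : φ · column A e ≢ 0ℤ) where

      private
        ψ̂xₑ≢0 : ψ̂ · column X e ≢ 0ℤ
        ψ̂xₑ≢0 eq = φAₑ≢0 (trans (φ-column e) (trans (cong (+ g *_) eq) (ℤ.*-zeroʳ (+ g))))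

      rank-at-nonzero : rk U ℕ.< rk (U ∪ ⁅ e ⁆)
      rank-at-nonzero = ℝE.rank-increases X {U} {ψ̂} ψ̂U≡0 ψ̂xₑ≢0 (rank U) (rank (U ∪ ⁅ e ⁆))

      multiplicity-at-nonzero : g ℕ.* m (U ∪ ⁅ e ⁆) ≡ m U ℕ.* ℤ.∣ φ · column A e ∣
      multiplicity-at-nonzero = begin
        g ℕ.* m (U ∪ ⁅ e ⁆)                            ≡⟨ cong (g ℕ.*_) (multiplicity-adjoin X ψ̂ û ψ̂û≡1 ψ̂U≡0 ψ̂xₑ≢0 ψ̂-kernel (multiplicity U) (multiplicity (U ∪ ⁅ e ⁆))) ⟩
        g ℕ.* (m U ℕ.* c)                              ≡⟨ ℕ.*-assoc g (m U) c ⟨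
        g ℕ.* m U ℕ.* c                                ≡⟨ cong (ℕ._* c) (ℕ.*-comm g (m U)) ⟩
        m U ℕ.* g ℕ.* c                                ≡⟨ ℕ.*-assoc (m U) g c ⟩
        m U ℕ.* (g ℕ.* c)                              ≡⟨ cong (m U ℕ.*_) (trans (cong ℤ.∣_∣ (φ-column e)) (ℤ.abs-* (+ g) (ψ̂ · column X e))) ⟨
        m U ℕ.* ℤ.∣ φ · column A e ∣                   ∎
        where c = ℤ.∣ ψ̂ · column X e ∣

module _ {d N} (X X′ : Matrix d N) (𝒜 : ArithmeticMatroidData N) (rep : Represents X 𝒜) (rep′ : Represents X′ 𝒜)
  {B : Subset N} {μ : Fin N → ℕ} (F : Frame X B μ) (F′ : Frame X′ B μ) where

  private
    A = Frame.Q F ⊡ X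
    A′ = Frame.Q F′ ⊡ X′

  -- Sign changes do not alter the content: as σ² = 1, σψ is primitive with Bézout vector σu. Both
  -- values are thus governed by the same `g`, m(U) and m(U ∪ e), and m(U) ≠ 0 can be cancelled.
  equal-values : ∀ {φ σ : Vector ℤ N} {r U} → φ r ≢ 0ℤ → (∀ r → IsSign (σ r)) →
    SpannedKernel A B φ U → SpannedKernel A′ B (λ r → σ r * φ r) U →
    ∀ e → ℤ.∣ φ · column A e ∣ ≡ ℤ.∣ (λ r → σ r * φ r) · column A′ e ∣
  equal-values {φ} {σ} {r} {U} φᵣ≢0 signs spanned spanned′ e with primitive-part φ φᵣ≢0
  ... | g , g≢0 , ψ , u , φ≡gψ , uψ≡1 = compare (φ · column A e ℤ.≟ 0ℤ) (φ′ · column A′ e ℤ.≟ 0ℤ)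
    where
    open ≡.≡-Reasoning
    open +-*-Solver
    open ArithmeticMatroidData 𝒜
    φ′ ψ′ u′ : Vector ℤ N
    φ′ r = σ r * φ r
    ψ′ r = σ r * ψ r
    u′ r = σ r * u r
    φ′≡gψ′ : ∀ r → φ′ r ≡ + g * ψ′ r
    φ′≡gψ′ r = trans (cong (σ r *_) (φ≡gψ r)) (solve 3 (λ s g p → s :* (g :* p) := g :* (s :* p)) refl (σ r) (+ g) (ψ r))
    u′ψ′≡1 : u′ · ψ′ ≡ 1ℤ
    u′ψ′≡1 = trans (ℤL.sum-cong-≋ {N} λ r → trans
      (solve 3 (λ s u p → s :* u :* (s :* p) := s :* s :* (u :* p)) refl (σ r) (u r) (ψ r))
      (trans (cong (_* (u r * ψ r)) (sign² (signs r))) (ℤ.*-identityˡ (u r * ψ r)))) uψ≡1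
    compare : Dec (φ · column A e ≡ 0ℤ) → Dec (φ′ · column A′ e ≡ 0ℤ) →
      ℤ.∣ φ · column A e ∣ ≡ ℤ.∣ φ′ · column A′ e ∣
    compare (yes z) (yes z′) = trans (cong ℤ.∣_∣ z) (sym (cong ℤ.∣_∣ z′))
    compare (yes z) (no ¬z′) = contradiction (rank-at-nonzero X′ 𝒜 rep′ F′ spanned′ {g} {ψ′} {u′} g≢0 φ′≡gψ′ u′ψ′≡1 ¬z′)
                                             (ℕ.≤⇒≯ (rank-at-zero X 𝒜 rep F spanned {g} {ψ} {u} g≢0 φ≡gψ uψ≡1 z))
    compare (no ¬z) (yes z′) = contradiction (rank-at-nonzero X 𝒜 rep F spanned {g} {ψ} {u} g≢0 φ≡gψ uψ≡1 ¬z)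
                                             (ℕ.≤⇒≯ (rank-at-zero X′ 𝒜 rep′ F′ spanned′ {g} {ψ′} {u′} g≢0 φ′≡gψ′ u′ψ′≡1 z′))
    compare (no ¬z) (no ¬z′) = ℕ.*-cancelˡ-≡ _ _ (m U) {{ℕ.≢-nonZero (multiplicity-nonzero (Represents.multiplicity rep U))}}
      (trans (sym (multiplicity-at-nonzero X 𝒜 rep F spanned {g} {ψ} {u} g≢0 φ≡gψ uψ≡1 ¬z))
             (multiplicity-at-nonzero X′ 𝒜 rep′ F′ spanned′ {g} {ψ′} {u′} g≢0 φ′≡gψ′ u′ψ′≡1 ¬z′))

-- Auxiliary facts on finite subsets and absolute values.

module _ {n p} {P : Fin n → Set p} (P? : Decidable P) where

  comprehension : Subset n
  comprehension = Vec.tabulate (does ∘ P?)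

  ∈-comprehension⁺ : ∀ {i} → P i → i ∈ comprehension
  ∈-comprehension⁺ {i} pᵢ = lookup⇒[]= i comprehension (trans (lookup∘tabulate (does ∘ P?) i) (holds (P? i)))
    where
    holds : (d : Dec (P i)) → does d ≡ true
    holds (yes _)  = refl
    holds (no ¬pᵢ) = contradiction pᵢ ¬pᵢ

  ∈-comprehension⁻ : ∀ {i} → i ∈ comprehension → P i
  ∈-comprehension⁻ {i} i∈ = holds (P? i) (trans (sym (lookup∘tabulate (does ∘ P?) i)) ([]=⇒lookup i∈))
    where
    holds : (d : Dec (P i)) → does d ≡ true → P i
    holds (yes pᵢ) _ = pᵢ

-- Every strict inclusion raises the cardinality, so `suc n` of them in a row would exceed the size
-- of `Fin n`.
stabilises : ∀ {n} (S : ℕ → Subset n) → (∀ k → S k ⊆ S (suc k)) → ∃[ k ] S (suc k) ⊆ S k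
stabilises {n} S increasing = [ (λ stable → stable) , (λ n<∣S∣ → contradiction (∣p∣≤n (S (suc n))) (ℕ.<⇒≱ n<∣S∣)) ]′ (search (suc n))
  where
  search : ∀ k → (∃[ j ] S (suc j) ⊆ S j) ⊎ k ℕ.≤ ∣ S k ∣
  search zero    = inj₂ ℕ.z≤n
  search (suc k) with search k | S (suc k) ⊆? S k
  ... | inj₁ stable | _          = inj₁ stable
  ... | inj₂ _      | yes stable = inj₁ (k , stable)
  ... | inj₂ k≤     | no  grows  = inj₂ (ℕ.≤-<-trans k≤ (p⊂q⇒∣p∣<∣q∣ (increasing k , new)))
    where
    new : ∃[ i ] i ∈ S (suc k) × i ∉ S k
    new with any? (λ i → (i ∈? S (suc k)) ×-dec ¬? (i ∈? S k))
    ... | yes found = found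
    ... | no  none  = contradiction (λ {i} i∈ → decidable-stable (i ∈? S k) λ i∉ → none (i , i∈ , i∉)) grows

x∈p-y⁻ : ∀ {n} (p : Subset n) y {x} → x ∈ p - y → x ∈ p × x ≢ y
x∈p-y⁻ (s ∷ p) zero    (there x∈) = there (subst (_ ∈_) (p─⊥≡p p) x∈) , λ ()
x∈p-y⁻ (s ∷ p) (suc y) here       = here , λ ()
x∈p-y⁻ (s ∷ p) (suc y) (there x∈) = let x∈p , x≢y = x∈p-y⁻ p y x∈ in there x∈p , λ { refl → x≢y refl }

∣i∣≡∣j∣⇒i≡±j : ∀ i j → ℤ.∣ i ∣ ≡ ℤ.∣ j ∣ → i ≡ j ⊎ i ≡ ℤ.- j
∣i∣≡∣j∣⇒i≡±j (+ m)    (+ n)    refl = inj₁ refl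
∣i∣≡∣j∣⇒i≡±j (+ m)    -[1+ n ] refl = inj₂ refl
∣i∣≡∣j∣⇒i≡±j -[1+ m ] (+ n)    refl = inj₂ refl
∣i∣≡∣j∣⇒i≡±j -[1+ m ] -[1+ n ] refl = inj₁ refl

i≡-i⇒i≡0 : ∀ {i} → i ≡ ℤ.- i → i ≡ 0ℤ
i≡-i⇒i≡0 {+ zero} _ = refl

∣x+y∣≡∣x-y∣⇒y≡0 : ∀ {x y} → x ≢ 0ℤ → ℤ.∣ x + y ∣ ≡ ℤ.∣ x ℤ.- y ∣ → y ≡ 0ℤ
∣x+y∣≡∣x-y∣⇒y≡0 {x} {y} x≢0 eq with ∣i∣≡∣j∣⇒i≡±j (x + y) (x ℤ.- y) eq
... | inj₁ x+y≡x-y  = i≡-i⇒i≡0 (+-cancelˡ x y (ℤ.- y) x+y≡x-y)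
... | inj₂ x+y≡y-x  = contradiction (i≡-i⇒i≡0 (begin
    x                        ≡⟨ solve 2 (λ x y → x := (x :+ y) :- y) refl x y ⟩
    (x + y) ℤ.- y            ≡⟨ cong (ℤ._- y) x+y≡y-x ⟩
    ℤ.- (x ℤ.- y) ℤ.- y      ≡⟨ solve 2 (λ x y → :- (x :- y) :- y := :- x) refl x y ⟩
    ℤ.- x                    ∎)) x≢0
  where
  open ≡.≡-Reasoning
  open +-*-Solver

-- Matching the signs of one further column.

record BasisColumns {N} (A : Matrix N N) (B : Subset N) (μ : Fin N → ℕ) : Set where
  field
    row∉     : ∀ {r} → r ∉ B → ∀ e → A r e ≡ 0ℤ
    diagonal : ∀ {f} → f ∈ B → ∀ r → A r f ≡ + μ f * identity r f
    μ≢0      : ∀ {f} → f ∈ B → μ f ≢ 0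

  nonzero-row : ∀ {r e} → A r e ≢ 0ℤ → r ∈ B
  nonzero-row {r} {e} Aᵣₑ≢0 = decidable-stable (r ∈? B) λ r∉B → Aᵣₑ≢0 (row∉ r∉B e)

  diagonal≢0 : ∀ {f} → f ∈ B → A f f ≢ 0ℤ
  diagonal≢0 {f} f∈ eq = μ≢0 f∈ (ℤ.+-injective (trans (sym (trans (cong (+ μ f *_) (identity-≡ f)) (ℤ.*-identityʳ (+ μ f)))) (trans (sym (diagonal f∈ f)) eq)))

  off-diagonal : ∀ {r f} → f ∈ B → r ≢ f → A r f ≡ 0ℤ
  off-diagonal {r} {f} f∈ r≢f = trans (diagonal f∈ r) (trans (cong (+ μ f *_) (identity-≢ r≢f)) (ℤ.*-zeroʳ (+ μ f)))

  -- The diagonal columns other than `r` span the hyperplane where coordinate `r` is 0. These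
  -- functionals start the paths, and show that single entries of the two matrices agree up to sign.
  coordinate-spannedKernel : ∀ {r} → r ∈ B → SpannedKernel A B (identity r) (B - r)
  coordinate-spannedKernel {r} r∈ = record
    { supported   = λ s∉ → identity-≢ λ { refl → s∉ r∈ }
    ; annihilates = λ f f∈ → let f∈B , f≢r = x∈p-y⁻ B r f∈ in
                      trans (identity-· r (column A f)) (off-diagonal f∈B (f≢r ∘ sym))
    -- A functional killing the diagonal columns other than `r` vanishes on the rows of `B` other
    -- than `r`, so it cannot separate `w`.
    ; kernel      = λ w w∉ wᵣ≡0 → [ (λ span → span) , (λ (θ , kills , θw≢0) → contradiction
        (ℤL.sum-zero λ s → term w w∉ (trans (sym (identity-· r w)) wᵣ≡0) θ kills s) θw≢0) ]′ (span-or-functional (column A) (B - r) w)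
    }
    where
    term : ∀ w → (∀ {s} → s ∉ B → w s ≡ 0ℤ) → w r ≡ 0ℤ → ∀ θ → Annihilates θ (column A) (B - r) → ∀ s → θ s * w s ≡ 0ℤ
    term w w∉ wᵣ≡0 θ kills s with s ≟ r | s ∈? B
    ... | yes refl | _      = trans (cong (θ s *_) wᵣ≡0) (ℤ.*-zeroʳ (θ s))
    ... | no _     | no s∉  = trans (cong (θ s *_) (w∉ s∉)) (ℤ.*-zeroʳ (θ s))
    ... | no s≢r   | yes s∈ = cong (_* w s) (*-cancel-0 (trans (ℤ.*-comm (A s s) (θ s)) (trans
        (sym (ℤL.sum-single (λ t → θ t * A t s) s λ t t≢s → trans (cong (θ t *_) (off-diagonal s∈ t≢s)) (ℤ.*-zeroʳ (θ t))))
        (kills s (x∈p∧x≢y⇒x∈p-y s∈ s≢r)))) (diagonal≢0 s∈))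

-- `A″` is instantiated with the second matrix rescaled by the signs found so far, so the columns in
-- `L` agree literally. `equal` asks for `U ⊆ L` because only there does a spanned kernel carry over
-- to the second matrix.
module Step {N} {A A″ : Matrix N N} {B L : Subset N} {μ : Fin N → ℕ} (basisColumns : BasisColumns A B μ)
  (A″-row∉ : ∀ {r} → r ∉ B → ∀ e → A″ r e ≡ 0ℤ)
  (B⊆L : B ⊆ L) (agree : ∀ {e} → e ∈ L → ∀ r → A r e ≡ A″ r e)
  (equal : ∀ {φ U r} → φ r ≢ 0ℤ → U ⊆ L → SpannedKernel A B φ U →
           ∀ e → ℤ.∣ φ · column A e ∣ ≡ ℤ.∣ φ · column A″ e ∣)
  (c : Fin N) where

  open BasisColumns basisColumns

  a a″ : Vector ℤ N
  a  = column A c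
  a″ = column A″ c

  equal-entries : ∀ r → ℤ.∣ a r ∣ ≡ ℤ.∣ a″ r ∣
  equal-entries r with r ∈? B
  ... | no  r∉ = trans (cong ℤ.∣_∣ (row∉ r∉ c)) (sym (cong ℤ.∣_∣ (A″-row∉ r∉ c)))
  ... | yes r∈ = begin
    ℤ.∣ a r ∣                  ≡⟨ cong ℤ.∣_∣ (identity-· r a) ⟨
    ℤ.∣ identity r · a ∣       ≡⟨ equal {identity r} {B - r} {r} 1≢0 (λ f∈ → B⊆L (proj₁ (x∈p-y⁻ B r f∈))) (coordinate-spannedKernel r∈) c ⟩
    ℤ.∣ identity r · a″ ∣      ≡⟨ cong ℤ.∣_∣ (identity-· r a″) ⟩
    ℤ.∣ a″ r ∣                 ∎
    where
    open ≡.≡-Reasoning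
    1≢0 : identity r r ≢ 0ℤ
    1≢0 eq = contradiction (trans (sym (identity-≡ r)) eq) λ ()

  -- Splits the new column into the rows that agree and those that are opposite; `minus-only` makes
  -- the two supports disjoint.
  record SignSplit (r : Fin N) : Set where
    field
      plus minus : ℤ
      sum≡       : a r ≡ plus + minus
      difference : a″ r ≡ plus ℤ.- minus
      minus-only : minus ≢ 0ℤ → plus ≡ 0ℤ

  signSplit : ∀ r → SignSplit r
  signSplit r = [ same , opposite ]′ (∣i∣≡∣j∣⇒i≡±j (a r) (a″ r) (equal-entries r))
    where
    same : a r ≡ a″ r → SignSplit r
    same eq = record { plus = a r ; minus = 0ℤ ; sum≡ = sym (ℤ.+-identityʳ (a r)) ; difference = trans (sym eq) (sym (ℤ.+-identityʳ (a r)))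
                     ; minus-only = λ 0≢0 → contradiction refl 0≢0 }
    opposite : a r ≡ ℤ.- a″ r → SignSplit r
    opposite eq = record { plus = 0ℤ ; minus = a r ; sum≡ = sym (ℤ.+-identityˡ (a r))
                         ; difference = trans (sym (ℤ.neg-involutive (a″ r))) (trans (cong ℤ.-_ (sym eq)) (sym (ℤ.+-identityˡ _)))
                         ; minus-only = λ _ → refl }

  abstract
    a⁺ a⁻ : Vector ℤ N
    a⁺ r = SignSplit.plus (signSplit r)
    a⁻ r = SignSplit.minus (signSplit r)

    a≡a⁺+a⁻ : ∀ r → a r ≡ a⁺ r + a⁻ r
    a≡a⁺+a⁻ r = SignSplit.sum≡ (signSplit r)

    a″≡a⁺-a⁻ : ∀ r → a″ r ≡ a⁺ r ℤ.- a⁻ r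
    a″≡a⁺-a⁻ r = SignSplit.difference (signSplit r)

    a⁻≢0⇒a⁺≡0 : ∀ {r} → a⁻ r ≢ 0ℤ → a⁺ r ≡ 0ℤ
    a⁻≢0⇒a⁺≡0 {r} = SignSplit.minus-only (signSplit r)

  a⁻≢0⇒∈B : ∀ {r} → a⁻ r ≢ 0ℤ → r ∈ B
  a⁻≢0⇒∈B {r} a⁻≢0 = nonzero-row {r} {c} λ a≡0 → a⁻≢0 (trans (sym (ℤ.+-identityˡ (a⁻ r)))
    (trans (cong (_+ a⁻ r) (sym (a⁻≢0⇒a⁺≡0 a⁻≢0))) (trans (sym (a≡a⁺+a⁻ r)) a≡0)))

  Touched : Subset N → Fin N → Set
  Touched S e = ∃[ r ] r ∈ S × A r e ≢ 0ℤ

  touched? : ∀ S e → Dec (Touched S e)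
  touched? S e = any? λ r → (r ∈? S) ×-dec ¬? (A r e ℤ.≟ 0ℤ)

  Reaches : Subset N → Fin N → Set
  Reaches S r = a⁻ r ≢ 0ℤ ⊎ ∃[ e ] e ∈ L × Touched S e × A r e ≢ 0ℤ

  reaches? : ∀ S r → Dec (Reaches S r)
  reaches? S r = ¬? (a⁻ r ℤ.≟ 0ℤ) ⊎-dec any? λ e → (e ∈? L) ×-dec (touched? S e ×-dec ¬? (A r e ℤ.≟ 0ℤ))

  -- The rows at distance less than n from the support of a⁻, in the bipartite graph of the columns in L.
  reach : ℕ → Subset N
  reach zero    = ∅
  reach (suc n) = comprehension (reaches? (reach n))

  reach⁺ : ∀ n {r} → Reaches (reach n) r → r ∈ reach (suc n)
  reach⁺ n = ∈-comprehension⁺ (reaches? (reach n))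

  reach⁻ : ∀ n {r} → r ∈ reach (suc n) → Reaches (reach n) r
  reach⁻ n = ∈-comprehension⁻ (reaches? (reach n))

  Touched-mono : ∀ {S S′ e} → S ⊆ S′ → Touched S e → Touched S′ e
  Touched-mono S⊆S′ (r , r∈ , A≢0) = r , S⊆S′ r∈ , A≢0

  reach-mono : ∀ n → reach n ⊆ reach (suc n)
  reach-mono zero    r∈ = contradiction r∈ ∉⊥
  reach-mono (suc n) r∈ with reach⁻ n r∈
  ... | inj₁ a⁻≢0                = reach⁺ (suc n) (inj₁ a⁻≢0)
  ... | inj₂ (e , e∈ , t , A≢0)  = reach⁺ (suc n) (inj₂ (e , e∈ , Touched-mono (reach-mono n) t , A≢0))

  -- A functional supported on a shortest path from the support of a⁻ to r.
  record PathFunctional (n : ℕ) (r : Fin N) : Set where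
    field
      φ         : Vector ℤ N
      U         : Subset N
      spanned   : SpannedKernel A B φ U
      U⊆L       : U ⊆ L
      -- Ensures that a row outside `reach (suc n)` vanishes on all of `U` except possibly its own
      -- diagonal column.
      U-touched : ∀ {e} → e ∈ U → e ∈ B ⊎ Touched (reach n) e
      φᵣ≢0      : φ r ≢ 0ℤ
      support   : ∀ {b} → φ b ≢ 0ℤ → b ∈ reach n ⊎ b ≡ r
      φa⁻≢0     : φ · a⁻ ≢ 0ℤ

  coordinate-path : ∀ {r} n → a⁻ r ≢ 0ℤ → PathFunctional n r
  coordinate-path {r} n a⁻≢0 = record
    { φ         = identity r
    ; U         = B - r
    ; spanned   = coordinate-spannedKernel (a⁻≢0⇒∈B a⁻≢0)
    ; U⊆L       = λ f∈ → B⊆L (proj₁ (x∈p-y⁻ B r f∈))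
    ; U-touched = λ f∈ → inj₁ (proj₁ (x∈p-y⁻ B r f∈))
    ; φᵣ≢0      = λ eq → contradiction (trans (sym (identity-≡ r)) eq) λ ()
    ; support   = λ {b} φ≢0 → inj₂ (sym (decidable-stable (r ≟ b) λ r≢b → φ≢0 (identity-≢ r≢b)))
    ; φa⁻≢0     = λ eq → a⁻≢0 (trans (sym (identity-· r a⁻)) eq)
    }

  -- The path through r′ is extended by the column e to the new row r. Because r is not reached
  -- earlier, the columns used before vanish in row r, and e vanishes in the rows before r′.
  module Extend {n r r′ e} (path : PathFunctional n r′) (r∉ : r ∉ reach (suc n))
    (r′∈ : r′ ∈ reach (suc n)) (e∈L : e ∈ L) (Aᵣₑ≢0 : A r e ≢ 0ℤ) (Aᵣ′ₑ≢0 : A r′ e ≢ 0ℤ) where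

    open ≡.≡-Reasoning
    private module Old = PathFunctional path
    open SpannedKernel Old.spanned

    r∈B : r ∈ B
    r∈B = nonzero-row Aᵣₑ≢0

    p q : ℤ
    p = A r e
    q = Old.φ · column A e

    -- Up to scale, the one combination of φ and coordinate `r` that kills column `e`: its value
    -- there is p q - q p.
    ψ : Vector ℤ N
    ψ b = p * Old.φ b ℤ.- q * identity r b

    -- Column `e` replaces the diagonal column of `r`, which ψ no longer kills.
    U′ : Subset N
    U′ = (Old.U - r) ∪ ⁅ e ⁆

    ¬touched : ¬ Touched (reach n) e
    ¬touched t = r∉ (reach⁺ n (inj₂ (e , e∈L , t , Aᵣₑ≢0)))

    ψ-· : ∀ w → ψ · w ≡ p * Old.φ · w ℤ.- q * w r
    ψ-· w = begin
      ψ · w                                                                ≡⟨ ℤL.·-comm ψ w ⟩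
      w · ψ                                                                ≡⟨ ℤL.·-- w (λ b → p * Old.φ b) (λ b → q * identity r b) ⟩
      w · (λ b → p * Old.φ b) ℤ.- w · (λ b → q * identity r b)             ≡⟨ cong₂ ℤ._-_ (ℤL.·-* w p Old.φ) (ℤL.·-* w q (identity r)) ⟩
      p * w · Old.φ ℤ.- q * w · identity r                                 ≡⟨ cong₂ (λ s t → p * s ℤ.- q * t) (ℤL.·-comm w Old.φ) (trans (ℤL.·-comm w (identity r)) (identity-· r w)) ⟩
      p * Old.φ · w ℤ.- q * w r                                            ∎

    q≢0 : q ≢ 0ℤ
    q≢0 q≡0 = *-≢0 Old.φᵣ≢0 Aᵣ′ₑ≢0 (trans (sym (ℤL.sum-single (λ b → Old.φ b * A b e) r′ term)) q≡0)
      where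
      term : ∀ b → b ≢ r′ → Old.φ b * A b e ≡ 0ℤ
      term b b≢r′ with Old.φ b ℤ.≟ 0ℤ | A b e ℤ.≟ 0ℤ
      ... | yes φ≡0 | _       = cong (_* A b e) φ≡0
      ... | no  _   | yes A≡0 = trans (cong (Old.φ b *_) A≡0) (ℤ.*-zeroʳ (Old.φ b))
      ... | no  φ≢0 | no  A≢0 = [ (λ b∈ → contradiction (b , b∈ , A≢0) ¬touched) , (λ b≡r′ → contradiction b≡r′ b≢r′) ]′ (Old.support φ≢0)

    old-column : ∀ {f} → f ∈ Old.U → f ≢ r → A r f ≡ 0ℤ
    old-column {f} f∈ f≢r = [ (λ f∈B → off-diagonal f∈B (f≢r ∘ sym))
      , (λ t → decidable-stable (A r f ℤ.≟ 0ℤ) λ A≢0 → r∉ (reach⁺ n (inj₂ (f , Old.U⊆L f∈ , t , A≢0)))) ]′ (Old.U-touched f∈)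

    annihilates′ : Annihilates ψ (column A) U′
    annihilates′ f f∈ = trans (ψ-· (column A f)) ([ old , new ]′ (x∈p∪q⁻ (Old.U - r) ⁅ e ⁆ f∈))
      where
      old : f ∈ Old.U - r → p * Old.φ · column A f ℤ.- q * A r f ≡ 0ℤ
      old f∈ = let f∈U , f≢r = x∈p-y⁻ Old.U r f∈ in cong₂ ℤ._-_
        (trans (cong (p *_) (annihilates f f∈U)) (ℤ.*-zeroʳ p))
        (trans (cong (q *_) (old-column f∈U f≢r)) (ℤ.*-zeroʳ q))
      new : f ∈ ⁅ e ⁆ → p * Old.φ · column A f ℤ.- q * A r f ≡ 0ℤ
      new f∈e with x∈⁅y⁆⇒x≡y e f∈e
      ... | refl = trans (cong (λ z → z ℤ.- q * p) (ℤ.*-comm p q)) (ℤ.+-inverseʳ (q * p))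

    project : Vector ℤ N → Vector ℤ N
    project w b = p * w b ℤ.- w r * A b e

    φ-project : ∀ w → ψ · w ≡ 0ℤ → Old.φ · project w ≡ 0ℤ
    φ-project w ψw≡0 = begin
      Old.φ · project w                                                      ≡⟨ ℤL.·-- Old.φ (λ b → p * w b) (λ b → w r * A b e) ⟩
      Old.φ · (λ b → p * w b) ℤ.- Old.φ · (λ b → w r * A b e)                ≡⟨ cong₂ ℤ._-_ (ℤL.·-* Old.φ p w) (trans (ℤL.·-* Old.φ (w r) (column A e)) (ℤ.*-comm (w r) q)) ⟩
      p * Old.φ · w ℤ.- q * w r                                              ≡⟨ ψ-· w ⟨
      ψ · w                                                                  ≡⟨ ψw≡0 ⟩
      0ℤ                                                                     ∎

    lift : ∀ w → ℚSpan (column A) Old.U (project w) → ℚSpan (column A) U′ w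
    lift w (k , k≢0 , α , α∉ , kw′≡) = k * p , *-≢0 k≢0 Aᵣₑ≢0 ,
      ℤ-Linear.Span-+ (column A) U′ {λ b → k * project w b} {λ b → k * w r * A b e}
        (ℤL.Span-mono (column A) (p⊆p∪q ⁅ e ⁆) (α , α∉′ , kw′≡))
        (ℤ-Linear.Span-* (column A) U′ {column A e} (k * w r) (ℝE.ℤ-span-generator A (q⊆p∪q (Old.U - r) ⁅ e ⁆ (x∈⁅x⁆ e))) λ b → refl)
        λ b → solve 5 (λ k p w wᵣ x → k :* p :* w := k :* (p :* w :- wᵣ :* x) :+ k :* wᵣ :* x) refl k p (w b) (w r) (A b e)
      where
      open +-*-Solver
      -- Row `r` of `project w` is 0, and among the columns of the old `U` only that of `r` can be
      -- nonzero in this row. Hence column `r` has coefficient 0 and can be removed from `U`.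
      αᵣAᵣᵣ≡0 : A r r * α r ≡ 0ℤ
      αᵣAᵣᵣ≡0 = begin
        A r r * α r                 ≡⟨ ℤ.*-comm (A r r) (α r) ⟩
        α r * A r r                 ≡⟨ ℤL.sum-single (λ f → α f * A r f) r term ⟨
        α · A r                     ≡⟨ kw′≡ r ⟨
        k * (p * w r ℤ.- w r * p)   ≡⟨ solve 3 (λ k p w → k :* (p :* w :- w :* p) := con 0ℤ) refl k p (w r) ⟩
        0ℤ                          ∎
        where
        term : ∀ f → f ≢ r → α f * A r f ≡ 0ℤ
        term f f≢r with f ∈? Old.U
        ... | yes f∈ = trans (cong (α f *_) (old-column f∈ f≢r)) (ℤ.*-zeroʳ (α f))
        ... | no  f∉ = cong (_* A r f) (α∉ f f∉)
      α∉′ : ∀ f → f ∉ Old.U - r → α f ≡ 0ℤ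
      α∉′ f f∉ with f ≟ r
      ... | yes refl = *-cancel-0 αᵣAᵣᵣ≡0 (diagonal≢0 r∈B)
      ... | no  f≢r  = α∉ f λ f∈ → f∉ (x∈p∧x≢y⇒x∈p-y f∈ f≢r)

    φᵣ≡0 : Old.φ r ≡ 0ℤ
    φᵣ≡0 = decidable-stable (Old.φ r ℤ.≟ 0ℤ) λ φ≢0 →
      [ (λ r∈ → r∉ (reach-mono n r∈)) , (λ r≡r′ → r∉ (subst (_∈ reach (suc n)) (sym r≡r′) r′∈)) ]′ (Old.support φ≢0)

    support′ : ∀ {b} → ψ b ≢ 0ℤ → b ∈ reach (suc n) ⊎ b ≡ r
    support′ {b} ψ≢0 with b ≟ r
    ... | yes b≡r = inj₂ b≡r
    ... | no  b≢r = inj₁ ([ reach-mono n , (λ b≡r′ → subst (_∈ reach (suc n)) (sym b≡r′) r′∈) ]′ (Old.support λ φ≡0 →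
      ψ≢0 (cong₂ ℤ._-_ (trans (cong (p *_) φ≡0) (ℤ.*-zeroʳ p)) (trans (cong (q *_) (identity-≢ (b≢r ∘ sym))) (ℤ.*-zeroʳ q)))))

    ψᵣ≢0 : ψ r ≢ 0ℤ
    ψᵣ≢0 ψᵣ≡0 = q≢0 (begin
      q                                        ≡⟨ solve 2 (λ p q → q := :- (p :* con 0ℤ :- q :* con 1ℤ)) refl p q ⟩
      ℤ.- (p * 0ℤ ℤ.- q * 1ℤ)                  ≡⟨ cong₂ (λ s t → ℤ.- (p * s ℤ.- q * t)) φᵣ≡0 (identity-≡ r) ⟨
      ℤ.- ψ r                                  ≡⟨ cong ℤ.-_ ψᵣ≡0 ⟩
      0ℤ                                       ∎)
      where open +-*-Solver

    ψa⁻≢0 : ψ · a⁻ ≢ 0ℤ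
    ψa⁻≢0 ψa⁻≡0 = *-≢0 Aᵣₑ≢0 Old.φa⁻≢0 (begin
      p * Old.φ · a⁻                       ≡⟨ solve 2 (λ s q → s := s :- q :* con 0ℤ) refl (p * Old.φ · a⁻) q ⟩
      p * Old.φ · a⁻ ℤ.- q * 0ℤ            ≡⟨ cong (λ z → p * Old.φ · a⁻ ℤ.- q * z) a⁻ᵣ≡0 ⟨
      p * Old.φ · a⁻ ℤ.- q * a⁻ r          ≡⟨ ψ-· a⁻ ⟨
      ψ · a⁻                               ≡⟨ ψa⁻≡0 ⟩
      0ℤ                                   ∎)
      where
      open +-*-Solver
      a⁻ᵣ≡0 : a⁻ r ≡ 0ℤ
      a⁻ᵣ≡0 = decidable-stable (a⁻ r ℤ.≟ 0ℤ) λ a⁻≢0 → r∉ (reach⁺ n (inj₁ a⁻≢0))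

    extended : PathFunctional (suc n) r
    extended = record
      { φ         = ψ
      ; U         = U′
      ; spanned   = record
        { supported   = λ b∉ → cong₂ ℤ._-_ (trans (cong (p *_) (supported b∉)) (ℤ.*-zeroʳ p))
            (trans (cong (q *_) (identity-≢ λ { refl → b∉ r∈B })) (ℤ.*-zeroʳ q))
        ; annihilates = annihilates′
        ; kernel      = λ w w∉ ψw≡0 → lift w (kernel (project w)
            (λ b∉ → cong₂ ℤ._-_ (trans (cong (p *_) (w∉ b∉)) (ℤ.*-zeroʳ p)) (trans (cong (w r *_) (row∉ b∉ e)) (ℤ.*-zeroʳ (w r))))
            (φ-project w ψw≡0))
        }
      ; U⊆L       = λ f∈ → [ (λ f∈ → Old.U⊆L (proj₁ (x∈p-y⁻ Old.U r f∈))) , (λ f∈e → subst (_∈ L) (sym (x∈⁅y⁆⇒x≡y e f∈e)) e∈L) ]′ (x∈p∪q⁻ (Old.U - r) ⁅ e ⁆ f∈)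
      ; U-touched = λ f∈ → [ (λ f∈ → [ inj₁ , (λ t → inj₂ (Touched-mono (reach-mono n) t)) ]′ (Old.U-touched (proj₁ (x∈p-y⁻ Old.U r f∈))))
                           , (λ f∈e → inj₂ (subst (Touched (reach (suc n))) (sym (x∈⁅y⁆⇒x≡y e f∈e)) (r′ , r′∈ , Aᵣ′ₑ≢0))) ]′ (x∈p∪q⁻ (Old.U - r) ⁅ e ⁆ f∈)
      ; φᵣ≢0      = ψᵣ≢0
      ; support   = support′
      ; φa⁻≢0     = ψa⁻≢0
      }

  pathFunctional : ∀ n {r} → r ∈ reach (suc n) → r ∉ reach n → PathFunctional n r
  pathFunctional n r∈ r∉ with reach⁻ n r∈
  pathFunctional n       r∈ r∉ | inj₁ a⁻≢0 = coordinate-path n a⁻≢0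
  pathFunctional zero    r∈ r∉ | inj₂ (e , e∈L , (r′ , r′∈ , _) , _) = contradiction r′∈ ∉⊥
  pathFunctional (suc n) {r} r∈ r∉ | inj₂ (e , e∈L , (r′ , r′∈ , Aᵣ′ₑ≢0) , Aᵣₑ≢0) =
    -- Minimality passes to `r′`: had it been reached earlier, column `e` would have made `r`
    -- reachable earlier as well.
    Extend.extended {n} {r} {r′} {e} (pathFunctional n r′∈ λ r′∈n → r∉ (reach⁺ n (inj₂ (e , e∈L , (r′ , r′∈n , Aᵣ′ₑ≢0) , Aᵣₑ≢0))))
      r∉ r′∈ e∈L Aᵣₑ≢0 Aᵣ′ₑ≢0

  -- |φ a⁺ + φ a⁻| = |φ a⁺ − φ a⁻| forces one of the two values to vanish.
  reach-avoids-a⁺ : ∀ n {r} → r ∈ reach n → a⁺ r ≡ 0ℤ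
  reach-avoids-a⁺ zero    r∈ = contradiction r∈ ∉⊥
  reach-avoids-a⁺ (suc n) {r} r∈ with r ∈? reach n
  ... | yes r∈n = reach-avoids-a⁺ n r∈n
  ... | no  r∉n = *-cancel-0 (trans (sym φa⁺) φa⁺≡0) φᵣ≢0
    where
    open PathFunctional (pathFunctional n r∈ r∉n)
    open ≡.≡-Reasoning
    -- By induction a⁺ vanishes on the rows reached before `r`, so of the whole support of φ only
    -- `r` contributes to φ · a⁺.
    term : ∀ b → b ≢ r → φ b * a⁺ b ≡ 0ℤ
    term b b≢r with φ b ℤ.≟ 0ℤ
    ... | yes φ≡0 = cong (_* a⁺ b) φ≡0
    ... | no  φ≢0 = [ (λ b∈ → trans (cong (φ b *_) (reach-avoids-a⁺ n b∈)) (ℤ.*-zeroʳ (φ b))) , (λ b≡r → contradiction b≡r b≢r) ]′ (support φ≢0)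
    φa⁺ : φ · a⁺ ≡ φ r * a⁺ r
    φa⁺ = ℤL.sum-single (λ b → φ b * a⁺ b) r term
    φa⁺≡0 : φ · a⁺ ≡ 0ℤ
    φa⁺≡0 = ∣x+y∣≡∣x-y∣⇒y≡0 φa⁻≢0 (begin
      ℤ.∣ φ · a⁻ + φ · a⁺ ∣          ≡⟨ cong ℤ.∣_∣ (ℤ.+-comm (φ · a⁻) (φ · a⁺)) ⟩
      ℤ.∣ φ · a⁺ + φ · a⁻ ∣          ≡⟨ cong ℤ.∣_∣ (trans (ℤL.·-cong {u = φ} (λ _ → refl) a≡a⁺+a⁻) (ℤL.·-+ φ a⁺ a⁻)) ⟨
      ℤ.∣ φ · a ∣                    ≡⟨ equal {φ} {U} {r} φᵣ≢0 U⊆L spanned c ⟩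
      ℤ.∣ φ · a″ ∣                   ≡⟨ cong ℤ.∣_∣ (trans (ℤL.·-cong {u = φ} (λ _ → refl) a″≡a⁺-a⁻) (ℤL.·-- φ a⁺ a⁻)) ⟩
      ℤ.∣ φ · a⁺ ℤ.- φ · a⁻ ∣        ≡⟨ ℤ.∣i-j∣≡∣j-i∣ (φ · a⁺) (φ · a⁻) ⟩
      ℤ.∣ φ · a⁻ ℤ.- φ · a⁺ ∣        ∎)

  module _ {n} (stable : reach (suc n) ⊆ reach n) where

    private
      F = reach n

    closed : ∀ {r e} → e ∈ L → Touched F e → A r e ≢ 0ℤ → r ∈ F
    closed e∈ t A≢0 = stable (reach⁺ n (inj₂ (_ , e∈ , t , A≢0)))

    row-sign : ∀ {r} → Dec (r ∈ F) → ℤ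
    row-sign (yes _) = -1ℤ
    row-sign (no _)  = 1ℤ

    -- Column `c` keeps the sign 1 even when touched: negating all rows of a⁻ and no row of a⁺
    -- already turns `a″` into `a`.
    column-sign : ∀ {e} → Dec (e ≡ c) → Dec (Touched F e) → ℤ
    column-sign (no _) (yes _) = -1ℤ
    column-sign _      _       = 1ℤ

    row-sign-isSign : ∀ {r} (d : Dec (r ∈ F)) → IsSign (row-sign d)
    row-sign-isSign (yes _) = inj₂ refl
    row-sign-isSign (no _)  = inj₁ refl

    column-sign-isSign : ∀ {e} (d : Dec (e ≡ c)) (t : Dec (Touched F e)) → IsSign (column-sign d t)
    column-sign-isSign (yes _) (yes _) = inj₁ refl
    column-sign-isSign (yes _) (no _)  = inj₁ refl
    column-sign-isSign (no _)  (yes _) = inj₂ refl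
    column-sign-isSign (no _)  (no _)  = inj₁ refl

    -- In a column of `L` other than `c`, a nonzero entry lies in a row of `F` exactly when the
    -- column touches `F`, so row and column signs cancel. In column `c`, `F` contains the support
    -- of a⁻ and avoids that of a⁺.
    sign-matching : ∀ {r e} → e ∈ L ∪ ⁅ c ⁆ → (dᵣ : Dec (r ∈ F)) (dₑ : Dec (e ≡ c)) (t : Dec (Touched F e)) →
      A r e ≡ row-sign dᵣ * A″ r e * column-sign dₑ t
    sign-matching {r} e∈ (yes r∈) (yes refl) t = begin
      a r                            ≡⟨ a≡a⁺+a⁻ r ⟩
      a⁺ r + a⁻ r                    ≡⟨ cong (_+ a⁻ r) a⁺ᵣ≡0 ⟩
      0ℤ + a⁻ r                      ≡⟨ solve 1 (λ y → con 0ℤ :+ y := con -1ℤ :* (con 0ℤ :- y) :* con 1ℤ) refl (a⁻ r) ⟩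
      -1ℤ * (0ℤ ℤ.- a⁻ r) * 1ℤ       ≡⟨ cong (λ z → -1ℤ * (z ℤ.- a⁻ r) * 1ℤ) a⁺ᵣ≡0 ⟨
      -1ℤ * (a⁺ r ℤ.- a⁻ r) * 1ℤ     ≡⟨ cong (λ z → -1ℤ * z * 1ℤ) (a″≡a⁺-a⁻ r) ⟨
      -1ℤ * a″ r * 1ℤ                ∎
      where
      open ≡.≡-Reasoning
      open +-*-Solver
      a⁺ᵣ≡0 = reach-avoids-a⁺ n r∈
    sign-matching {r} e∈ (no r∉) (yes refl) t = begin
      a r                            ≡⟨ a≡a⁺+a⁻ r ⟩
      a⁺ r + a⁻ r                    ≡⟨ cong (λ z → a⁺ r + z) a⁻ᵣ≡0 ⟩
      a⁺ r + 0ℤ                      ≡⟨ solve 1 (λ y → y :+ con 0ℤ := con 1ℤ :* (y :- con 0ℤ) :* con 1ℤ) refl (a⁺ r) ⟩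
      1ℤ * (a⁺ r ℤ.- 0ℤ) * 1ℤ        ≡⟨ cong (λ z → 1ℤ * (a⁺ r ℤ.- z) * 1ℤ) a⁻ᵣ≡0 ⟨
      1ℤ * (a⁺ r ℤ.- a⁻ r) * 1ℤ      ≡⟨ cong (λ z → 1ℤ * z * 1ℤ) (a″≡a⁺-a⁻ r) ⟨
      1ℤ * a″ r * 1ℤ                 ∎
      where
      open ≡.≡-Reasoning
      open +-*-Solver
      a⁻ᵣ≡0 : a⁻ r ≡ 0ℤ
      a⁻ᵣ≡0 = decidable-stable (a⁻ r ℤ.≟ 0ℤ) λ a⁻≢0 → r∉ (stable (reach⁺ n (inj₁ a⁻≢0)))
    sign-matching {r} {e} e∈ dᵣ (no e≢c) t = trans (agree e∈L r) (match dᵣ t)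
      where
      open +-*-Solver
      e∈L : e ∈ L
      e∈L = [ (λ e∈L → e∈L) , (λ e∈c → contradiction (x∈⁅y⁆⇒x≡y c e∈c) e≢c) ]′ (x∈p∪q⁻ L ⁅ c ⁆ e∈)
      vanishing : ∀ s t → ¬ A r e ≢ 0ℤ → A″ r e ≡ s * A″ r e * t
      vanishing s t ¬A≢0 with trans (sym (agree e∈L r)) (decidable-stable (A r e ℤ.≟ 0ℤ) ¬A≢0)
      ... | A″≡0 rewrite A″≡0 | ℤ.*-zeroʳ s = refl
      match : ∀ (dᵣ : Dec (r ∈ F)) (t : Dec (Touched F e)) → A″ r e ≡ row-sign dᵣ * A″ r e * column-sign (no e≢c) t
      match (yes _)  (yes _)  = solve 1 (λ y → y := con -1ℤ :* y :* con -1ℤ) refl (A″ r e)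
      match (no _)   (no _)   = solve 1 (λ y → y := con 1ℤ :* y :* con 1ℤ) refl (A″ r e)
      match (yes r∈) (no ¬t)  = vanishing -1ℤ 1ℤ λ A≢0 → ¬t (r , r∈ , A≢0)
      match (no r∉)  (yes t)  = vanishing 1ℤ -1ℤ λ A≢0 → r∉ (closed e∈L t A≢0)

  extend-agreement : Σ (Vector ℤ N) λ ρ → Σ (Vector ℤ N) λ θ →
    (∀ r → IsSign (ρ r)) × (∀ e → IsSign (θ e)) × (∀ {e} → e ∈ L ∪ ⁅ c ⁆ → ∀ r → A r e ≡ ρ r * A″ r e * θ e)
  extend-agreement =
    let n , stable = stabilises reach reach-mono
    in (λ r → row-sign {n} stable (r ∈? reach n)) , (λ e → column-sign {n} stable (e ≟ c) (touched? (reach n) e))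
       , (λ r → row-sign-isSign {n} stable (r ∈? reach n)) , (λ e → column-sign-isSign {n} stable (e ≟ c) (touched? (reach n) e))
       , λ {e} e∈ r → sign-matching {n} stable e∈ (r ∈? reach n) (e ≟ c) (touched? (reach n) e)

-- Sign equivalence on all columns.

IsSign-* : ∀ {s t} → IsSign s → IsSign t → IsSign (s * t)
IsSign-* (inj₁ refl) (inj₁ refl) = inj₁ refl
IsSign-* (inj₁ refl) (inj₂ refl) = inj₂ refl
IsSign-* (inj₂ refl) (inj₁ refl) = inj₂ refl
IsSign-* (inj₂ refl) (inj₂ refl) = inj₁ refl

sign≢0 : ∀ {s} → IsSign s → s ≢ 0ℤ
sign≢0 (inj₁ refl) ()
sign≢0 (inj₂ refl) ()

∣i*s∣≡∣i∣ : ∀ i {s} → IsSign s → ℤ.∣ i * s ∣ ≡ ℤ.∣ i ∣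
∣i*s∣≡∣i∣ i (inj₁ refl) = cong ℤ.∣_∣ (ℤ.*-identityʳ i)
∣i*s∣≡∣i∣ i (inj₂ refl) = trans (ℤ.abs-* i -1ℤ) (ℕ.*-identityʳ ℤ.∣ i ∣)

module _ {N} (A A′ : Matrix N N) where

  SignEquivalentOn : (Fin N → Set) → (σ τ : Vector ℤ N) → Set
  SignEquivalentOn P σ τ = (∀ r → IsSign (σ r)) × (∀ e → IsSign (τ e)) ×
    (∀ {e} → P e → ∀ r → A r e ≡ σ r * A′ r e * τ e)

module _ {N} {A A′ : Matrix N N} {B : Subset N} {μ : Fin N → ℕ}
  (basisColumns : BasisColumns A B μ) (basisColumns′ : BasisColumns A′ B μ)
  (equal : ∀ {φ σ : Vector ℤ N} {r U} → φ r ≢ 0ℤ → (∀ r → IsSign (σ r)) →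
    SpannedKernel A B φ U → SpannedKernel A′ B (λ r → σ r * φ r) U →
    ∀ e → ℤ.∣ φ · column A e ∣ ≡ ℤ.∣ (λ r → σ r * φ r) · column A′ e ∣)
  where

  open ≡.≡-Reasoning
  open +-*-Solver

  module _ {L : Subset N} {σ τ : Vector ℤ N} (equivalent : SignEquivalentOn A A′ (_∈ L) σ τ) where

    private
      σ-sign = proj₁ equivalent
      τ-sign = proj₁ (proj₂ equivalent)
      agree  = proj₂ (proj₂ equivalent)

    rescaled : Matrix N N
    rescaled r e = σ r * A′ r e * τ e

    ·-rescaled : ∀ φ e → φ · column rescaled e ≡ (λ r → σ r * φ r) · column A′ e * τ e
    ·-rescaled φ e = begin
      φ · column rescaled e                                    ≡⟨ ℤL.sum-cong-≋ {N} (λ r → solve 4 (λ p s a t → p :* (s :* a :* t) := s :* p :* a :* t) refl (φ r) (σ r) (A′ r e) (τ e)) ⟩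
      ℤL.sum (λ r → σ r * φ r * A′ r e * τ e)                  ≡⟨ ℤL.*-distribʳ-sum (τ e) (λ r → σ r * φ r * A′ r e) ⟨
      (λ r → σ r * φ r) · column A′ e * τ e                    ∎

    -- On `L` the two matrices differ by diag(σ) and diag(τ), which are their own inverses. A
    -- relation in the columns of `U` therefore transports with coefficients multiplied by τ, and
    -- the same `U` serves both matrices.
    spanned′ : ∀ {φ U} → U ⊆ L → SpannedKernel A B φ U → SpannedKernel A′ B (λ r → σ r * φ r) U
    spanned′ {φ} {U} U⊆L spanned = record
      { supported   = λ {r} r∉ → trans (cong (σ r *_) (supported r∉)) (ℤ.*-zeroʳ (σ r))
      ; annihilates = λ e e∈ → *-cancel-0 (begin
          τ e * (λ r → σ r * φ r) · column A′ e      ≡⟨ ℤ.*-comm (τ e) _ ⟩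
          (λ r → σ r * φ r) · column A′ e * τ e      ≡⟨ ·-rescaled φ e ⟨
          φ · column rescaled e                      ≡⟨ ℤL.·-cong {u = φ} (λ _ → refl) (agree (U⊆L e∈)) ⟨
          φ · column A e                             ≡⟨ annihilates e e∈ ⟩
          0ℤ                                         ∎) (sign≢0 (τ-sign e))
      ; kernel      = λ w w∉ σφw≡0 → lift w (kernel (λ r → σ r * w r)
          (λ {r} r∉ → trans (cong (σ r *_) (w∉ r∉)) (ℤ.*-zeroʳ (σ r)))
          (trans (ℤL.sum-cong-≋ {N} λ r → solve 3 (λ p s w → p :* (s :* w) := s :* p :* w) refl (φ r) (σ r) (w r)) σφw≡0))
      }
      where
      open SpannedKernel spanned
      lift : ∀ w → ℚSpan (column A) U (λ r → σ r * w r) → ℚSpan (column A′) U w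
      lift w (k , k≢0 , α , α∉ , kσw≡) = k , k≢0 , (λ e → τ e * α e)
        , (λ e e∉ → trans (cong (τ e *_) (α∉ e e∉)) (ℤ.*-zeroʳ (τ e)))
        , λ r → begin
          k * w r                                          ≡⟨ ℤ.*-identityˡ _ ⟨
          1ℤ * (k * w r)                                   ≡⟨ cong (_* (k * w r)) (sign² (σ-sign r)) ⟨
          σ r * σ r * (k * w r)                            ≡⟨ solve 3 (λ s k w → s :* s :* (k :* w) := s :* (k :* (s :* w))) refl (σ r) k (w r) ⟩
          σ r * (k * (σ r * w r))                          ≡⟨ cong (σ r *_) (kσw≡ r) ⟩
          σ r * α · A r                                    ≡⟨ ℤL.*-distribˡ-sum (σ r) (λ e → α e * A r e) ⟩
          ℤL.sum (λ e → σ r * (α e * A r e))               ≡⟨ ℤL.sum-cong-≋ {N} (term r) ⟩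
          (λ e → τ e * α e) · A′ r                         ∎
        where
        term : ∀ r e → σ r * (α e * A r e) ≡ τ e * α e * A′ r e
        term r e with e ∈? U
        ... | yes e∈ = begin
          σ r * (α e * A r e)                        ≡⟨ cong (λ z → σ r * (α e * z)) (agree (U⊆L e∈) r) ⟩
          σ r * (α e * (σ r * A′ r e * τ e))         ≡⟨ solve 4 (λ s a x t → s :* (a :* (s :* x :* t)) := s :* s :* (t :* a :* x)) refl (σ r) (α e) (A′ r e) (τ e) ⟩
          σ r * σ r * (τ e * α e * A′ r e)           ≡⟨ cong (_* (τ e * α e * A′ r e)) (sign² (σ-sign r)) ⟩
          1ℤ * (τ e * α e * A′ r e)                  ≡⟨ ℤ.*-identityˡ _ ⟩
          τ e * α e * A′ r e                         ∎
        ... | no  e∉ = begin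
          σ r * (α e * A r e)                        ≡⟨ cong (λ z → σ r * (z * A r e)) (α∉ e e∉) ⟩
          σ r * 0ℤ                                   ≡⟨ ℤ.*-zeroʳ (σ r) ⟩
          0ℤ                                         ≡⟨ cong (_* A′ r e) (trans (cong (τ e *_) (α∉ e e∉)) (ℤ.*-zeroʳ (τ e))) ⟨
          τ e * α e * A′ r e                         ∎

    extend-equivalence : B ⊆ L → ∀ c → Σ (Vector ℤ N) λ σ′ → Σ (Vector ℤ N) λ τ′ → SignEquivalentOn A A′ (_∈ L ∪ ⁅ c ⁆) σ′ τ′
    extend-equivalence B⊆L c =
      let ρ , θ , ρ-sign , θ-sign , match = Step.extend-agreement {A = A} {rescaled} {B} {L} basisColumns
            (λ {r} r∉ e → cong (_* τ e) (trans (cong (σ r *_) (BasisColumns.row∉ basisColumns′ r∉ e)) (ℤ.*-zeroʳ (σ r))))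
            B⊆L agree
            (λ {φ} {U} {r} φᵣ≢0 U⊆L spanned e → trans (equal {φ} {σ} {r} {U} φᵣ≢0 σ-sign spanned (spanned′ U⊆L spanned) e)
              (trans (sym (∣i*s∣≡∣i∣ ((λ r → σ r * φ r) · column A′ e) (τ-sign e))) (cong ℤ.∣_∣ (sym (·-rescaled φ e)))))
            c
      in (λ r → ρ r * σ r) , (λ e → τ e * θ e) , (λ r → IsSign-* (ρ-sign r) (σ-sign r)) , (λ e → IsSign-* (τ-sign e) (θ-sign e))
         , λ {e} e∈ r → trans (match e∈ r) (solve 5 (λ p s a t h → p :* (s :* a :* t) :* h := p :* s :* a :* (t :* h)) refl (ρ r) (σ r) (A′ r e) (τ e) (θ e))

  -- The start is `L = B` with all signs 1: there both matrices carry the same diagonal entries μ.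
  -- Every later `L` contains `B`, since the coordinate functionals rely on its columns.
  sign-equivalent-on-list : ∀ (cs : List (Fin N)) → Σ (Subset N) λ L → B ⊆ L × (∀ {e} → e ∈ˡ cs → e ∈ L) ×
    Σ (Vector ℤ N) λ σ → Σ (Vector ℤ N) λ τ → SignEquivalentOn A A′ (_∈ L) σ τ
  sign-equivalent-on-list [] = B , (λ e∈ → e∈) , (λ ()) , (λ _ → 1ℤ) , (λ _ → 1ℤ) , (λ _ → inj₁ refl) , (λ _ → inj₁ refl)
    , λ {e} e∈ r → trans (trans (BasisColumns.diagonal basisColumns e∈ r) (sym (BasisColumns.diagonal basisColumns′ e∈ r)))
        (solve 1 (λ a → a := con 1ℤ :* a :* con 1ℤ) refl (A′ r e))
  sign-equivalent-on-list (c ∷ cs) =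
    let L , B⊆L , cs⊆L , σ , τ , equivalent = sign-equivalent-on-list cs
    in L ∪ ⁅ c ⁆ , (λ e∈ → p⊆p∪q ⁅ c ⁆ (B⊆L e∈))
       , (λ { (hereˡ refl) → q⊆p∪q L ⁅ c ⁆ (x∈⁅x⁆ c) ; (thereˡ e∈) → p⊆p∪q ⁅ c ⁆ (cs⊆L e∈) })
       , extend-equivalence equivalent B⊆L c

  sign-equivalent : Σ (Vector ℤ N) λ σ → Σ (Vector ℤ N) λ τ → (∀ r → IsSign (σ r)) × (∀ e → IsSign (τ e)) × (∀ r e → A r e ≡ σ r * A′ r e * τ e)
  sign-equivalent =
    let _ , _ , all∈ , σ , τ , σ-sign , τ-sign , match = sign-equivalent-on-list (allFin N)
    in σ , τ , σ-sign , τ-sign , λ r e → match (all∈ (∈-allFin e)) r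

-- From signs in coordinates to the matrices T and D.

frame-basisColumns : ∀ {d N} {X : Matrix d N} {B μ} (F : Frame X B μ) → BasisColumns (Frame.Q F ⊡ X) B μ
frame-basisColumns {d} {X = X} {μ = μ} F = record
  { row∉     = λ r∉ e → ℤL.sum-zero λ j → cong (_* X j e) (Q∉ r∉ j)
  ; diagonal = λ {f} f∈ r → begin
      Q r · column X f                      ≡⟨ ℤL.·-cong {u = Q r} (λ _ → refl) (scale f∈) ⟩
      Q r · (λ j → + μ f * P j f)           ≡⟨ ℤL.·-* (Q r) (+ μ f) (λ j → P j f) ⟩
      + μ f * (Q ⊡ P) r f                   ≡⟨ cong (+ μ f *_) (QP r f∈) ⟩
      + μ f * identity r f                  ∎
  ; μ≢0      = m≢0
  }
  where
  open Frame F
  open ≡.≡-Reasoning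

-- P′ diag(σ) Q: it sends the basis vector of `F` at `f` to σ(f) times that of `F′`.
transfer : ∀ {d N} {X X′ : Matrix d N} {B μ μ′} → Frame X B μ → Frame X′ B μ′ → Vector ℤ N → Matrix d d
transfer F F′ σ = Frame.P F′ ⊡ (λ r j → σ r * Frame.Q F r j)

-- The inverse uses the same signs. Although `QP` is the identity only on the columns in `B`, it is
-- followed here by `Q′`, whose rows off `B` vanish, so diag(σ) QP diag(σ) Q′ = Q′.
transfer-inverse : ∀ {d N} {X X′ : Matrix d N} {B μ μ′} (F : Frame X B μ) (F′ : Frame X′ B μ′) {σ : Vector ℤ N} →
  (∀ r → IsSign (σ r)) → transfer F F′ σ ⊡ transfer F′ F σ ≐ identity
transfer-inverse {d} {N} {B = B} F F′ {σ} signs i j = begin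
  (P′ ⊡ σQ ⊡ (P ⊡ σQ′)) i j                   ≡⟨ ⊡-assoc P′ σQ (P ⊡ σQ′) i j ⟩
  P′ i · (λ r → (σQ ⊡ (P ⊡ σQ′)) r j)         ≡⟨ ℤL.·-cong {u = P′ i} (λ _ → refl) (λ r → trans (sym (⊡-assoc σQ P σQ′ r j)) (middle r)) ⟩
  (P′ ⊡ Q′) i j                               ≡⟨ Frame.PQ F′ i j ⟩
  identity i j                                ∎
  where
  open ≡.≡-Reasoning
  open +-*-Solver
  P  = Frame.P F
  P′ = Frame.P F′
  Q  = Frame.Q F
  Q′ = Frame.Q F′
  σQ σQ′ : Matrix N d
  σQ  r k = σ r * Q r k
  σQ′ r k = σ r * Q′ r k
  σQP : ∀ r f → (σQ ⊡ P) r f ≡ σ r * (Q ⊡ P) r f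
  σQP r f = begin
    (σQ ⊡ P) r f                           ≡⟨ ℤL.sum-cong-≋ {d} (λ k → ℤ.*-assoc (σ r) (Q r k) (P k f)) ⟩
    ℤL.sum (λ k → σ r * (Q r k * P k f))   ≡⟨ ℤL.*-distribˡ-sum (σ r) (λ k → Q r k * P k f) ⟨
    σ r * (Q ⊡ P) r f                      ∎
  term : ∀ r f → (σQ ⊡ P) r f * σQ′ f j ≡ identity r f * (σ r * σ f * Q′ f j)
  term r f with f ∈? B
  ... | yes f∈ = begin
    (σQ ⊡ P) r f * σQ′ f j                     ≡⟨ cong (_* σQ′ f j) (trans (σQP r f) (cong (σ r *_) (Frame.QP F r f∈))) ⟩
    σ r * identity r f * (σ f * Q′ f j)        ≡⟨ solve 4 (λ s i t q → s :* i :* (t :* q) := i :* (s :* t :* q)) refl (σ r) (identity r f) (σ f) (Q′ f j) ⟩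
    identity r f * (σ r * σ f * Q′ f j)        ∎
  ... | no  f∉ = begin
    (σQ ⊡ P) r f * (σ f * Q′ f j)              ≡⟨ cong (λ z → (σQ ⊡ P) r f * (σ f * z)) Q′≡0 ⟩
    (σQ ⊡ P) r f * (σ f * 0ℤ)                  ≡⟨ solve 4 (λ s i t q → q :* (t :* con 0ℤ) := i :* (s :* t :* con 0ℤ)) refl (σ r) (identity r f) (σ f) ((σQ ⊡ P) r f) ⟩
    identity r f * (σ r * σ f * 0ℤ)            ≡⟨ cong (λ z → identity r f * (σ r * σ f * z)) Q′≡0 ⟨
    identity r f * (σ r * σ f * Q′ f j)        ∎
    where Q′≡0 = Frame.Q∉ F′ f∉ j
  middle : ∀ r → (σQ ⊡ P ⊡ σQ′) r j ≡ Q′ r j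
  middle r = begin
    (σQ ⊡ P ⊡ σQ′) r j                                ≡⟨ ℤL.sum-cong-≋ {N} (term r) ⟩
    identity r · (λ f → σ r * σ f * Q′ f j)           ≡⟨ identity-· r (λ f → σ r * σ f * Q′ f j) ⟩
    σ r * σ r * Q′ r j                                ≡⟨ cong (_* Q′ r j) (sign² (signs r)) ⟩
    1ℤ * Q′ r j                                       ≡⟨ ℤ.*-identityˡ (Q′ r j) ⟩
    Q′ r j                                            ∎

frame-transfer : ∀ {d N} {X X′ : Matrix d N} {B μ μ′} (F : Frame X B μ) (F′ : Frame X′ B μ′) {σ τ : Vector ℤ N} →
  (∀ r → IsSign (σ r)) → (∀ e → IsSign (τ e)) →
  (∀ r e → (Frame.Q F ⊡ X) r e ≡ σ r * (Frame.Q F′ ⊡ X′) r e * τ e) →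
  X′ ≐ transfer F F′ σ ⊡ X ⊡ (λ e f → identity e f * τ f)
frame-transfer {d} {N} {X} {X′} F F′ {σ} {τ} σ-sign τ-sign match i e = sym (begin
  (T ⊡ X ⊡ (λ e f → identity e f * τ f)) i e
    ≡⟨ ℤL.sum-single (λ f → (T ⊡ X) i f * (identity f e * τ e)) e (λ f f≢e → trans (cong (λ z → (T ⊡ X) i f * (z * τ e)) (identity-≢ f≢e)) (ℤ.*-zeroʳ ((T ⊡ X) i f))) ⟩
  (T ⊡ X) i e * (identity e e * τ e)
    ≡⟨ cong ((T ⊡ X) i e *_) (trans (cong (_* τ e) (identity-≡ e)) (ℤ.*-identityˡ (τ e))) ⟩
  (T ⊡ X) i e * τ e
    ≡⟨ cong (_* τ e) (⊡-assoc P′ (λ r j → σ r * Q r j) X i e) ⟩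
  P′ i · (λ r → (λ j → σ r * Q r j) · column X e) * τ e
    ≡⟨ cong (_* τ e) (ℤL.·-cong {u = P′ i} (λ _ → refl) entry) ⟩
  P′ i · (λ r → τ e * (Q′ ⊡ X′) r e) * τ e
    ≡⟨ cong (_* τ e) (ℤL.·-* (P′ i) (τ e) (λ r → (Q′ ⊡ X′) r e)) ⟩
  τ e * (P′ ⊡ (Q′ ⊡ X′)) i e * τ e
    ≡⟨ cong (λ z → τ e * z * τ e) (trans (sym (⊡-assoc P′ Q′ X′ i e)) (trans (ℤL.·-cong {v = column X′ e} (Frame.PQ F′ i) (λ _ → refl)) (identity-· i (column X′ e)))) ⟩
  τ e * X′ i e * τ e
    ≡⟨ solve 2 (λ t x → t :* x :* t := t :* t :* x) refl (τ e) (X′ i e) ⟩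
  τ e * τ e * X′ i e
    ≡⟨ cong (_* X′ i e) (sign² (τ-sign e)) ⟩
  1ℤ * X′ i e
    ≡⟨ ℤ.*-identityˡ (X′ i e) ⟩
  X′ i e ∎)
  where
  open ≡.≡-Reasoning
  open +-*-Solver
  P′ = Frame.P F′
  Q  = Frame.Q F
  Q′ = Frame.Q F′
  T  = transfer F F′ σ
  entry : ∀ r → (λ j → σ r * Q r j) · column X e ≡ τ e * (Q′ ⊡ X′) r e
  entry r = begin
    (λ j → σ r * Q r j) · column X e                  ≡⟨ ℤL.sum-cong-≋ {d} (λ j → ℤ.*-assoc (σ r) (Q r j) (X j e)) ⟩
    ℤL.sum (λ j → σ r * (Q r j * X j e))              ≡⟨ ℤL.*-distribˡ-sum (σ r) (λ j → Q r j * X j e) ⟨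
    σ r * (Q ⊡ X) r e                                 ≡⟨ cong (σ r *_) (match r e) ⟩
    σ r * (σ r * (Q′ ⊡ X′) r e * τ e)                 ≡⟨ solve 3 (λ s a t → s :* (s :* a :* t) := s :* s :* (t :* a)) refl (σ r) ((Q′ ⊡ X′) r e) (τ e) ⟩
    σ r * σ r * (τ e * (Q′ ⊡ X′) r e)                 ≡⟨ cong (_* (τ e * (Q′ ⊡ X′) r e)) (sign² (σ-sign r)) ⟩
    1ℤ * (τ e * (Q′ ⊡ X′) r e)                        ≡⟨ ℤ.*-identityˡ _ ⟩
    τ e * (Q′ ⊡ X′) r e                               ∎

sign-diagonal : ∀ {n} {τ : Vector ℤ n} → (∀ e → IsSign (τ e)) → IsSignDiagonal (λ e f → identity e f * τ f)
sign-diagonal {τ = τ} signs = (λ i j i≢j → cong (_* τ j) (identity-≢ i≢j))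
  , λ i → subst IsSign (sym (trans (cong (_* τ i) (identity-≡ i)) (ℤ.*-identityˡ (τ i)))) (signs i)

theorem1p1 : (d N : ℕ) → 1 ≤ d → d ≤ N →
    (X X′ : Matrix d N) → HasRank X ⊤ d → HasRank X′ ⊤ d →
    (𝒜 : ArithmeticMatroidData N) → Represents X 𝒜 → Represents X′ 𝒜 →
    IsWeaklyMultiplicative 𝒜 →
    Σ (Matrix d d) λ T → Σ (Matrix N N) λ D →
    InGL T × IsSignDiagonal D × X′ ≐ T ⊡ X ⊡ D
theorem1p1 d N _ _ X X′ full full′ 𝒜 rep rep′ (_ , B , basis , multiplicative) =
  let F  = frame X full 𝒜 rep basis multiplicative
      F′ = frame X′ full′ 𝒜 rep′ basis multiplicative
      σ , τ , σ-sign , τ-sign , match = sign-equivalent (frame-basisColumns F) (frame-basisColumns F′)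
        (λ {φ} {σ} {r} {U} → equal-values X X′ 𝒜 rep rep′ F F′ {φ} {σ} {r} {U})
  in transfer F F′ σ , (λ e f → identity e f * τ f)
     , (transfer F′ F σ , transfer-inverse F F′ σ-sign , transfer-inverse F′ F σ-sign)
     , sign-diagonal τ-sign
     , frame-transfer F F′ σ-sign τ-sign match
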